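{- Let $p\ge11$ be a prime. Then, modulo $p^4$ in $\mathbb{Z}_p$, \begin{align*} A^\star_{p-3}\equiv-\frac{1}{p-3}\Bigg(&\frac{37p^3}{12}-3p^2+\frac{3p}{4}-p^2(pB_{p-1})+3p(p-3)\mathcal{B}_{p+1}-\frac{1}{2}\Big(p-3+\frac{11p^3}{2}\Big)B_{2p}\\ &+p^2(p-5)(\mathcal{B}_{p+3}-2\mathcal{B}_4)(2\mathcal{B}_{p-3}-\mathcal{B}_{2p-4})\\ &+2p(\mathcal{B}_{2p-4}-2\mathcal{B}_{p-3})\Big(p(2\mathcal{B}_4-\mathcal{B}_{p+3})+\frac{1}{2}\Big(\frac{7}{720}p^2+2p\mathcal{B}_{p+3}+2p\mathcal{B}_4(pB_{p-1})\Big)\Big)\\ &-\frac{p^3}{2}\Big(\frac{4}{3}\mathcal{T}(p+1)-\mathcal{C}(p-1)(\mathcal{B}_2+B_2)-\mathcal{C}(p-3)(\mathcal{B}_4+B_4)-\mathcal{B}_2^2(\mathcal{B}_{p-3}+B_{p-3})\Big)\\ &+p^2(1+pw_p)\frac{p-3}{2}\Big(2\mathcal{B}_4\mathcal{B}_{p-3}-\mathcal{TC}(4)\Big)-\frac{p^3}{2}\sum_{a=1}^{p-1}\Bigg(\sum_{i=6}^{p-5}\frac{B_i-2\mathcal{B}_i}{a^i}\Bigg)(aq_a)^2\Bigg)\pmod{p^4}. \end{align*}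
   Context: $A^\star_k:=\sum_{1\le i_1<\dots<i_k\le p-1}\frac{1}{i_1\cdots i_k}$. $w_p:=\frac{(p-1)!+1}{p}$ and $q_a:=\frac{a^{p-1}-1}{p}$ (Fermat quotient). $B_n$ is the $n$-th Bernoulli number, $\mathcal{B}_n:=B_n/n$ for $n\ge1$; for even $m\ge4$, $\mathcal{C}(m):=\sum_{i=2}^{m-2}\mathcal{B}_i\mathcal{B}_{m-i}$ and $\mathcal{T}(m):=\sum_{i=2}^{m-4}\mathcal{B}_i\mathcal{C}(m-i)$. The truncated convolution is $\mathcal{TC}(4):=\sum_{i=4}^{p-3}\mathcal{B}_i\mathcal{B}_{p+1-i}$. $x\equiv y\pmod{p^4}$ means $x-y\in p^4\mathbb{Z}_p$. -}

module Defs where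

open import Data.Nat as ℕ using (ℕ; zero; suc; _∸_; _^_)
open import Data.Nat.Combinatorics using (_C_)
open import Data.Nat using (_!)
open import Data.Nat.Divisibility using (_∣_)
open import Data.Integer as ℤ using (ℤ; +_)
open import Data.Rational using (ℚ; _+_; _*_; _-_; -_; _/_; 0ℚ; 1ℚ; ↥_; ↧ₙ_)
open import Data.List using (List; []; _∷_; _++_; [_]; foldr; map; applyUpTo)
open import Data.Product using (_×_)
open import Relation.Nullary using (¬_)

ι : ℕ → ℚ
ι n = + n / 1

-- reciprocal of a natural number (only used at nonzero arguments; 1/0 := 0 by convention)
recipℕ : ℕ → ℚ
recipℕ zero = 0ℚ
recipℕ (suc n) = + 1 / suc n

-- Σ_{i=a}^{b} f i  (empty sum = 0 when b < a)
sumFT : ℕ → ℕ → (ℕ → ℚ) → ℚ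
sumFT a b f = foldr _+_ 0ℚ (map f (applyUpTo (a ℕ.+_) (suc b ∸ a)))

nth : List ℚ → ℕ → ℚ
nth [] _ = 0ℚ
nth (x ∷ xs) zero = x
nth (x ∷ xs) (suc k) = nth xs k

weighted : ℕ → ℕ → List ℚ → ℚ
weighted m k [] = 0ℚ
weighted m k (b ∷ bs) = ι (m C k) * b + weighted m (suc k) bs

-- [B_0, ..., B_n] using B_0 = 1 and Σ_{k=0}^{m} C(m+1,k) B_k = 0 for m ≥ 1
bernList : ℕ → List ℚ
bernList zero = [ 1ℚ ]
bernList (suc n) = bs ++ [ - (recipℕ (suc (suc n)) * weighted (suc (suc n)) 0 bs) ]
  where bs = bernList n

-- Bernoulli number B_n (B_1 = -1/2)
B : ℕ → ℚ
B n = nth (bernList n) n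

𝓑 : ℕ → ℚ
𝓑 n = B n * recipℕ n

𝓒 : ℕ → ℚ
𝓒 m = sumFT 2 (m ∸ 2) (λ i → 𝓑 i * 𝓑 (m ∸ i))

𝓣 : ℕ → ℚ
𝓣 m = sumFT 2 (m ∸ 4) (λ i → 𝓑 i * 𝓒 (m ∸ i))

𝓣𝓒4 : ℕ → ℚ
𝓣𝓒4 p = sumFT 4 (p ∸ 3) (λ i → 𝓑 i * 𝓑 (suc p ∸ i))

wq : ℕ → ℚ
wq p = (ι ((p ∸ 1) !) + 1ℚ) * recipℕ p

fq : ℕ → ℕ → ℚ
fq p a = (ι (a ^ (p ∸ 1)) - 1ℚ) * recipℕ p

incSum : ℕ → ℕ → ℕ → ℚ
incSum p zero lo = 1ℚ
incSum p (suc k) lo = sumFT lo (p ∸ 1) (λ i → recipℕ i * incSum p k (suc i))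

Astar : ℕ → ℕ → ℚ
Astar p k = incSum p k 1

-- x ≡ y (mod p^k) in ℤ_p: writing x - y = n/d in lowest terms, p ∤ d and p^k ∣ n
_≡_[mod_^_] : ℚ → ℚ → ℕ → ℕ → Set
x ≡ y [mod p ^ k ] = (p ^ k ∣ ℤ.∣ ↥ (x - y) ∣) × ¬ (p ∣ ↧ₙ (x - y))

-- The left-hand side is e₂(1, …, p-1) / (p-1)!, so the theorem computes (p-1)! modulo p³.  Write each residue as
-- a = w a (1 + y a) with w a its Teichmüller representative and p ∣ y a, and let n k = ∑ w^k y.  Expanding
-- ∑ a^k = ∑ w^k (1 + y)^k expresses the Bernoulli numbers through the moments ∑ w^k y^j; Fourier inversion over the
-- (p-1)-st roots of unity w a expresses the moments of y² and y³ through convolutions of n with itself, which are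
-- the convolutions of divided Bernoulli numbers in the statement; and -(p-1)! = ∏ (1 + y a).  In this language the
-- claim reduces to the expansion of ∑ a² = 2 n 2 + ∑ w² y² modulo p⁴.  Triple convolutions weighted by an index are
-- removed with the derivation θ f k = k f k.
module Submission where

open import Defs

-- Everything stays in ℚ: no p-adic limit is taken, and w a = a^(p⁴) is a root of unity modulo p⁵
-- only. The order beyond the claimed p⁴ is spent on 𝓑 (2p), which comes from a power sum divided by
-- 2p. Knowing (p-1)! modulo p³ suffices because the parenthesised factor is itself divisible by p.
-- Two quantities have no expression through single Bernoulli numbers: the third moment `n₃ 2` and
-- the index-weighted convolution `U`. To leading order, `n₃ 2` enters with coefficient 1 through B
-- (2p) and -1 through the double sum, so it cancels. `U` enters with -3/2 through 𝓣𝓒(4) and -1/2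
-- through the double sum; the derivation turns -2 U into (2/3) T plus products of moments, T being
-- the triple convolution of `n`, and the term -(1/2)(4/3) 𝓣 removes T. This is where the 4/3 comes
-- from. What remains is a polynomial congruence between quantities of known p-adic order, settled
-- by an expansion truncated by weight.

module Proof where
  open import Data.Bool as Bool using (Bool; true; false; _∧_; if_then_else_)
  open import Data.Empty using (⊥; ⊥-elim)
  open import Data.Fin using (Fin)
  open import Data.Integer as ℤ using (+_; +0)
  import Data.Integer.Properties as ℤP
  open import Data.List using (List; []; _∷_; _++_; length; foldr; map; applyUpTo)
  import Data.List.Properties as LP
  open import Data.Nat as ℕ using (ℕ; zero; suc; z≤n; s≤s; _≤_; _<_; _∸_; _^_; _≤ᵇ_; _≡ᵇ_; _≤?_; _!; NonZero)
  import Data.Nat.Properties as ℕP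
  open import Data.Nat.Combinatorics using (_C_; nCk≡n!/k![n-k]!; k![n∸k]!∣n!; nC1≡n; nCn≡1; nCk≡nC[n∸k])
  open import Data.Nat.Divisibility using (_∣_; _∣?_; divides; ∣-refl; ∣-trans; m∣m*n; ∣m+n∣m⇒∣n; ∣1⇒≡1; 1∣_; *-monoʳ-∣; *-cancelˡ-∣; >⇒∤)
  open import Data.Nat.DivMod using (m/n*n≡m)
  open import Data.Nat.Induction using (<-rec)
  open import Data.Nat.Primality using (Prime; euclidsLemma; prime⇒nonZero; prime⇒nonTrivial; prime⇒irreducible)
  open import Data.Product using (∃; _,_; _×_; proj₁; proj₂)
  open import Data.Rational as ℚ using (ℚ; _*_; _-_; -_; _/_; 1ℚ; 0ℚ; _+_; ↥_; ↧_; ↧ₙ_; toℚᵘ; mkℚ)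
  import Data.Rational.Properties as ℚP
  open import Data.Rational.Solver
  open import Data.Rational.Unnormalised as ℚᵘ using (mkℚᵘ; *≡*)
  import Data.Rational.Unnormalised.Properties as ℚᵘP
  open import Data.Sum using (_⊎_; inj₁; inj₂; [_,_]′)
  open import Data.Unit using (tt)
  open import Data.Vec as Vec using (Vec; []; _∷_; lookup; zipWith; allFin)
  open import Data.Vec.N-ary using (N-ary; _$ⁿ_)
  open import Relation.Binary.Definitions using (Tri; tri<; tri≈; tri>)
  open import Relation.Binary.PropositionalEquality hiding ([_])
  open import Relation.Nullary using (¬_; Dec; does; yes; no)
  open +-*-Solver using (solve; con; _:=_; _:+_; _:*_; _:-_; :-_; Polynomial; op; var; _:^_; [+]; [*]; ⟦_⟧)
  open ≡-Reasoning

  -- Rationals, finite sums and Cauchy products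

  toℚᵘ-ι : ∀ n → toℚᵘ (ι n) ℚᵘ.≃ mkℚᵘ (+ n) 0
  toℚᵘ-ι n = ℚP.toℚᵘ-fromℚᵘ (mkℚᵘ (+ n) 0)

  ι-+ : ∀ m n → ι (m ℕ.+ n) ≡ ι m + ι n
  ι-+ m n = ℚP.toℚᵘ-injective (ℚᵘP.≃-trans (toℚᵘ-ι (m ℕ.+ n)) (ℚᵘP.≃-sym
    (ℚᵘP.≃-trans (ℚP.toℚᵘ-homo-+ (ι m) (ι n)) (ℚᵘP.≃-trans (ℚᵘP.+-cong (toℚᵘ-ι m) (toℚᵘ-ι n))
      (*≡* (cong (λ t → t ℤ.* + 1) (trans (cong₂ ℤ._+_ (ℤP.*-identityʳ (+ m)) (ℤP.*-identityʳ (+ n))) refl)))))))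

  ι-* : ∀ m n → ι (m ℕ.* n) ≡ ι m * ι n
  ι-* m n = ℚP.toℚᵘ-injective (ℚᵘP.≃-trans (toℚᵘ-ι (m ℕ.* n)) (ℚᵘP.≃-sym
    (ℚᵘP.≃-trans (ℚP.toℚᵘ-homo-* (ι m) (ι n)) (ℚᵘP.≃-trans (ℚᵘP.*-cong (toℚᵘ-ι m) (toℚᵘ-ι n))
      (*≡* (cong (λ t → t ℤ.* + 1) (sym (ℤP.pos-* m n))))))))

  ι-suc : ∀ n → ι (suc n) ≡ 1ℚ + ι n
  ι-suc n = ι-+ 1 n

  ι-∸ : ∀ {m n} → n ≤ m → ι (m ∸ n) ≡ ι m - ι n
  ι-∸ {m} {n} n≤m = begin
    ι (m ∸ n)                 ≡⟨ solve 2 (λ a b → a := (a :+ b) :- b) refl (ι (m ∸ n)) (ι n) ⟩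
    (ι (m ∸ n) + ι n) - ι n   ≡⟨ cong (_- ι n) (ι-+ (m ∸ n) n) ⟨
    ι (m ∸ n ℕ.+ n) - ι n     ≡⟨ cong (λ t → ι t - ι n) (ℕP.m∸n+n≡m n≤m) ⟩
    ι m - ι n                 ∎

  ι-recip : ∀ n .{{_ : ℕ.NonZero n}} → ι n * recipℕ n ≡ 1ℚ
  ι-recip (suc n) = ℚP.toℚᵘ-injective
    (ℚᵘP.≃-trans (ℚP.toℚᵘ-homo-* (ι (suc n)) (recipℕ (suc n)))
      (ℚᵘP.≃-trans (ℚᵘP.*-cong (toℚᵘ-ι (suc n)) (ℚP.toℚᵘ-fromℚᵘ (mkℚᵘ (+ 1) n)))
        (*≡* (cong (λ t → + suc t) (trans (trans (ℕP.*-identityʳ (n ℕ.* 1)) (ℕP.*-identityʳ n)) (sym (trans (ℕP.+-identityʳ (n ℕ.+ 0)) (ℕP.+-identityʳ n))))))))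

  ι-cancel : ∀ n .{{_ : ℕ.NonZero n}} {x y} → ι n * x ≡ ι n * y → x ≡ y
  ι-cancel n {x} {y} eq = begin
    x                       ≡⟨ ℚP.*-identityˡ x ⟨
    1ℚ * x                  ≡⟨ cong (_* x) (ι-recip n) ⟨
    ι n * recipℕ n * x      ≡⟨ solve 3 (λ a b c → a :* b :* c := b :* (a :* c)) refl (ι n) (recipℕ n) x ⟩
    recipℕ n * (ι n * x)    ≡⟨ cong (recipℕ n *_) eq ⟩
    recipℕ n * (ι n * y)    ≡⟨ solve 3 (λ a b c → a :* b :* c := b :* (a :* c)) refl (ι n) (recipℕ n) y ⟨
    ι n * recipℕ n * y      ≡⟨ cong (_* y) (ι-recip n) ⟩
    1ℚ * y                  ≡⟨ ℚP.*-identityˡ y ⟩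
    y                       ∎

  recip-unique : ∀ n .{{_ : ℕ.NonZero n}} {x} → ι n * x ≡ 1ℚ → x ≡ recipℕ n
  recip-unique n eq = ι-cancel n (trans eq (sym (ι-recip n)))

  recip-* : ∀ m n .{{_ : ℕ.NonZero m}} .{{_ : ℕ.NonZero n}} → recipℕ (m ℕ.* n) ≡ recipℕ m * recipℕ n
  recip-* m n = sym (recip-unique (m ℕ.* n) {{ℕP.m*n≢0 m n}} (begin
    ι (m ℕ.* n) * (recipℕ m * recipℕ n)     ≡⟨ cong (_* (recipℕ m * recipℕ n)) (ι-* m n) ⟩
    ι m * ι n * (recipℕ m * recipℕ n)       ≡⟨ solve 4 (λ a b c d → a :* b :* (c :* d) := (a :* c) :* (b :* d)) refl (ι m) (ι n) (recipℕ m) (recipℕ n) ⟩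
    (ι m * recipℕ m) * (ι n * recipℕ n)     ≡⟨ cong₂ _*_ (ι-recip m) (ι-recip n) ⟩
    1ℚ                                      ∎))

  infixr 8 _↑_
  _↑_ : ℚ → ℕ → ℚ
  x ↑ zero = 1ℚ
  x ↑ suc n = x * x ↑ n

  ι-^ : ∀ m n → ι (m ^ n) ≡ ι m ↑ n
  ι-^ m zero = refl
  ι-^ m (suc n) = trans (ι-* m (m ^ n)) (cong (ι m *_) (ι-^ m n))

  ↑-+ : ∀ x m n → x ↑ (m ℕ.+ n) ≡ x ↑ m * x ↑ n
  ↑-+ x zero n = sym (ℚP.*-identityˡ _)
  ↑-+ x (suc m) n = trans (cong (x *_) (↑-+ x m n)) (sym (ℚP.*-assoc x _ _))

  *-↑ : ∀ x y n → (x * y) ↑ n ≡ x ↑ n * y ↑ n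
  *-↑ x y zero = refl
  *-↑ x y (suc n) = trans (cong (x * y *_) (*-↑ x y n))
    (solve 4 (λ a b c d → a :* b :* (c :* d) := a :* c :* (b :* d)) refl x y (x ↑ n) (y ↑ n))

  1-↑ : ∀ n → 1ℚ ↑ n ≡ 1ℚ
  1-↑ zero = refl
  1-↑ (suc n) = trans (ℚP.*-identityˡ _) (1-↑ n)

  ↑-* : ∀ x m n → x ↑ (m ℕ.* n) ≡ (x ↑ n) ↑ m
  ↑-* x zero n = refl
  ↑-* x (suc m) n = trans (↑-+ x n (m ℕ.* n)) (cong (x ↑ n *_) (↑-* x m n))

  ∑ : ℕ → (ℕ → ℚ) → ℚ
  ∑ zero f = 0ℚ
  ∑ (suc n) f = f 0 + ∑ n (λ i → f (suc i))

  sumFT≡∑ : ∀ a b f → sumFT a b f ≡ ∑ (suc b ∸ a) (λ i → f (a ℕ.+ i))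
  sumFT≡∑ a b f = go (suc b ∸ a) (a ℕ.+_)
    where
    go : ∀ n g → foldr _+_ 0ℚ (map f (applyUpTo g n)) ≡ ∑ n (λ i → f (g i))
    go zero g = refl
    go (suc n) g = cong (_+_ (f (g 0))) (go n (λ i → g (suc i)))

  ∑-cong : ∀ n {f g} → (∀ i → i < n → f i ≡ g i) → ∑ n f ≡ ∑ n g
  ∑-cong zero h = refl
  ∑-cong (suc n) h = cong₂ _+_ (h 0 (s≤s z≤n)) (∑-cong n (λ i i<n → h (suc i) (s≤s i<n)))

  ∑-+ : ∀ n f g → ∑ n (λ i → f i + g i) ≡ ∑ n f + ∑ n g
  ∑-+ zero f g = refl
  ∑-+ (suc n) f g = trans (cong (_+_ (f 0 + g 0)) (∑-+ n _ _))
    (solve 4 (λ a b c d → (a :+ b) :+ (c :+ d) := (a :+ c) :+ (b :+ d)) refl (f 0) (g 0) (∑ n (λ i → f (suc i))) (∑ n (λ i → g (suc i))))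

  ∑-*ˡ : ∀ n c f → ∑ n (λ i → c * f i) ≡ c * ∑ n f
  ∑-*ˡ zero c f = sym (ℚP.*-zeroʳ c)
  ∑-*ˡ (suc n) c f = trans (cong (_+_ (c * f 0)) (∑-*ˡ n c _)) (sym (ℚP.*-distribˡ-+ c _ _))

  ∑-*ʳ : ∀ n f c → ∑ n (λ i → f i * c) ≡ ∑ n f * c
  ∑-*ʳ n f c = trans (∑-cong n (λ i _ → ℚP.*-comm (f i) c)) (trans (∑-*ˡ n c f) (ℚP.*-comm c _))

  ∑-neg : ∀ n f → ∑ n (λ i → - f i) ≡ - ∑ n f
  ∑-neg zero f = refl
  ∑-neg (suc n) f = trans (cong (_+_ (- f 0)) (∑-neg n _)) (sym (ℚP.neg-distrib-+ (f 0) _))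

  ∑-- : ∀ n f g → ∑ n (λ i → f i - g i) ≡ ∑ n f - ∑ n g
  ∑-- n f g = trans (∑-+ n f (λ i → - g i)) (cong (_+_ (∑ n f)) (∑-neg n g))

  ∑-0 : ∀ n → ∑ n (λ _ → 0ℚ) ≡ 0ℚ
  ∑-0 zero = refl
  ∑-0 (suc n) = trans (ℚP.+-identityˡ _) (∑-0 n)

  ∑-const : ∀ n c → ∑ n (λ _ → c) ≡ ι n * c
  ∑-const zero c = sym (ℚP.*-zeroˡ c)
  ∑-const (suc n) c = trans (cong (_+_ c) (∑-const n c)) (trans
    (solve 2 (λ a b → a :+ b :* a := (con 1ℚ :+ b) :* a) refl c (ι n)) (cong (_* c) (sym (ι-suc n))))

  ∑-swap : ∀ m n (f : ℕ → ℕ → ℚ) → ∑ m (λ i → ∑ n (λ j → f i j)) ≡ ∑ n (λ j → ∑ m (λ i → f i j))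
  ∑-swap zero n f = sym (∑-0 n)
  ∑-swap (suc m) n f = trans (cong (_+_ (∑ n (f 0))) (∑-swap m n (λ i j → f (suc i) j))) (sym (∑-+ n (f 0) _))

  ∑-last : ∀ n f → ∑ (suc n) f ≡ ∑ n f + f n
  ∑-last zero f = ℚP.+-comm (f 0) 0ℚ
  ∑-last (suc n) f = trans (cong (_+_ (f 0)) (∑-last n (λ i → f (suc i)))) (sym (ℚP.+-assoc (f 0) _ _))

  ∑-split : ∀ m n f → ∑ (m ℕ.+ n) f ≡ ∑ m f + ∑ n (λ i → f (m ℕ.+ i))
  ∑-split zero n f = sym (ℚP.+-identityˡ _)
  ∑-split (suc m) n f = trans (cong (_+_ (f 0)) (∑-split m n (λ i → f (suc i)))) (sym (ℚP.+-assoc (f 0) _ _))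

  ∑-reverse : ∀ n f → ∑ n f ≡ ∑ n (λ i → f (n ∸ suc i))
  ∑-reverse zero f = refl
  ∑-reverse (suc n) f = begin
    f 0 + ∑ n (λ i → f (suc i))             ≡⟨ cong (_+_ (f 0)) (∑-reverse n (λ i → f (suc i))) ⟩
    f 0 + ∑ n (λ i → f (suc (n ∸ suc i)))   ≡⟨ cong (_+_ (f 0)) (∑-cong n (λ i i<n → cong f (sym (ℕP.+-∸-assoc 1 i<n)))) ⟩
    f 0 + ∑ n (λ i → f (n ∸ i))             ≡⟨ ℚP.+-comm (f 0) _ ⟩
    ∑ n (λ i → f (n ∸ i)) + f 0             ≡⟨ cong (λ t → ∑ n (λ i → f (n ∸ i)) + f t) (ℕP.n∸n≡0 n) ⟨
    ∑ n (λ i → f (n ∸ i)) + f (n ∸ n)       ≡⟨ ∑-last n (λ i → f (n ∸ i)) ⟨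
    ∑ (suc n) (λ i → f (n ∸ i))             ∎

  infixl 7 _⋆_
  -- The Cauchy product, peeled from the left so that no truncated subtraction occurs and the ring
  -- laws go by plain induction; `⋆-∑` recovers the usual sum.
  _⋆_ : (ℕ → ℚ) → (ℕ → ℚ) → ℕ → ℚ
  (f ⋆ g) zero = f 0 * g 0
  (f ⋆ g) (suc m) = f 0 * g (suc m) + ((λ i → f (suc i)) ⋆ g) m

  ⋆-∑ : ∀ m f g → (f ⋆ g) m ≡ ∑ (suc m) (λ i → f i * g (m ∸ i))
  ⋆-∑ zero f g = sym (ℚP.+-identityʳ _)
  ⋆-∑ (suc m) f g = cong (_+_ (f 0 * g (suc m))) (⋆-∑ m (λ i → f (suc i)) g)

  ⋆-cong : ∀ m {f f′ g g′} → (∀ i → f i ≡ f′ i) → (∀ i → g i ≡ g′ i) → (f ⋆ g) m ≡ (f′ ⋆ g′) m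
  ⋆-cong zero h k = cong₂ _*_ (h 0) (k 0)
  ⋆-cong (suc m) h k = cong₂ _+_ (cong₂ _*_ (h 0) (k (suc m))) (⋆-cong m (λ i → h (suc i)) k)

  ⋆-snoc : ∀ m f g → (f ⋆ g) (suc m) ≡ (f ⋆ (λ i → g (suc i))) m + f (suc m) * g 0
  ⋆-snoc zero f g = refl
  ⋆-snoc (suc m) f g = trans (cong (_+_ (f 0 * g (suc (suc m)))) (⋆-snoc m (λ i → f (suc i)) g)) (sym (ℚP.+-assoc (f 0 * g (suc (suc m))) _ _))

  ⋆-comm : ∀ m f g → (f ⋆ g) m ≡ (g ⋆ f) m
  ⋆-comm zero f g = ℚP.*-comm (f 0) (g 0)
  ⋆-comm (suc m) f g = begin
    f 0 * g (suc m) + ((λ i → f (suc i)) ⋆ g) m     ≡⟨ cong₂ _+_ (ℚP.*-comm (f 0) _) (⋆-comm m (λ i → f (suc i)) g) ⟩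
    g (suc m) * f 0 + (g ⋆ (λ i → f (suc i))) m     ≡⟨ ℚP.+-comm (g (suc m) * f 0) _ ⟩
    (g ⋆ (λ i → f (suc i))) m + g (suc m) * f 0     ≡⟨ ⋆-snoc m g f ⟨
    (g ⋆ f) (suc m)                                 ∎

  ⋆-linearˡ : ∀ m c f g h → ((λ i → c * f i + g i) ⋆ h) m ≡ c * (f ⋆ h) m + (g ⋆ h) m
  ⋆-linearˡ zero c f g h = solve 4 (λ c f g h → (c :* f :+ g) :* h := c :* (f :* h) :+ g :* h) refl c (f 0) (g 0) (h 0)
  ⋆-linearˡ (suc m) c f g h = trans (cong (_+_ ((c * f 0 + g 0) * h (suc m))) (⋆-linearˡ m c _ _ h))
    (solve 6 (λ c f g h u v → (c :* f :+ g) :* h :+ (c :* u :+ v) := c :* (f :* h :+ u) :+ (g :* h :+ v)) refl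
      c (f 0) (g 0) (h (suc m)) (((λ i → f (suc i)) ⋆ h) m) (((λ i → g (suc i)) ⋆ h) m))

  ⋆-assoc : ∀ m f g h → ((f ⋆ g) ⋆ h) m ≡ (f ⋆ (g ⋆ h)) m
  ⋆-assoc zero f g h = ℚP.*-assoc (f 0) (g 0) (h 0)
  ⋆-assoc (suc m) f g h = begin
    f 0 * g 0 * h (suc m) + ((λ i → f 0 * g (suc i) + (f′ ⋆ g) i) ⋆ h) m
      ≡⟨ cong (_+_ (f 0 * g 0 * h (suc m))) (⋆-linearˡ m (f 0) (λ i → g (suc i)) (f′ ⋆ g) h) ⟩
    f 0 * g 0 * h (suc m) + (f 0 * (g′ ⋆ h) m + ((f′ ⋆ g) ⋆ h) m)
      ≡⟨ cong (λ t → f 0 * g 0 * h (suc m) + (f 0 * (g′ ⋆ h) m + t)) (⋆-assoc m f′ g h) ⟩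
    f 0 * g 0 * h (suc m) + (f 0 * (g′ ⋆ h) m + (f′ ⋆ (g ⋆ h)) m)
      ≡⟨ solve 5 (λ a b c d e → a :* b :* c :+ (a :* d :+ e) := a :* (b :* c :+ d) :+ e) refl (f 0) (g 0) (h (suc m)) ((g′ ⋆ h) m) ((f′ ⋆ (g ⋆ h)) m) ⟩
    f 0 * (g 0 * h (suc m) + (g′ ⋆ h) m) + (f′ ⋆ (g ⋆ h)) m ∎
    where
    f′ g′ : ℕ → ℚ
    f′ i = f (suc i)
    g′ i = g (suc i)

  θ : (ℕ → ℚ) → ℕ → ℚ
  θ f i = ι i * f i

  ⋆-addˡ : ∀ m f g h → ((λ i → f i + g i) ⋆ h) m ≡ (f ⋆ h) m + (g ⋆ h) m
  ⋆-addˡ m f g h = trans (⋆-cong m {g = h} (λ i → cong (_+ g i) (sym (ℚP.*-identityˡ (f i)))) (λ _ → refl))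
    (trans (⋆-linearˡ m 1ℚ f g h) (cong (_+ (g ⋆ h) m) (ℚP.*-identityˡ ((f ⋆ h) m))))

  -- Leibniz rule, from m = i + (m - i). Shifting `f` adds one unweighted copy of the shifted
  -- sequence to `θ f`; the 1 in 1 + m supplies it.
  θ-⋆ : ∀ m f g → ι m * (f ⋆ g) m ≡ (θ f ⋆ g) m + (f ⋆ θ g) m
  θ-⋆ zero f g = solve 2 (λ a b → con 0ℚ :* (a :* b) := (con 0ℚ :* a) :* b :+ a :* (con 0ℚ :* b)) refl (f 0) (g 0)
  θ-⋆ (suc m) f g = begin
    ι (suc m) * (f 0 * g (suc m) + (f′ ⋆ g) m)
      ≡⟨ cong (_* (f 0 * g (suc m) + (f′ ⋆ g) m)) (ι-suc m) ⟩
    (1ℚ + ι m) * (f 0 * g (suc m) + (f′ ⋆ g) m)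
      ≡⟨ solve 4 (λ a b c d → (con 1ℚ :+ a) :* (b :* c :+ d) := (con 1ℚ :+ a) :* (b :* c) :+ (d :+ a :* d)) refl (ι m) (f 0) (g (suc m)) ((f′ ⋆ g) m) ⟩
    (1ℚ + ι m) * (f 0 * g (suc m)) + ((f′ ⋆ g) m + ι m * (f′ ⋆ g) m)
      ≡⟨ cong (λ t → (1ℚ + ι m) * (f 0 * g (suc m)) + ((f′ ⋆ g) m + t)) (θ-⋆ m f′ g) ⟩
    (1ℚ + ι m) * (f 0 * g (suc m)) + ((f′ ⋆ g) m + ((θ f′ ⋆ g) m + (f′ ⋆ θ g) m))
      ≡⟨ solve 6 (λ a b c d e f → (con 1ℚ :+ a) :* (b :* c) :+ (d :+ (e :+ f)) := ((con 0ℚ :* b) :* c :+ (d :+ e)) :+ (b :* ((con 1ℚ :+ a) :* c) :+ f)) refl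
           (ι m) (f 0) (g (suc m)) ((f′ ⋆ g) m) ((θ f′ ⋆ g) m) ((f′ ⋆ θ g) m) ⟩
    ((0ℚ * f 0) * g (suc m) + ((f′ ⋆ g) m + (θ f′ ⋆ g) m)) + (f 0 * ((1ℚ + ι m) * g (suc m)) + (f′ ⋆ θ g) m)
      ≡⟨ cong₂ (λ s t → ((0ℚ * f 0) * g (suc m) + s) + (f 0 * (t * g (suc m)) + (f′ ⋆ θ g) m))
           (trans (sym (⋆-addˡ m f′ (θ f′) g)) (⋆-cong m {g = g} (λ i → trans (solve 2 (λ a b → a :+ b :* a := (con 1ℚ :+ b) :* a) refl (f′ i) (ι i)) (cong (_* f′ i) (sym (ι-suc i)))) (λ _ → refl)))
           (sym (ι-suc m)) ⟩
    (θ f ⋆ g) (suc m) + (f ⋆ θ g) (suc m) ∎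
    where
    f′ : ℕ → ℚ
    f′ i = f (suc i)

  -- By symmetry each factor carries the same share of the degree: one half here, one third in
  -- `θ-cube`.
  θ-square : ∀ m f → ι m * (f ⋆ f) m ≡ ι 2 * (θ f ⋆ f) m
  θ-square m f = trans (θ-⋆ m f f) (trans (cong (_+_ ((θ f ⋆ f) m)) (⋆-comm m f (θ f)))
    (solve 1 (λ a → a :+ a := con (ι 2) :* a) refl ((θ f ⋆ f) m)))

  θ-cube : ∀ m f → ι m * (f ⋆ (f ⋆ f)) m ≡ ι 3 * (θ f ⋆ (f ⋆ f)) m
  θ-cube m f = begin
    ι m * (f ⋆ (f ⋆ f)) m
      ≡⟨ θ-⋆ m f (f ⋆ f) ⟩
    (θ f ⋆ (f ⋆ f)) m + (f ⋆ θ (f ⋆ f)) m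
      ≡⟨ cong (_+_ ((θ f ⋆ (f ⋆ f)) m)) (⋆-cong m {f = f} (λ _ → refl) (λ i → θ-⋆ i f f)) ⟩
    X + (f ⋆ (λ i → (θ f ⋆ f) i + (f ⋆ θ f) i)) m
      ≡⟨ cong (_+_ X) (trans (⋆-comm m f _) (⋆-addˡ m (θ f ⋆ f) (f ⋆ θ f) f)) ⟩
    X + (((θ f ⋆ f) ⋆ f) m + ((f ⋆ θ f) ⋆ f) m)
      ≡⟨ cong (_+_ X) (cong₂ _+_ (⋆-assoc m (θ f) f f) (trans (⋆-cong m {g = f} (λ i → ⋆-comm i f (θ f)) (λ _ → refl)) (⋆-assoc m (θ f) f f))) ⟩
    X + (X + X)
      ≡⟨ solve 1 (λ a → a :+ (a :+ a) := con (ι 3) :* a) refl X ⟩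
    ι 3 * X ∎
    where
    X = (θ f ⋆ (f ⋆ f)) m

  -- Divisibility by powers of p in the rationals

  module Filtration (p : ℕ) (pp : Prime p) where

    private instance
      nzp : NonZero p
      nzp = prime⇒nonZero pp

    -- The localisation ℤ₍ₚ₎, which stands in for ℤₚ throughout.
    Loc : ℚ → Set
    Loc x = ¬ p ∣ ↧ₙ x

    p∤1 : ¬ p ∣ 1
    p∤1 d = ℕ.nonTrivial⇒≢1 {{prime⇒nonTrivial pp}} (∣1⇒≡1 d)

    private
      ∣-factor : ∀ a b {c} → a ℤ.* b ≡ c → ℤ.∣ a ∣ ∣ ℤ.∣ c ∣
      ∣-factor a b eq = divides ℤ.∣ b ∣ (trans (cong ℤ.∣_∣ (sym eq)) (trans (ℤP.abs-* a b) (ℕP.*-comm ℤ.∣ a ∣ _)))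

    ↧-divides-+ : ∀ x y → ↧ₙ (x + y) ∣ ↧ₙ x ℕ.* ↧ₙ y
    ↧-divides-+ x y = subst (↧ₙ (x + y) ∣_) (ℤP.abs-* (↧ x) (↧ y)) (∣-factor (↧ (x + y)) _ (ℚP.↧-+ x y))

    ↧-divides-* : ∀ x y → ↧ₙ (x * y) ∣ ↧ₙ x ℕ.* ↧ₙ y
    ↧-divides-* x y = subst (↧ₙ (x * y) ∣_) (ℤP.abs-* (↧ x) (↧ y)) (∣-factor (↧ (x * y)) _ (ℚP.↧-* x y))

    Loc-+ : ∀ {x y} → Loc x → Loc y → Loc (x + y)
    Loc-+ {x} {y} lx ly d = [ lx , ly ]′ (euclidsLemma _ _ pp (∣-trans d (↧-divides-+ x y)))

    Loc-* : ∀ {x y} → Loc x → Loc y → Loc (x * y)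
    Loc-* {x} {y} lx ly d = [ lx , ly ]′ (euclidsLemma _ _ pp (∣-trans d (↧-divides-* x y)))

    Loc-neg : ∀ {x} → Loc x → Loc (- x)
    Loc-neg {x} lx d = lx (subst (λ t → p ∣ ℤ.∣ t ∣) (ℚP.↧-neg x) d)

    Loc-/ : ∀ i n .{{_ : NonZero n}} → ¬ p ∣ n → Loc (i / n)
    Loc-/ i n p∤n d = p∤n (∣-trans d (∣-factor (↧ (i / n)) _ (ℚP.↧-/ i n)))

    Loc-ι : ∀ n → Loc (ι n)
    Loc-ι n = Loc-/ (+ n) 1 p∤1

    Loc-recip : ∀ n → ¬ p ∣ n → Loc (recipℕ n)
    Loc-recip zero p∤n = p∤1
    Loc-recip (suc n) p∤n = Loc-/ (+ 1) (suc n) p∤n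

    -- x ∈ pᵏℤ₍ₚ₎
    record V (k : ℕ) (x : ℚ) : Set where
      constructor mkV
      field
        quot : ℚ
        loc  : Loc quot
        eq   : x ≡ ι p ↑ k * quot

    infix 4 _≈[_]_
    -- A record rather than an abbreviation: `x` and `y` could not be inferred from the reducible
    -- term `x - y`.
    record _≈[_]_ (x : ℚ) (k : ℕ) (y : ℚ) : Set where
      constructor mk≈
      field
        diff : V k (x - y)
    open _≈[_]_ public

    V-resp : ∀ {k x y} → x ≡ y → V k x → V k y
    V-resp refl v = v

    Loc⇒V : ∀ {x} → Loc x → V 0 x
    Loc⇒V {x} l = mkV x l (sym (ℚP.*-identityˡ x))

    V⇒Loc : ∀ {x} → V 0 x → Loc x
    V⇒Loc (mkV z l eq) = subst Loc (sym (trans eq (ℚP.*-identityˡ z))) l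

    V-0 : ∀ {k} → V k 0ℚ
    V-0 {k} = mkV 0ℚ p∤1 (sym (ℚP.*-zeroʳ (ι p ↑ k)))

    V-+ : ∀ {k x y} → V k x → V k y → V k (x + y)
    V-+ {k} (mkV z l e) (mkV w m f) = mkV (z + w) (Loc-+ {z} {w} l m) (trans (cong₂ _+_ e f) (sym (ℚP.*-distribˡ-+ (ι p ↑ k) z w)))

    V-neg : ∀ {k x} → V k x → V k (- x)
    V-neg {k} (mkV z l e) = mkV (- z) (Loc-neg {z} l) (trans (cong -_ e) (ℚP.neg-distribʳ-* (ι p ↑ k) z))

    V-- : ∀ {k x y} → V k x → V k y → V k (x - y)
    V-- v w = V-+ v (V-neg w)

    V-* : ∀ {j k x y} → V j x → V k y → V (j ℕ.+ k) (x * y)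
    V-* {j} {k} (mkV z l e) (mkV w m f) = mkV (z * w) (Loc-* {z} {w} l m)
      (trans (cong₂ _*_ e f) (trans
        (solve 4 (λ a b c d → (a :* b) :* (c :* d) := (a :* c) :* (b :* d)) refl (ι p ↑ j) z (ι p ↑ k) w)
        (cong (_* (z * w)) (sym (↑-+ (ι p) j k)))))

    V-0+ : ∀ {j k x} → V (j ℕ.+ k) x → V k x
    V-0+ {j} {k} (mkV z l e) = mkV (ι p ↑ j * z) (Loc-* {ι p ↑ j} {z} (go j) l)
      (trans e (trans (cong (_* z) (↑-+ (ι p) j k)) (solve 3 (λ a b c → a :* b :* c := b :* (a :* c)) refl (ι p ↑ j) (ι p ↑ k) z)))
      where
      go : ∀ j → Loc (ι p ↑ j)
      go zero = p∤1
      go (suc j) = Loc-* {ι p} {ι p ↑ j} (Loc-ι p) (go j)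

    V-≤ : ∀ {j k x} → j ≤ k → V k x → V j x
    V-≤ {j} {k} {x} j≤k v = V-0+ {k ∸ j} (subst (λ t → V t x) (sym (ℕP.m∸n+n≡m j≤k)) v)

    V-*ˡ : ∀ {k x y} → V 0 x → V k y → V k (x * y)
    V-*ˡ = V-*

    V-*ʳ : ∀ {k x y} → V k x → V 0 y → V k (x * y)
    V-*ʳ {k} {x} {y} v w = V-resp (ℚP.*-comm y x) (V-* w v)

    V-ι : ∀ n → V 0 (ι n)
    V-ι n = Loc⇒V (Loc-ι n)

    V-recip : ∀ n → ¬ p ∣ n → V 0 (recipℕ n)
    V-recip n h = Loc⇒V (Loc-recip n h)

    V-p : V 1 (ι p)
    V-p = mkV 1ℚ p∤1 (solve 1 (λ a → a := (a :* con 1ℚ) :* con 1ℚ) refl (ι p))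

    V-↑ : ∀ {w x} e → V w x → V (e ℕ.* w) (x ↑ e)
    V-↑ zero v = Loc⇒V p∤1
    V-↑ (suc e) v = V-* v (V-↑ e v)

    V-∣ : ∀ {n} → p ∣ n → V 1 (ι n)
    V-∣ (divides q refl) = V-resp (sym (ι-* q p)) (V-* (V-ι q) V-p)

    -- Division by `p` costs one order. It is applied to 𝓑 (2p) and explains why moments are
    -- computed modulo p⁵.
    V-cancel-p : ∀ {k x} → V (suc k) (ι p * x) → V k x
    V-cancel-p {k} {x} (mkV z l e) = mkV z l (ι-cancel p (trans e (ℚP.*-assoc (ι p) (ι p ↑ k) z)))

    V-cancel : ∀ {k n x} → ¬ p ∣ n → V k (ι n * x) → V k x
    V-cancel {k} {zero} h v = ⊥-elim (h (divides 0 refl))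
    V-cancel {k} {suc n} {x} h v = V-resp
      (trans (sym (ℚP.*-assoc (recipℕ (suc n)) (ι (suc n)) x)) (trans (cong (_* x) (trans (ℚP.*-comm (recipℕ (suc n)) _) (ι-recip (suc n)))) (ℚP.*-identityˡ x)))
      (V-* (V-recip (suc n) h) v)

    V-∑ : ∀ {k} n {f} → (∀ i → i < n → V k (f i)) → V k (∑ n f)
    V-∑ zero h = V-0
    V-∑ (suc n) h = V-+ (h 0 (s≤s z≤n)) (V-∑ n (λ i i<n → h (suc i) (s≤s i<n)))

    ≈-reflexive : ∀ {k x y} → x ≡ y → x ≈[ k ] y
    ≈-reflexive {k} {x} refl = mk≈ (V-resp (sym (ℚP.+-inverseʳ x)) V-0)

    ≈-refl : ∀ {k x} → x ≈[ k ] x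
    ≈-refl = ≈-reflexive refl

    ≈-sym : ∀ {k x y} → x ≈[ k ] y → y ≈[ k ] x
    ≈-sym {k} {x} {y} (mk≈ v) = mk≈ (V-resp (solve 2 (λ a b → :- (a :- b) := b :- a) refl x y) (V-neg v))

    ≈-trans : ∀ {k x y z} → x ≈[ k ] y → y ≈[ k ] z → x ≈[ k ] z
    ≈-trans {k} {x} {y} {z} (mk≈ v) (mk≈ w) = mk≈ (V-resp (solve 3 (λ a b c → (a :- b) :+ (b :- c) := a :- c) refl x y z) (V-+ v w))

    ≈-≤ : ∀ {j k x y} → j ≤ k → x ≈[ k ] y → x ≈[ j ] y
    ≈-≤ j≤k (mk≈ v) = mk≈ (V-≤ j≤k v)

    ≈-+ : ∀ {k x y z w} → x ≈[ k ] y → z ≈[ k ] w → x + z ≈[ k ] y + w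
    ≈-+ {k} {x} {y} {z} {w} (mk≈ a) (mk≈ b) = mk≈ (V-resp (solve 4 (λ a b c d → (a :- b) :+ (c :- d) := (a :+ c) :- (b :+ d)) refl x y z w) (V-+ a b))

    ≈-neg : ∀ {k x y} → x ≈[ k ] y → - x ≈[ k ] - y
    ≈-neg {k} {x} {y} (mk≈ a) = mk≈ (V-resp (solve 2 (λ a b → :- (a :- b) := :- a :- :- b) refl x y) (V-neg a))

    ≈-- : ∀ {k x y z w} → x ≈[ k ] y → z ≈[ k ] w → x - z ≈[ k ] y - w
    ≈-- a b = ≈-+ a (≈-neg b)

    ≈-*ˡ : ∀ {j k c x y} → V j c → x ≈[ k ] y → c * x ≈[ j ℕ.+ k ] c * y
    ≈-*ˡ {j} {k} {c} {x} {y} v (mk≈ a) = mk≈ (V-resp (solve 3 (λ c a b → c :* (a :- b) := c :* a :- c :* b) refl c x y) (V-* v a))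

    ≈-*ʳ : ∀ {j k c x y} → V j c → x ≈[ k ] y → x * c ≈[ j ℕ.+ k ] y * c
    ≈-*ʳ {j} {k} {c} {x} {y} v (mk≈ a) = mk≈ (V-resp (solve 3 (λ c a b → c :* (a :- b) := a :* c :- b :* c) refl c x y) (V-* v a))

    ≈-* : ∀ {k x y z w} → V 0 x → V 0 w → x ≈[ k ] y → z ≈[ k ] w → x * z ≈[ k ] y * w
    ≈-* vx vw a b = ≈-trans (≈-*ˡ vx b) (≈-*ʳ vw a)

    ≈-∑ : ∀ {k} n {f g} → (∀ i → i < n → f i ≈[ k ] g i) → ∑ n f ≈[ k ] ∑ n g
    ≈-∑ n {f} {g} h = mk≈ (V-resp (∑-- n f g) (V-∑ n (λ i i<n → diff (h i i<n))))

    ≈⇒V : ∀ {k x y} → x ≈[ k ] y → V k y → V k x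
    ≈⇒V {k} {x} {y} (mk≈ a) v = V-resp (solve 2 (λ a b → (a :- b) :+ b := a) refl x y) (V-+ a v)

    V⇒≈0 : ∀ {k x} → V k x → x ≈[ k ] 0ℚ
    V⇒≈0 {k} {x} v = mk≈ (V-resp (sym (ℚP.+-identityʳ x)) v)

    ≈-↑ : ∀ {k x y} n → V 0 x → V 0 y → x ≈[ k ] y → x ↑ n ≈[ k ] y ↑ n
    ≈-↑ zero vx vy a = ≈-refl
    ≈-↑ {k} {x} {y} (suc n) vx vy a = ≈-* vx (subst (λ t → V t (y ↑ n)) (ℕP.*-zeroʳ n) (V-↑ n vy)) a (≈-↑ n vx vy a)

    p∤product : ∀ {a b} → ¬ p ∣ a → ¬ p ∣ b → ¬ p ∣ a ℕ.* b
    p∤product ha hb d = [ ha , hb ]′ (euclidsLemma _ _ pp d)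

    ^∣-strip : ∀ k a b → ¬ p ∣ b → p ^ k ∣ a ℕ.* b → p ^ k ∣ a
    ^∣-strip zero a b h d = 1∣ a
    ^∣-strip (suc k) a b h d with euclidsLemma a b pp (∣-trans (m∣m*n (p ^ k)) d)
    ... | inj₂ p∣b = ⊥-elim (h p∣b)
    ... | inj₁ (divides q refl) = subst (p ^ suc k ∣_) (ℕP.*-comm p q)
      (*-monoʳ-∣ p (^∣-strip k q b h (*-cancelˡ-∣ p (subst (p ^ suc k ∣_)
        (trans (cong (ℕ._* b) (ℕP.*-comm q p)) (ℕP.*-assoc p q b)) d))))

    -- If d = pᵏ z, then cross-multiplication gives |num d| · den z = pᵏ · |num z| · den d. Since p
    -- does not divide den z, all of pᵏ divides num d.
    V⇒≡mod : ∀ {x y} k → V k (x - y) → x ≡ y [mod p ^ k ]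
    V⇒≡mod {x} {y} k v@(mkV z l e) = ^∣-strip k _ (↧ₙ z) l p^k∣ , V⇒Loc (V-≤ z≤n v)
      where
      d = x - y
      homo : toℚᵘ d ℚᵘ.≃ mkℚᵘ (+ (p ^ k)) 0 ℚᵘ.* toℚᵘ z
      homo = ℚᵘP.≃-trans (ℚᵘP.≃-reflexive (cong toℚᵘ (trans e (cong (_* z) (sym (ι-^ p k))))))
        (ℚᵘP.≃-trans (ℚP.toℚᵘ-homo-* (ι (p ^ k)) z) (ℚᵘP.*-cong (toℚᵘ-ι (p ^ k)) ℚᵘP.≃-refl))
      cross : ∀ a b → toℚᵘ a ℚᵘ.≃ mkℚᵘ (+ (p ^ k)) 0 ℚᵘ.* toℚᵘ b →
        ℤ.∣ ↥ a ∣ ℕ.* (1 ℕ.* ↧ₙ b) ≡ p ^ k ℕ.* ℤ.∣ ↥ b ∣ ℕ.* ↧ₙ a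
      -- Matching both rationals as records lets `toℚᵘ` reduce, so that `eq` speaks of numerators
      -- and denominators.
      cross a@record{} b@record{} (*≡* eq) = trans (sym (ℤP.abs-* (↥ a) (+ (1 ℕ.* ↧ₙ b))))
        (trans (cong ℤ.∣_∣ eq) (trans (ℤP.abs-* (+ (p ^ k) ℤ.* ↥ b) (↧ a)) (cong (ℕ._* ↧ₙ a) (ℤP.abs-* (+ (p ^ k)) (↥ b)))))
      p^k∣ : p ^ k ∣ ℤ.∣ ↥ d ∣ ℕ.* ↧ₙ z
      p^k∣ = divides (ℤ.∣ ↥ z ∣ ℕ.* ↧ₙ d) (trans (cong (ℤ.∣ ↥ d ∣ ℕ.*_) (sym (ℕP.*-identityˡ (↧ₙ z))))
        (trans (cross d z homo) (trans (ℕP.*-assoc (p ^ k) _ _) (ℕP.*-comm (p ^ k) _))))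

  -- Congruences between weighted polynomials, decided by truncated expansion

  does-true : ∀ {A : Set} (d : Dec A) → does d ≡ true → A
  does-true (yes a) _ = a

  ∧-left : ∀ {a b} → a ∧ b ≡ true → a ≡ true
  ∧-left {true} _ = refl

  ∧-right : ∀ {a b} → a ∧ b ≡ true → b ≡ true
  ∧-right {true} e = e

  Monomial : ℕ → Set
  Monomial n = Vec ℕ n

  Terms : ℕ → Set
  Terms n = List (ℚ × Monomial n)

  mval : ∀ {n} → Vec ℚ n → Monomial n → ℚ
  mval [] [] = 1ℚ
  mval (x ∷ ρ) (e ∷ m) = x ↑ e * mval ρ m

  mwt : ∀ {n} → Vec ℕ n → Monomial n → ℕ
  mwt [] [] = 0
  mwt (w ∷ ws) (e ∷ m) = e ℕ.* w ℕ.+ mwt ws m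

  infixl 7 _⊗_
  _⊗_ : ∀ {n} → Monomial n → Monomial n → Monomial n
  _⊗_ = zipWith ℕ._+_

  one : ∀ {n} → Monomial n
  one = Vec.replicate _ 0

  unit : ∀ {n} → Fin n → Monomial n
  unit Fin.zero = 1 ∷ one
  unit (Fin.suc i) = 0 ∷ unit i

  mval-⊗ : ∀ {n} (ρ : Vec ℚ n) m m′ → mval ρ (m ⊗ m′) ≡ mval ρ m * mval ρ m′
  mval-⊗ [] [] [] = refl
  mval-⊗ (x ∷ ρ) (e ∷ m) (f ∷ m′) = trans (cong₂ _*_ (↑-+ x e f) (mval-⊗ ρ m m′))
    (solve 4 (λ a b c d → (a :* b) :* (c :* d) := (a :* c) :* (b :* d)) refl (x ↑ e) (x ↑ f) (mval ρ m) (mval ρ m′))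

  mval-one : ∀ {n} (ρ : Vec ℚ n) → mval ρ one ≡ 1ℚ
  mval-one [] = refl
  mval-one (x ∷ ρ) = trans (ℚP.*-identityˡ _) (mval-one ρ)

  mval-unit : ∀ {n} (ρ : Vec ℚ n) i → mval ρ (unit i) ≡ lookup ρ i
  mval-unit (x ∷ ρ) Fin.zero = trans (cong₂ _*_ (ℚP.*-identityʳ x) (mval-one ρ)) (ℚP.*-identityʳ x)
  mval-unit (x ∷ ρ) (Fin.suc i) = trans (ℚP.*-identityˡ _) (mval-unit ρ i)

  -- Boolean and built on `≡ᵇ`, because the certificates below are evaluated by the type checker.
  _≟ᵐ_ : ∀ {n} → Monomial n → Monomial n → Bool
  [] ≟ᵐ [] = true
  (e ∷ m) ≟ᵐ (f ∷ m′) = (e ≡ᵇ f) ∧ (m ≟ᵐ m′)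

  ≟ᵐ-sound : ∀ {n} (m m′ : Monomial n) → m ≟ᵐ m′ ≡ true → m ≡ m′
  ≟ᵐ-sound [] [] _ = refl
  ≟ᵐ-sound (e ∷ m) (f ∷ m′) h = cong₂ _∷_
    (ℕP.≡ᵇ⇒≡ e f (subst Bool.T (sym (∧-left {e ≡ᵇ f} h)) tt)) (≟ᵐ-sound m m′ (∧-right {e ≡ᵇ f} h))

  tval : ∀ {n} → Vec ℚ n → Terms n → ℚ
  tval ρ [] = 0ℚ
  tval ρ ((c , m) ∷ ts) = c * mval ρ m + tval ρ ts

  insert : ∀ {n} → ℚ → Monomial n → Terms n → Terms n
  insert c m [] = (c , m) ∷ []
  insert c m ((d , m′) ∷ ts) = if m ≟ᵐ m′ then (c + d , m′) ∷ ts else (d , m′) ∷ insert c m ts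

  tval-insert : ∀ {n} (ρ : Vec ℚ n) c m ts → tval ρ (insert c m ts) ≡ c * mval ρ m + tval ρ ts
  tval-insert ρ c m [] = refl
  tval-insert ρ c m ((d , m′) ∷ ts) with m ≟ᵐ m′ in eq
  ... | true rewrite ≟ᵐ-sound m m′ eq =
    solve 4 (λ c d m t → (c :+ d) :* m :+ t := c :* m :+ (d :* m :+ t)) refl c d (mval ρ m′) (tval ρ ts)
  ... | false = trans (cong (_+_ (d * mval ρ m′)) (tval-insert ρ c m ts))
    (solve 3 (λ a b t → a :+ (b :+ t) := b :+ (a :+ t)) refl (d * mval ρ m′) (c * mval ρ m) (tval ρ ts))

  -- Truncation happens at every insertion, so intermediate lists never contain a monomial of weight
  -- `k` or more; this keeps large expansions feasible.
  truncInsert : ∀ {n} → ℕ → Vec ℕ n → ℚ → Monomial n → Terms n → Terms n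
  truncInsert k ws c m ts = if k ≤ᵇ mwt ws m then ts else insert c m ts

  truncAdd : ∀ {n} → ℕ → Vec ℕ n → Terms n → Terms n → Terms n
  truncAdd k ws [] us = us
  truncAdd k ws ((c , m) ∷ ts) us = truncInsert k ws c m (truncAdd k ws ts us)

  truncScale : ∀ {n} → ℕ → Vec ℕ n → ℚ → Monomial n → Terms n → Terms n → Terms n
  truncScale k ws c m [] vs = vs
  truncScale k ws c m ((d , m′) ∷ us) vs = truncInsert k ws (c * d) (m ⊗ m′) (truncScale k ws c m us vs)

  truncMul : ∀ {n} → ℕ → Vec ℕ n → Terms n → Terms n → Terms n
  truncMul k ws [] us = []
  truncMul k ws ((c , m) ∷ ts) us = truncScale k ws c m us (truncMul k ws ts us)

  negate : ∀ {n} → Terms n → Terms n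
  negate [] = []
  negate ((c , m) ∷ ts) = (- c , m) ∷ negate ts

  tval-negate : ∀ {n} (ρ : Vec ℚ n) ts → tval ρ (negate ts) ≡ - tval ρ ts
  tval-negate ρ [] = refl
  tval-negate ρ ((c , m) ∷ ts) = trans (cong (_+_ (- c * mval ρ m)) (tval-negate ρ ts))
    (solve 3 (λ c m t → :- c :* m :+ :- t := :- (c :* m :+ t)) refl c (mval ρ m) (tval ρ ts))

  expand : ∀ {n} → ℕ → Vec ℕ n → Polynomial n → Terms n
  expand k ws (op [+] a b) = truncAdd k ws (expand k ws a) (expand k ws b)
  expand k ws (op [*] a b) = truncMul k ws (expand k ws a) (expand k ws b)
  expand k ws (con c) = (c , one) ∷ []
  expand k ws (var i) = (1ℚ , unit i) ∷ []
  -- `admissible` rejects this constructor, which makes the default sound; powers are written as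
  -- products.
  expand k ws (a :^ n) = []
  expand k ws (:- a) = negate (expand k ws a)

  -- Primes p ≥ 11 do not divide the denominators of the constants of an admissible polynomial.
  admissible : ∀ {n} → Polynomial n → Bool
  admissible (op _ a b) = admissible a ∧ admissible b
  admissible (con c) = does (↧ₙ c ∣? ((10 !) ℕ.* (10 !)))
  admissible (var i) = true
  admissible (a :^ n) = false
  admissible (:- a) = admissible a

  isZero : ℚ → Bool
  isZero (mkℚ +0 _ _) = true
  isZero _ = false

  isZero-sound : ∀ c → isZero c ≡ true → c ≡ 0ℚ
  isZero-sound c@(mkℚ +0 d _) _ = ℚP.≃⇒≡ {c} {0ℚ} (ℚ.*≡* refl)

  allZero : ∀ {n} → Terms n → Bool
  allZero [] = true
  allZero ((c , m) ∷ ts) = isZero c ∧ allZero ts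

  allZero-sound : ∀ {n} (ρ : Vec ℚ n) ts → allZero ts ≡ true → tval ρ ts ≡ 0ℚ
  allZero-sound ρ [] _ = refl
  allZero-sound ρ ((c , m) ∷ ts) h =
    trans (cong₂ (λ x y → x * mval ρ m + y) (isZero-sound c (∧-left {isZero c} h)) (allZero-sound ρ ts (∧-right {isZero c} h)))
      (trans (ℚP.+-identityʳ _) (ℚP.*-zeroˡ (mval ρ m)))

  module Order (p : ℕ) (pp : Prime p) (11≤p : 11 ≤ p) where
    open Filtration p pp public

    ≤p : ∀ k {_ : Bool.T (k ≤ᵇ 11)} → k ≤ p
    ≤p k {h} = ℕP.≤-trans (ℕP.≤ᵇ⇒≤ k 11 h) 11≤p

    infixr 5 _∷_
    -- An environment given by the proofs of order alone: the value and the weight of each variable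
    -- are read off the type of its proof.
    data Weighted : ℕ → Set where
      []  : Weighted 0
      _∷_ : ∀ {n w x} → V w x → Weighted n → Weighted (suc n)

    values : ∀ {n} → Weighted n → Vec ℚ n
    values [] = []
    values (_∷_ {x = x} _ vs) = x ∷ values vs

    weights : ∀ {n} → Weighted n → Vec ℕ n
    weights [] = []
    weights (_∷_ {w = w} _ vs) = w ∷ weights vs

    p∤! : ∀ n → n < p → ¬ p ∣ n !
    p∤! zero _ = p∤1
    p∤! (suc n) n<p = p∤product (>⇒∤ n<p) (p∤! n (ℕP.<-trans (ℕP.n<1+n n) n<p))

    -- A monomial of weight at least `k` may be dropped only if its coefficient is p-integral, so
    -- integrality is carried through the expansion.
    data AllLoc {n} : Terms n → Set where
      []  : AllLoc []
      _∷_ : ∀ {c m ts} → V 0 c → AllLoc ts → AllLoc ((c , m) ∷ ts)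

    module _ {n} (vs : Weighted n) where
      private
        ρ = values vs
        ws = weights vs

      V-mval : ∀ (m : Monomial n) → V (mwt ws m) (mval ρ m)
      V-mval = go vs
        where
        go : ∀ {n} (vs : Weighted n) m → V (mwt (weights vs) m) (mval (values vs) m)
        go [] [] = V-ι 1
        go (v ∷ vs) (e ∷ m) = V-* (V-↑ e v) (go vs m)

      V-tval : ∀ {ts : Terms n} → AllLoc ts → V 0 (tval ρ ts)
      V-tval [] = V-0
      V-tval (_∷_ {c = c} {m} v l) = V-+ (V-*ˡ {x = c} v (V-≤ z≤n (V-mval m))) (V-tval l)

      insert-loc : ∀ {c} m {ts : Terms n} → V 0 c → AllLoc ts → AllLoc (insert c m ts)
      insert-loc m v [] = v ∷ []
      insert-loc m v (_∷_ {m = m′} w l) with m ≟ᵐ m′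
      ... | true = V-+ v w ∷ l
      ... | false = w ∷ insert-loc m v l

      module _ (k : ℕ) where

        truncInsert-loc : ∀ {c} m {ts} → V 0 c → AllLoc ts → AllLoc (truncInsert k ws c m ts)
        truncInsert-loc m v l with k ≤ᵇ mwt ws m
        ... | true = l
        ... | false = insert-loc m v l

        truncInsert-≈ : ∀ c m ts → V 0 c → tval ρ (truncInsert k ws c m ts) ≈[ k ] c * mval ρ m + tval ρ ts
        truncInsert-≈ c m ts v with k ≤ᵇ mwt ws m in eq
        ... | true = ≈-sym (mk≈ (V-resp (solve 2 (λ a b → a := (a :+ b) :- b) refl (c * mval ρ m) (tval ρ ts))
                (V-*ˡ v (V-≤ (ℕP.≤ᵇ⇒≤ k _ (subst Bool.T (sym eq) tt)) (V-mval m)))))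
        ... | false = ≈-reflexive (tval-insert ρ c m ts)

        truncAdd-loc : ∀ {ts us} → AllLoc ts → AllLoc us → AllLoc (truncAdd k ws ts us)
        truncAdd-loc [] l′ = l′
        truncAdd-loc (_∷_ {m = m} v l) l′ = truncInsert-loc m v (truncAdd-loc l l′)

        truncAdd-≈ : ∀ {ts us} → AllLoc ts → tval ρ (truncAdd k ws ts us) ≈[ k ] tval ρ ts + tval ρ us
        truncAdd-≈ [] = ≈-reflexive (sym (ℚP.+-identityˡ _))
        truncAdd-≈ {us = us} (_∷_ {c = c} {m} {ts} v l) = ≈-trans (truncInsert-≈ c m (truncAdd k ws ts us) v)
          (≈-trans (≈-+ (≈-refl {x = c * mval ρ m}) (truncAdd-≈ l)) (≈-reflexive (sym (ℚP.+-assoc (c * mval ρ m) (tval ρ ts) (tval ρ us)))))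

        truncScale-loc : ∀ {c} m {us vs′} → V 0 c → AllLoc us → AllLoc vs′ → AllLoc (truncScale k ws c m us vs′)
        truncScale-loc m v [] l = l
        truncScale-loc m v (_∷_ {m = m′} w l′) l = truncInsert-loc (m ⊗ m′) (V-*ˡ v w) (truncScale-loc m v l′ l)

        truncScale-≈ : ∀ {c} m {us vs′} → V 0 c → AllLoc us → tval ρ (truncScale k ws c m us vs′) ≈[ k ] c * mval ρ m * tval ρ us + tval ρ vs′
        truncScale-≈ {c} m {vs′ = vs′} v [] = ≈-reflexive (solve 2 (λ a b → b := a :* con 0ℚ :+ b) refl (c * mval ρ m) (tval ρ vs′))
        truncScale-≈ {c} m {vs′ = vs′} v (_∷_ {c = d} {m′} {us} w l) = ≈-trans (truncInsert-≈ (c * d) (m ⊗ m′) (truncScale k ws c m us vs′) (V-*ˡ v w))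
          (≈-trans (≈-+ (≈-reflexive (cong (c * d *_) (mval-⊗ ρ m m′))) (truncScale-≈ m v l))
            (≈-reflexive (solve 6 (λ c d m m′ u v → c :* d :* (m :* m′) :+ (c :* m :* u :+ v) := c :* m :* (d :* m′ :+ u) :+ v) refl
              c d (mval ρ m) (mval ρ m′) (tval ρ us) (tval ρ vs′))))

        truncMul-loc : ∀ {ts us} → AllLoc ts → AllLoc us → AllLoc (truncMul k ws ts us)
        truncMul-loc [] l′ = []
        truncMul-loc (_∷_ {m = m} v l) l′ = truncScale-loc m v l′ (truncMul-loc l l′)

        truncMul-≈ : ∀ {ts us} → AllLoc ts → AllLoc us → tval ρ (truncMul k ws ts us) ≈[ k ] tval ρ ts * tval ρ us
        truncMul-≈ {us = us} [] l′ = ≈-reflexive (sym (ℚP.*-zeroˡ (tval ρ us)))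
        truncMul-≈ {us = us} (_∷_ {c = c} {m} {ts} v l) l′ = ≈-trans (truncScale-≈ m v l′)
          (≈-trans (≈-+ (≈-refl {x = c * mval ρ m * tval ρ us}) (truncMul-≈ l l′)) (≈-reflexive (sym (ℚP.*-distribʳ-+ (tval ρ us) (c * mval ρ m) (tval ρ ts)))))

        negate-loc : ∀ {ts} → AllLoc ts → AllLoc {n} (negate ts)
        negate-loc [] = []
        negate-loc (v ∷ l) = V-neg v ∷ negate-loc l

        con-loc : ∀ c → does (↧ₙ c ∣? ((10 !) ℕ.* (10 !))) ≡ true → V 0 c
        con-loc c h = Loc⇒V (λ p∣c → p∤product (p∤! 10 11≤p) (p∤! 10 11≤p) (∣-trans p∣c (does-true (↧ₙ c ∣? ((10 !) ℕ.* (10 !))) h)))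

        expand-loc : ∀ e → admissible e ≡ true → AllLoc (expand k ws e)
        expand-loc (op [+] a b) h = truncAdd-loc (expand-loc a (∧-left h)) (expand-loc b (∧-right {admissible a} h))
        expand-loc (op [*] a b) h = truncMul-loc (expand-loc a (∧-left h)) (expand-loc b (∧-right {admissible a} h))
        expand-loc (con c) h = con-loc c h ∷ []
        expand-loc (var i) h = V-ι 1 ∷ []
        expand-loc (:- a) h = negate-loc (expand-loc a h)

        expand-≈ : ∀ e → admissible e ≡ true → tval ρ (expand k ws e) ≈[ k ] ⟦ e ⟧ ρ
        -- Mutual with `expand-≈`: replacing a factor of a product by a congruent one requires the
        -- other factor to be integral, and that follows from the congruence for the smaller
        -- expression.
        value-loc : ∀ e → admissible e ≡ true → V 0 (⟦ e ⟧ ρ)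
        value-loc e h = ≈⇒V (≈-≤ z≤n (≈-sym (expand-≈ e h))) (V-tval (expand-loc e h))

        expand-≈ (op [+] a b) h = ≈-trans (truncAdd-≈ (expand-loc a (∧-left h))) (≈-+ (expand-≈ a (∧-left h)) (expand-≈ b (∧-right {admissible a} h)))
        expand-≈ (op [*] a b) h = ≈-trans (truncMul-≈ (expand-loc a (∧-left h)) (expand-loc b (∧-right {admissible a} h)))
          (≈-* (V-tval (expand-loc a (∧-left h))) (value-loc b (∧-right {admissible a} h)) (expand-≈ a (∧-left h)) (expand-≈ b (∧-right {admissible a} h)))
        expand-≈ (con c) h = ≈-reflexive (trans (ℚP.+-identityʳ _) (trans (cong (c *_) (mval-one ρ)) (ℚP.*-identityʳ c)))
        expand-≈ (var i) h = ≈-reflexive (trans (ℚP.+-identityʳ _) (trans (ℚP.*-identityˡ _) (mval-unit ρ i)))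
        expand-≈ (:- a) h = ≈-trans (≈-reflexive (tval-negate ρ (expand k ws a))) (≈-neg (expand-≈ a h))

      close : N-ary n (Polynomial n) (Polynomial n) → Polynomial n
      close f = f $ⁿ Vec.map var (allFin n)

      -- The polynomial f is expanded, discarding every monomial whose weight is at least k; if nothing is left, its value lies in pᵏℤ₍ₚ₎.
      V-poly : ∀ k (f : N-ary n (Polynomial n) (Polynomial n)) →
        admissible (close f) ∧ allZero (expand k ws (close f)) ≡ true → V k (⟦ close f ⟧ ρ)
      V-poly k f h = ≈⇒V (≈-sym (expand-≈ k (close f) (∧-left h)))
        (V-resp (sym (allZero-sound ρ (expand k ws (close f)) (∧-right {admissible (close f)} h))) V-0)

      ≈-poly : ∀ k (f g : N-ary n (Polynomial n) (Polynomial n)) →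
        admissible (close f :- close g) ∧ allZero (expand k ws (close f :- close g)) ≡ true → ⟦ close f ⟧ ρ ≈[ k ] ⟦ close g ⟧ ρ
      ≈-poly k f g h = mk≈ (≈⇒V (≈-sym (expand-≈ k e (∧-left h)))
        (V-resp (sym (allZero-sound ρ (expand k ws e) (∧-right {admissible e} h))) V-0))
        where e = close f :- close g

  -- Bernoulli numbers and power sums

  nth-++ˡ : ∀ xs ys k → k < length xs → nth (xs ++ ys) k ≡ nth xs k
  nth-++ˡ (x ∷ xs) ys zero _ = refl
  nth-++ˡ (x ∷ xs) ys (suc k) (s≤s h) = nth-++ˡ xs ys k h

  nth-last : ∀ xs y k → k ≡ length xs → nth (xs ++ y ∷ []) k ≡ y
  nth-last [] y zero _ = refl
  nth-last (x ∷ xs) y (suc k) h = nth-last xs y k (ℕP.suc-injective h)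

  length-bernList : ∀ n → length (bernList n) ≡ suc n
  length-bernList zero = refl
  length-bernList (suc n) = trans (LP.length-++ (bernList n)) (trans (ℕP.+-comm _ 1) (cong suc (length-bernList n)))

  nth-bernList : ∀ n k → k ≤ n → nth (bernList n) k ≡ B k
  nth-bernList zero zero _ = refl
  nth-bernList (suc n) k k≤1+n with ℕP.m≤n⇒m<n∨m≡n k≤1+n
  ... | inj₁ (s≤s k≤n) = trans
    (nth-++ˡ (bernList n) _ k (subst (k <_) (sym (length-bernList n)) (s≤s k≤n))) (nth-bernList n k k≤n)
  ... | inj₂ refl = refl

  weighted-∑ : ∀ m k bs → weighted m k bs ≡ ∑ (length bs) (λ i → ι (m C (k ℕ.+ i)) * nth bs i)
  weighted-∑ m k [] = refl
  weighted-∑ m k (b ∷ bs) = cong₂ _+_ (cong (λ t → ι (m C t) * b) (sym (ℕP.+-identityʳ k)))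
    (trans (weighted-∑ m (suc k) bs) (∑-cong (length bs) (λ i _ → cong (λ t → ι (m C t) * nth bs i) (sym (ℕP.+-suc k i)))))

  B-suc : ∀ n → B (suc n) ≡ - (recipℕ (suc (suc n)) * ∑ (suc n) (λ i → ι (suc (suc n) C i) * B i))
  B-suc n = trans (nth-last (bernList n) _ (suc n) (sym (length-bernList n)))
    (cong (λ t → - (recipℕ (suc (suc n)) * t)) (trans (weighted-∑ (suc (suc n)) 0 (bernList n))
      (trans (cong (λ l → ∑ l (λ i → ι (suc (suc n) C i) * nth (bernList n) i)) (length-bernList n))
        (∑-cong (suc n) (λ i i<n → cong (ι (suc (suc n) C i) *_) (nth-bernList n i (ℕ.s≤s⁻¹ i<n)))))))

  invFact : ℕ → ℚ
  invFact k = recipℕ (k !)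

  invFact-suc : ∀ k → ι (suc k) * invFact (suc k) ≡ invFact k
  invFact-suc k = begin
    ι (suc k) * recipℕ (suc k ℕ.* k !)             ≡⟨ cong (ι (suc k) *_) (recip-* (suc k) (k !) {{_}} {{k ℕP.!≢0}}) ⟩
    ι (suc k) * (recipℕ (suc k) * recipℕ (k !))    ≡⟨ ℚP.*-assoc (ι (suc k)) _ _ ⟨
    ι (suc k) * recipℕ (suc k) * recipℕ (k !)      ≡⟨ cong (_* recipℕ (k !)) (ι-recip (suc k)) ⟩
    1ℚ * recipℕ (k !)                              ≡⟨ ℚP.*-identityˡ _ ⟩
    recipℕ (k !)                                   ∎

  fact-invFact : ∀ k → ι (k !) * invFact k ≡ 1ℚ
  fact-invFact k = ι-recip (k !) {{k ℕP.!≢0}}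

  C-*! : ∀ {n k} → k ≤ n → (n C k) ℕ.* (k ! ℕ.* (n ∸ k) !) ≡ n !
  C-*! {n} {k} k≤n = trans (cong (ℕ._* (k ! ℕ.* (n ∸ k) !)) (nCk≡n!/k![n-k]! k≤n)) (m/n*n≡m (k![n∸k]!∣n! k≤n))
    where instance _ = k ℕP.!* (n ∸ k) !≢0

  ι-C : ∀ {n k} → k ≤ n → ι (n C k) ≡ ι (n !) * (invFact k * invFact (n ∸ k))
  ι-C {n} {k} k≤n = sym (begin
    ι (n !) * (invFact k * invFact (n ∸ k))
      ≡⟨ cong (λ t → ι t * (invFact k * invFact (n ∸ k))) (C-*! k≤n) ⟨
    ι ((n C k) ℕ.* (k ! ℕ.* (n ∸ k) !)) * (invFact k * invFact (n ∸ k))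
      ≡⟨ cong (_* (invFact k * invFact (n ∸ k))) (trans (ι-* (n C k) _) (cong (ι (n C k) *_) (ι-* (k !) ((n ∸ k) !)))) ⟩
    ι (n C k) * (ι (k !) * ι ((n ∸ k) !)) * (invFact k * invFact (n ∸ k))
      ≡⟨ solve 5 (λ a b c d e → a :* (b :* c) :* (d :* e) := a :* ((b :* d) :* (c :* e))) refl
           (ι (n C k)) (ι (k !)) (ι ((n ∸ k) !)) (invFact k) (invFact (n ∸ k)) ⟩
    ι (n C k) * ((ι (k !) * invFact k) * (ι ((n ∸ k) !) * invFact (n ∸ k)))
      ≡⟨ cong (ι (n C k) *_) (cong₂ _*_ (fact-invFact k) (fact-invFact (n ∸ k))) ⟩
    ι (n C k) * 1ℚ
      ≡⟨ ℚP.*-identityʳ _ ⟩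
    ι (n C k) ∎)

  -- Exponential generating functions: a sequence f stands for ∑ f k xᵏ, so exp a is e^{ax} and β is x/(eˣ-1).
  exp : ℚ → ℕ → ℚ
  exp a k = a ↑ k * invFact k

  tail : (ℕ → ℚ) → ℕ → ℚ
  tail f k = f (suc k)

  δ₀ : ℕ → ℚ
  δ₀ zero = 1ℚ
  δ₀ (suc _) = 0ℚ

  β : ℕ → ℚ
  β k = B k * invFact k

  ⋆-congˡ : ∀ m {f f′ g} → (∀ i → f i ≡ f′ i) → (f ⋆ g) m ≡ (f′ ⋆ g) m
  ⋆-congˡ m h = ⋆-cong m h (λ _ → refl)

  ⋆-congʳ : ∀ m {f g g′} → (∀ i → g i ≡ g′ i) → (f ⋆ g) m ≡ (f ⋆ g′) m
  ⋆-congʳ m h = ⋆-cong m (λ _ → refl) h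

  ⋆-zeroˡ : ∀ m g → ((λ _ → 0ℚ) ⋆ g) m ≡ 0ℚ
  ⋆-zeroˡ zero g = ℚP.*-zeroˡ (g 0)
  ⋆-zeroˡ (suc m) g = cong₂ _+_ (ℚP.*-zeroˡ (g (suc m))) (⋆-zeroˡ m g)

  ⋆-scaleˡ : ∀ m c f g → ((λ i → c * f i) ⋆ g) m ≡ c * (f ⋆ g) m
  ⋆-scaleˡ m c f g = trans (⋆-congˡ m {f′ = λ i → c * f i + 0ℚ} {g = g} (λ i → sym (ℚP.+-identityʳ (c * f i))))
    (trans (⋆-linearˡ m c f (λ _ → 0ℚ) g) (trans (cong (_+_ (c * (f ⋆ g) m)) (⋆-zeroˡ m g)) (ℚP.+-identityʳ _)))

  ⋆-identityˡ : ∀ m g → (δ₀ ⋆ g) m ≡ g m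
  ⋆-identityˡ zero g = ℚP.*-identityˡ (g 0)
  ⋆-identityˡ (suc m) g = trans (cong₂ _+_ (ℚP.*-identityˡ (g (suc m))) (⋆-zeroˡ m g)) (ℚP.+-identityʳ _)

  ⋆-identityʳ : ∀ m g → (g ⋆ δ₀) m ≡ g m
  ⋆-identityʳ m g = trans (⋆-comm m g δ₀) (⋆-identityˡ m g)

  -- The substitution x ↦ c x is multiplicative on generating functions.
  ⋆-geometric : ∀ m c f g → c ↑ m * (f ⋆ g) m ≡ ((λ i → c ↑ i * f i) ⋆ (λ i → c ↑ i * g i)) m
  ⋆-geometric zero c f g = solve 2 (λ a b → con 1ℚ :* (a :* b) := (con 1ℚ :* a) :* (con 1ℚ :* b)) refl (f 0) (g 0)
  ⋆-geometric (suc m) c f g = begin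
    c * c ↑ m * (f 0 * g (suc m) + (tail f ⋆ g) m)
      ≡⟨ solve 5 (λ c d a b e → c :* d :* (a :* b :+ e) := (con 1ℚ :* a) :* (c :* d :* b) :+ c :* (d :* e)) refl c (c ↑ m) (f 0) (g (suc m)) ((tail f ⋆ g) m) ⟩
    1ℚ * f 0 * (c * c ↑ m * g (suc m)) + c * (c ↑ m * (tail f ⋆ g) m)
      ≡⟨ cong (λ t → 1ℚ * f 0 * (c * c ↑ m * g (suc m)) + c * t) (⋆-geometric m c (tail f) g) ⟩
    1ℚ * f 0 * (c * c ↑ m * g (suc m)) + c * ((λ i → c ↑ i * tail f i) ⋆ (λ i → c ↑ i * g i)) m
      ≡⟨ cong (_+_ (1ℚ * f 0 * (c * c ↑ m * g (suc m)))) (trans (sym (⋆-scaleˡ m c _ _)) (⋆-congˡ m (λ i → sym (ℚP.*-assoc c (c ↑ i) (tail f i))))) ⟩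
    ((λ i → c ↑ i * f i) ⋆ (λ i → c ↑ i * g i)) (suc m) ∎

  θ-exp : ∀ a k → θ (exp a) (suc k) ≡ a * exp a k
  θ-exp a k = trans (solve 4 (λ n a b e → n :* (a :* b :* e) := a :* (b :* (n :* e))) refl (ι (suc k)) a (a ↑ k) (invFact (suc k)))
    (cong (λ t → a * (a ↑ k * t)) (invFact-suc k))

  θ-exp-⋆ : ∀ a m g → (θ (exp a) ⋆ g) (suc m) ≡ a * (exp a ⋆ g) m
  θ-exp-⋆ a m g = trans (cong₂ _+_ (trans (cong (_* g (suc m)) (ℚP.*-zeroˡ (exp a 0))) (ℚP.*-zeroˡ (g (suc m)))) (⋆-congˡ m (θ-exp a)))
    (trans (ℚP.+-identityˡ _) (⋆-scaleˡ m a (exp a) g))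

  -- Both sides satisfy θ F = (a + b) x F, the left one by Leibniz; this determines each coefficient
  -- from the preceding one.
  exp-+ : ∀ m a b → (exp a ⋆ exp b) m ≡ exp (a + b) m
  exp-+ zero a b = refl
  exp-+ (suc m) a b = ι-cancel (suc m) (begin
    ι (suc m) * (exp a ⋆ exp b) (suc m)
      ≡⟨ θ-⋆ (suc m) (exp a) (exp b) ⟩
    (θ (exp a) ⋆ exp b) (suc m) + (exp a ⋆ θ (exp b)) (suc m)
      ≡⟨ cong₂ _+_ (θ-exp-⋆ a m (exp b)) (trans (⋆-comm (suc m) (exp a) (θ (exp b))) (θ-exp-⋆ b m (exp a))) ⟩
    a * (exp a ⋆ exp b) m + b * (exp b ⋆ exp a) m
      ≡⟨ cong₂ (λ s t → a * s + b * t) (exp-+ m a b) (trans (⋆-comm m (exp b) (exp a)) (exp-+ m a b)) ⟩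
    a * exp (a + b) m + b * exp (a + b) m
      ≡⟨ ℚP.*-distribʳ-+ (exp (a + b) m) a b ⟨
    (a + b) * exp (a + b) m
      ≡⟨ θ-exp (a + b) m ⟨
    ι (suc m) * exp (a + b) (suc m) ∎)

  -- The coefficient of xⁿ in eᵃˣ eᵇˣ, multiplied by n!.
  binomial : ∀ n a b → (a + b) ↑ n ≡ ∑ (suc n) (λ k → ι (n C k) * (a ↑ k * b ↑ (n ∸ k)))
  binomial n a b = begin
    (a + b) ↑ n
      ≡⟨ solve 3 (λ x y z → x := (y :* z) :* x :+ (x :- (y :* z) :* x)) refl ((a + b) ↑ n) (ι (n !)) (invFact n) ⟩
    (ι (n !) * invFact n) * (a + b) ↑ n + ((a + b) ↑ n - (ι (n !) * invFact n) * (a + b) ↑ n)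
      ≡⟨ cong (λ t → (ι (n !) * invFact n) * (a + b) ↑ n + ((a + b) ↑ n - t * (a + b) ↑ n)) (fact-invFact n) ⟩
    (ι (n !) * invFact n) * (a + b) ↑ n + ((a + b) ↑ n - 1ℚ * (a + b) ↑ n)
      ≡⟨ solve 3 (λ x y z → (y :* z) :* x :+ (x :- con 1ℚ :* x) := y :* (x :* z)) refl ((a + b) ↑ n) (ι (n !)) (invFact n) ⟩
    ι (n !) * exp (a + b) n
      ≡⟨ cong (ι (n !) *_) (trans (sym (exp-+ n a b)) (⋆-∑ n (exp a) (exp b))) ⟩
    ι (n !) * ∑ (suc n) (λ k → exp a k * exp b (n ∸ k))
      ≡⟨ ∑-*ˡ (suc n) (ι (n !)) (λ k → exp a k * exp b (n ∸ k)) ⟨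
    ∑ (suc n) (λ k → ι (n !) * (exp a k * exp b (n ∸ k)))
      ≡⟨ ∑-cong (suc n) (λ k k<n → trans
           (solve 5 (λ f a x b y → f :* ((a :* x) :* (b :* y)) := f :* (x :* y) :* (a :* b)) refl (ι (n !)) (a ↑ k) (invFact k) (b ↑ (n ∸ k)) (invFact (n ∸ k)))
           (cong (_* (a ↑ k * b ↑ (n ∸ k))) (sym (ι-C (ℕ.s≤s⁻¹ k<n))))) ⟩
    ∑ (suc n) (λ k → ι (n C k) * (a ↑ k * b ↑ (n ∸ k))) ∎

  -- `tail` removes the constant term and divides by x, so this is x/(eˣ-1) · (eˣ-1)/x = 1.
  -- Multiplied by (m+2)!, the coefficient of degree m + 1 is the defining recurrence of the
  -- Bernoulli numbers.
  β-exp : ∀ m → (β ⋆ tail (exp 1ℚ)) m ≡ δ₀ m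
  β-exp zero = refl
  β-exp (suc m) = ι-cancel (N !) {{N ℕP.!≢0}} (begin
    ι (N !) * (β ⋆ tail (exp 1ℚ)) (suc m)
      ≡⟨ cong (ι (N !) *_) (⋆-∑ (suc m) β (tail (exp 1ℚ))) ⟩
    ι (N !) * ∑ (suc (suc m)) (λ k → β k * exp 1ℚ (suc (suc m ∸ k)))
      ≡⟨ ∑-*ˡ (suc (suc m)) (ι (N !)) (λ k → β k * exp 1ℚ (suc (suc m ∸ k))) ⟨
    ∑ (suc (suc m)) (λ k → ι (N !) * (β k * exp 1ℚ (suc (suc m ∸ k))))
      ≡⟨ ∑-cong (suc (suc m)) (λ k k<n → trans
            (cong₂ (λ s t → ι (N !) * (β k * (s * t))) (1-↑ (suc (suc m ∸ k))) (cong invFact (sym (ℕP.+-∸-assoc 1 (ℕ.s≤s⁻¹ k<n)))))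
            (trans (solve 4 (λ f b x y → f :* ((b :* x) :* (con 1ℚ :* y)) := f :* (x :* y) :* b) refl (ι (N !)) (B k) (invFact k) (invFact (N ∸ k)))
              (cong (_* B k) (sym (ι-C (ℕP.≤-trans (ℕ.s≤s⁻¹ k<n) (ℕP.n≤1+n (suc m)))))))) ⟩
    ∑ (suc (suc m)) (λ k → ι (N C k) * B k)
      ≡⟨ ∑-last (suc m) (λ k → ι (N C k) * B k) ⟩
    X + ι (N C suc m) * B (suc m)
      ≡⟨ cong₂ (λ s t → X + ι s * t) top (B-suc m) ⟩
    X + ι N * - (recipℕ N * X)
      ≡⟨ solve 3 (λ x n r → x :+ n :* :- (r :* x) := x :- (n :* r) :* x) refl X (ι N) (recipℕ N) ⟩
    X - (ι N * recipℕ N) * X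
      ≡⟨ cong (λ t → X - t * X) (ι-recip N) ⟩
    X - 1ℚ * X
      ≡⟨ solve 2 (λ x n → x :- con 1ℚ :* x := n :* con 0ℚ) refl X (ι (N !)) ⟩
    ι (N !) * 0ℚ ∎)
    where
    N = suc (suc m)
    X = ∑ (suc m) (λ k → ι (N C k) * B k)
    top : N C suc m ≡ N
    top = trans (nCk≡nC[n∸k] (ℕP.n≤1+n (suc m))) (trans (cong (N C_) (trans (ℕP.+-∸-assoc 1 (ℕP.≤-refl {suc m})) (cong suc (ℕP.n∸n≡0 m)))) (nC1≡n N))

  powerSum : ℕ → ℕ → ℚ
  powerSum n k = ∑ n (λ a → ι a ↑ k)

  exp-step : ∀ a m → (exp a ⋆ tail (exp 1ℚ)) m ≡ exp (1ℚ + a) (suc m) - exp a (suc m)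
  exp-step a m = begin
    (exp a ⋆ tail (exp 1ℚ)) m
      ≡⟨ ⋆-comm m (exp a) _ ⟩
    (tail (exp 1ℚ) ⋆ exp a) m
      ≡⟨ solve 2 (λ x y → x := (con 1ℚ :* con 1ℚ) :* y :+ x :- y) refl ((tail (exp 1ℚ) ⋆ exp a) m) (exp a (suc m)) ⟩
    (exp 1ℚ ⋆ exp a) (suc m) - exp a (suc m)
      ≡⟨ cong (_- exp a (suc m)) (exp-+ (suc m) 1ℚ a) ⟩
    exp (1ℚ + a) (suc m) - exp a (suc m) ∎

  -- The telescoping sum of e⁰, eˣ, ..., e⁽ⁿ⁻¹⁾ˣ times eˣ - 1, divided by x. The constant -1 of eⁿˣ
  -- - 1 is invisible at the positive index `suc m`; the summand a = 0 counts with 0⁰ = 1.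
  powerSum-exp : ∀ n m → ((λ k → powerSum n k * invFact k) ⋆ tail (exp 1ℚ)) m ≡ exp (ι n) (suc m)
  powerSum-exp zero m = trans (⋆-congˡ m (λ k → ℚP.*-zeroˡ (invFact k))) (trans (⋆-zeroˡ m _)
    (sym (trans (cong (_* invFact (suc m)) (ℚP.*-zeroˡ (0ℚ ↑ m))) (ℚP.*-zeroˡ (invFact (suc m))))))
  powerSum-exp (suc n) m = begin
    ((λ k → powerSum (suc n) k * invFact k) ⋆ tail (exp 1ℚ)) m
      ≡⟨ ⋆-congˡ m (λ k → trans (cong (_* invFact k) (∑-last n (λ a → ι a ↑ k))) (ℚP.*-distribʳ-+ (invFact k) (powerSum n k) (ι n ↑ k))) ⟩
    ((λ k → powerSum n k * invFact k + exp (ι n) k) ⋆ tail (exp 1ℚ)) m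
      ≡⟨ ⋆-addˡ m _ _ _ ⟩
    ((λ k → powerSum n k * invFact k) ⋆ tail (exp 1ℚ)) m + (exp (ι n) ⋆ tail (exp 1ℚ)) m
      ≡⟨ cong₂ _+_ (powerSum-exp n m) (exp-step (ι n) m) ⟩
    exp (ι n) (suc m) + (exp (1ℚ + ι n) (suc m) - exp (ι n) (suc m))
      ≡⟨ solve 2 (λ x y → x :+ (y :- x) := y) refl (exp (ι n) (suc m)) (exp (1ℚ + ι n) (suc m)) ⟩
    exp (1ℚ + ι n) (suc m)
      ≡⟨ cong (λ t → exp t (suc m)) (ι-suc n) ⟨
    exp (ι (suc n)) (suc m) ∎

  -- Multiplying `powerSum-exp` by `β` inverts (eˣ-1)/x. The sum is arranged by powers of `n`, so
  -- that at n = p its terms become p-adically small.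
  faulhaber : ∀ n k → powerSum n k ≡ ∑ (suc k) (λ j → ι (k C j) * (ι n ↑ suc j * recipℕ (suc j)) * B (k ∸ j))
  faulhaber n k = ι-cancel 1 (begin
    1ℚ * powerSum n k
      ≡⟨ cong (_* powerSum n k) (fact-invFact k) ⟨
    ι (k !) * invFact k * powerSum n k
      ≡⟨ solve 3 (λ a b c → a :* b :* c := a :* (c :* b)) refl (ι (k !)) (invFact k) (powerSum n k) ⟩
    ι (k !) * σ k
      ≡⟨ cong (ι (k !) *_) σ≡ ⟩
    ι (k !) * (tail (exp (ι n)) ⋆ β) k
      ≡⟨ cong (ι (k !) *_) (⋆-∑ k (tail (exp (ι n))) β) ⟩
    ι (k !) * ∑ (suc k) (λ j → exp (ι n) (suc j) * β (k ∸ j))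
      ≡⟨ ∑-*ˡ (suc k) (ι (k !)) (λ j → exp (ι n) (suc j) * β (k ∸ j)) ⟨
    ∑ (suc k) (λ j → ι (k !) * (exp (ι n) (suc j) * β (k ∸ j)))
      ≡⟨ ∑-cong (suc k) (λ j j<k → term j (ℕ.s≤s⁻¹ j<k)) ⟩
    ∑ (suc k) (λ j → ι (k C j) * (ι n ↑ suc j * recipℕ (suc j)) * B (k ∸ j))
      ≡⟨ ℚP.*-identityˡ (∑ (suc k) (λ j → ι (k C j) * (ι n ↑ suc j * recipℕ (suc j)) * B (k ∸ j))) ⟨
    1ℚ * ∑ (suc k) (λ j → ι (k C j) * (ι n ↑ suc j * recipℕ (suc j)) * B (k ∸ j)) ∎)
    where
    σ : ℕ → ℚ
    σ k = powerSum n k * invFact k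
    σ≡ : σ k ≡ (tail (exp (ι n)) ⋆ β) k
    σ≡ = begin
      σ k                                    ≡⟨ ⋆-identityʳ k σ ⟨
      (σ ⋆ δ₀) k                             ≡⟨ ⋆-congʳ k (λ i → trans (sym (β-exp i)) (⋆-comm i β _)) ⟩
      (σ ⋆ (tail (exp 1ℚ) ⋆ β)) k            ≡⟨ ⋆-assoc k σ _ β ⟨
      ((σ ⋆ tail (exp 1ℚ)) ⋆ β) k            ≡⟨ ⋆-congˡ k (powerSum-exp n) ⟩
      (tail (exp (ι n)) ⋆ β) k               ∎
    term : ∀ j → j ≤ k → ι (k !) * (exp (ι n) (suc j) * β (k ∸ j)) ≡ ι (k C j) * (ι n ↑ suc j * recipℕ (suc j)) * B (k ∸ j)
    term j j≤k = begin
      ι (k !) * (ι n ↑ suc j * invFact (suc j) * (B (k ∸ j) * invFact (k ∸ j)))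
        ≡⟨ cong (λ t → ι (k !) * (ι n ↑ suc j * t * (B (k ∸ j) * invFact (k ∸ j)))) (recip-* (suc j) (j !) {{_}} {{j ℕP.!≢0}}) ⟩
      ι (k !) * (ι n ↑ suc j * (recipℕ (suc j) * invFact j) * (B (k ∸ j) * invFact (k ∸ j)))
        ≡⟨ solve 6 (λ f x r i b i′ → f :* (x :* (r :* i) :* (b :* i′)) := f :* (i :* i′) :* (x :* r) :* b) refl
             (ι (k !)) (ι n ↑ suc j) (recipℕ (suc j)) (invFact j) (B (k ∸ j)) (invFact (k ∸ j)) ⟩
      ι (k !) * (invFact j * invFact (k ∸ j)) * (ι n ↑ suc j * recipℕ (suc j)) * B (k ∸ j)
        ≡⟨ cong (λ t → t * (ι n ↑ suc j * recipℕ (suc j)) * B (k ∸ j)) (ι-C j≤k) ⟨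
      ι (k C j) * (ι n ↑ suc j * recipℕ (suc j)) * B (k ∸ j) ∎

  -1ℚ : ℚ
  -1ℚ = - 1ℚ

  -- (1 - e⁻ˣ)/x · eˣ = (eˣ - 1)/x.
  expNeg-tail : ∀ m → ((λ i → -1ℚ ↑ i * tail (exp 1ℚ) i) ⋆ exp 1ℚ) m ≡ exp 1ℚ (suc m)
  expNeg-tail m = begin
    ((λ i → -1ℚ ↑ i * tail (exp 1ℚ) i) ⋆ exp 1ℚ) m
      ≡⟨ ⋆-congˡ m (λ i → trans (cong (λ t → -1ℚ ↑ i * (t * invFact (suc i))) (1-↑ (suc i)))
           (solve 2 (λ a b → a :* (con 1ℚ :* b) := con -1ℚ :* (con -1ℚ :* a :* b)) refl (-1ℚ ↑ i) (invFact (suc i)))) ⟩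
    ((λ i → -1ℚ * tail (exp -1ℚ) i) ⋆ exp 1ℚ) m
      ≡⟨ ⋆-scaleˡ m -1ℚ (tail (exp -1ℚ)) (exp 1ℚ) ⟩
    -1ℚ * (tail (exp -1ℚ) ⋆ exp 1ℚ) m
      ≡⟨ solve 2 (λ x y → con -1ℚ :* x := y :- ((con 1ℚ :* con 1ℚ) :* y :+ x)) refl ((tail (exp -1ℚ) ⋆ exp 1ℚ) m) (exp 1ℚ (suc m)) ⟩
    exp 1ℚ (suc m) - (exp -1ℚ ⋆ exp 1ℚ) (suc m)
      ≡⟨ cong (_-_ (exp 1ℚ (suc m))) (trans (exp-+ (suc m) -1ℚ 1ℚ) (trans (cong (_* invFact (suc m)) (ℚP.*-zeroˡ (0ℚ ↑ m))) (ℚP.*-zeroˡ (invFact (suc m))))) ⟩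
    exp 1ℚ (suc m) - 0ℚ
      ≡⟨ ℚP.+-identityʳ _ ⟩
    exp 1ℚ (suc m) ∎

  -- x eˣ/(eˣ-1) = x/(eˣ-1) + x, which changes nothing from degree 2 on.
  β⋆exp : ∀ m → (β ⋆ exp 1ℚ) (suc (suc m)) ≡ β (suc (suc m))
  β⋆exp m = begin
    (β ⋆ exp 1ℚ) (suc (suc m))
      ≡⟨ ⋆-snoc (suc m) β (exp 1ℚ) ⟩
    (β ⋆ tail (exp 1ℚ)) (suc m) + β (suc (suc m)) * (1ℚ * 1ℚ)
      ≡⟨ cong₂ _+_ (β-exp (suc m)) (ℚP.*-identityʳ (β (suc (suc m)))) ⟩
    0ℚ + β (suc (suc m))
      ≡⟨ ℚP.+-identityˡ (β (suc (suc m))) ⟩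
    β (suc (suc m)) ∎

  -- In generating functions β(-x) = β(x) eˣ: insert 1 = β(x) · (eˣ-1)/x, rewrite the last factor by
  -- `expNeg-tail`, and cancel β(-x) against (1 - e⁻ˣ)/x.
  β-reflect : ∀ m → -1ℚ ↑ m * β m ≡ (β ⋆ exp 1ℚ) m
  β-reflect m = begin
    νβ m                          ≡⟨ ⋆-identityʳ m νβ ⟨
    (νβ ⋆ δ₀) m                   ≡⟨ ⋆-congʳ m (λ i → trans (sym (β-exp i)) (⋆-congʳ i (λ j → sym (expNeg-tail j)))) ⟩
    (νβ ⋆ (β ⋆ (νE ⋆ exp 1ℚ))) m   ≡⟨ ⋆-congʳ m (λ i → trans (⋆-congʳ i (λ j → ⋆-comm j νE (exp 1ℚ))) (sym (⋆-assoc i β (exp 1ℚ) νE))) ⟩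
    (νβ ⋆ ((β ⋆ exp 1ℚ) ⋆ νE)) m   ≡⟨ ⋆-congʳ m (λ i → ⋆-comm i (β ⋆ exp 1ℚ) νE) ⟩
    (νβ ⋆ (νE ⋆ (β ⋆ exp 1ℚ))) m   ≡⟨ ⋆-assoc m νβ νE _ ⟨
    ((νβ ⋆ νE) ⋆ (β ⋆ exp 1ℚ)) m   ≡⟨ ⋆-congˡ m (λ i → trans (sym (⋆-geometric i -1ℚ β (tail (exp 1ℚ)))) (trans (cong (-1ℚ ↑ i *_) (β-exp i)) (sgn i))) ⟩
    (δ₀ ⋆ (β ⋆ exp 1ℚ)) m          ≡⟨ ⋆-identityˡ m _ ⟩
    (β ⋆ exp 1ℚ) m                 ∎
    where
    νβ νE : ℕ → ℚ
    νβ i = -1ℚ ↑ i * β i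
    νE i = -1ℚ ↑ i * tail (exp 1ℚ) i
    sgn : ∀ i → -1ℚ ↑ i * δ₀ i ≡ δ₀ i
    sgn zero = refl
    sgn (suc i) = ℚP.*-zeroʳ (-1ℚ ↑ suc i)

  -1-odd : ∀ k → -1ℚ ↑ suc (k ℕ.* 2) ≡ -1ℚ
  -1-odd zero = refl
  -1-odd (suc k) = cong (λ t → -1ℚ * (-1ℚ * t)) (-1-odd k)

  -- `β-reflect` and `β⋆exp` give (-1)ⁿ B n = B n for n ≥ 2, hence 2 B n = 0 when n is odd.
  B-odd : ∀ k → B (suc (suc k ℕ.* 2)) ≡ 0ℚ
  B-odd k = ι-cancel 2 (begin
    ι 2 * B n
      ≡⟨ solve 1 (λ b → con (ι 2) :* b := b :- con -1ℚ :* b) refl (B n) ⟩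
    B n - -1ℚ * B n
      ≡⟨ cong (λ t → B n - t * B n) (-1-odd (suc k)) ⟨
    B n - -1ℚ ↑ n * B n
      ≡⟨ cong (_- -1ℚ ↑ n * B n) unscale ⟨
    -1ℚ ↑ n * B n - -1ℚ ↑ n * B n
      ≡⟨ ℚP.+-inverseʳ (-1ℚ ↑ n * B n) ⟩
    0ℚ
      ≡⟨⟩
    ι 2 * 0ℚ ∎)
    where
    n = suc (suc k ℕ.* 2)
    unscale : -1ℚ ↑ n * B n ≡ B n
    unscale = begin
      -1ℚ ↑ n * B n                          ≡⟨ ℚP.*-identityʳ _ ⟨
      -1ℚ ↑ n * B n * 1ℚ                     ≡⟨ cong (-1ℚ ↑ n * B n *_) (fact-invFact n) ⟨
      -1ℚ ↑ n * B n * (ι (n !) * invFact n)  ≡⟨ solve 4 (λ s b f i → s :* b :* (f :* i) := (s :* (b :* i)) :* f) refl (-1ℚ ↑ n) (B n) (ι (n !)) (invFact n) ⟩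
      -1ℚ ↑ n * β n * ι (n !)                ≡⟨ cong (_* ι (n !)) (trans (β-reflect n) (β⋆exp (suc (k ℕ.* 2)))) ⟩
      β n * ι (n !)                          ≡⟨ solve 3 (λ b f i → (b :* i) :* f := b :* (f :* i)) refl (B n) (ι (n !)) (invFact n) ⟩
      B n * (ι (n !) * invFact n)            ≡⟨ cong (B n *_) (fact-invFact n) ⟩
      B n * 1ℚ                               ≡⟨ ℚP.*-identityʳ _ ⟩
      B n                                    ∎

  Even Odd : ℕ → Set
  Even n = ∃ λ h → n ≡ h ℕ.* 2
  Odd n = ∃ λ h → n ≡ suc (h ℕ.* 2)

  even⊎odd : ∀ n → Even n ⊎ Odd n
  even⊎odd zero = inj₁ (0 , refl)
  even⊎odd (suc n) with even⊎odd n
  ... | inj₁ (h , refl) = inj₂ (h , refl)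
  ... | inj₂ (h , refl) = inj₁ (suc h , refl)

  suc-even : ∀ {n} → Even n → Odd (suc n)
  suc-even (h , refl) = h , refl

  suc-odd : ∀ {n} → Odd n → Even (suc n)
  suc-odd (h , refl) = suc h , refl

  even-+ : ∀ {m n} → Even m → Even n → Even (m ℕ.+ n)
  even-+ (h , refl) (k , refl) = h ℕ.+ k , sym (ℕP.*-distribʳ-+ 2 h k)

  odd-+ : ∀ {m n} → Odd m → Even n → Odd (m ℕ.+ n)
  odd-+ (h , refl) e = suc-even (even-+ (h , refl) e)

  even-∸ : ∀ {m n} → Even m → Even n → Even (m ∸ n)
  even-∸ (h , refl) (k , refl) = h ∸ k , sym (ℕP.*-distribʳ-∸ 2 h k)

  even-odd-⊥ : ∀ {m} → Even m → Odd m → ⊥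
  even-odd-⊥ (h , refl) (k , eq) = go h k eq
    where
    go : ∀ h k → h ℕ.* 2 ≡ suc (k ℕ.* 2) → ⊥
    go (suc h) (suc k) eq = go h k (ℕP.suc-injective (ℕP.suc-injective eq))

  even∸odd : ∀ {m n} → Even m → Odd n → n ≤ m → Odd (m ∸ n)
  even∸odd {m} {n} em on n≤m with even⊎odd (m ∸ n)
  ... | inj₂ o = o
  ... | inj₁ e = ⊥-elim (even-odd-⊥ em (subst Odd (ℕP.m+[n∸m]≡n n≤m) (odd-+ on e)))

  B-odd′ : ∀ {n} → Odd n → 3 ≤ n → B n ≡ 0ℚ
  B-odd′ (zero , refl) (s≤s ())
  B-odd′ (suc k , refl) _ = B-odd k

  C-2 : ∀ {n} → 2 ≤ n → ι (n C 2) ≡ (+ 1 / 2) * (ι n * (ι n - 1ℚ))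
  C-2 {suc zero} (s≤s ())
  C-2 {suc (suc m)} h = trans (ι-C h) (trans
    (cong (_* ((+ 1 / 2) * invFact m)) (trans (ι-* N (suc m !)) (cong (ι N *_) (ι-* (suc m) (m !)))))
    (trans (solve 4 (λ a b f i → a :* (b :* f) :* (con (+ 1 / 2) :* i) := con (+ 1 / 2) :* (a :* (b :* (f :* i)))) refl (ι N) (ι (suc m)) (ι (m !)) (invFact m))
      (cong (λ t → (+ 1 / 2) * (ι N * t)) (trans (cong (ι (suc m) *_) (fact-invFact m)) (trans (ℚP.*-identityʳ _)
        (trans (solve 1 (λ a → a := (con 1ℚ :+ a) :- con 1ℚ) refl (ι (suc m))) (cong (_- 1ℚ) (sym (ι-suc (suc m)))))))))) 
    where N = suc (suc m)

  C-0 : ∀ n → ι (n C 0) ≡ 1ℚ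
  C-0 n = trans (ι-C {n} z≤n) (trans (cong (ι (n !) *_) (ℚP.*-identityˡ _)) (fact-invFact n))

  -- Faulhaber's formula at n = p, by p-adic order

  module Integrality (p : ℕ) (pp : Prime p) (11≤p : 11 ≤ p) where
    open Order p pp 11≤p public

    private instance
      nzp : NonZero p
      nzp = prime⇒nonZero pp

    P : ℚ
    P = ι p

    V-recip< : ∀ n → n < p → V 0 (recipℕ n)
    V-recip< zero _ = V-0
    V-recip< (suc n) h = V-recip (suc n) (>⇒∤ h)

    -- A positive number below p^(e+1) contains at most e factors p; they are stripped one by one.
    -- At n = 0 the convention 1/0 = 0 applies.
    V-recip-^ : ∀ e n → n < p ^ suc e → V 0 (P ↑ e * recipℕ n)
    V-recip-^ e zero h = V-resp (sym (ℚP.*-zeroʳ (P ↑ e))) V-0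
    V-recip-^ zero n@(suc _) h = V-resp (sym (ℚP.*-identityˡ _)) (V-recip< n (subst (n <_) (ℕP.*-identityʳ p) h))
    V-recip-^ (suc e) n@(suc _) h with p ∣? n
    ... | no ¬d = V-*ʳ (V-≤ z≤n (V-↑ (suc e) V-p)) (V-recip n ¬d)
    ... | yes (divides zero ())
    ... | yes (divides q@(suc _) eq) = V-resp
        (trans (solve 2 (λ a b → a :* b := con 1ℚ :* a :* b) refl (P ↑ e) (recipℕ q))
          (trans (cong (λ t → t * P ↑ e * recipℕ q) (sym (ι-recip p)))
            (trans (solve 4 (λ a b c d → a :* b :* c :* d := a :* c :* (d :* b)) refl P (recipℕ p) (P ↑ e) (recipℕ q))
              (cong (P * P ↑ e *_) (trans (sym (recip-* q p)) (cong recipℕ (sym eq)))))))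
        (V-recip-^ e q (ℕP.*-cancelˡ-< p q (p ^ suc e) (subst (_< p ℕ.* p ^ suc e) (trans eq (ℕP.*-comm q p)) h)))

    weight : ℕ → ℚ
    weight j = P ↑ j * recipℕ (suc j)

    -- pʳ splits off, and pᵈ clears the denominator r + d + 1, which is below p^(d+1): for d = 0
    -- because r + 1 ≤ 6 < p, and afterwards because the power at least doubles.
    V-weight : ∀ r d → r ≤ 5 → V r (weight (r ℕ.+ d))
    V-weight r d r≤5 = V-resp (trans (sym (ℚP.*-assoc (P ↑ r) (P ↑ d) _)) (cong (_* recipℕ (suc (r ℕ.+ d))) (sym (↑-+ P r d))))
      (subst (λ t → V t (P ↑ r * (P ↑ d * recipℕ (suc (r ℕ.+ d))))) (ℕP.+-identityʳ r)
        (V-* (subst (λ t → V t (P ↑ r)) (ℕP.*-identityʳ r) (V-↑ r V-p)) (V-recip-^ d (suc (r ℕ.+ d)) (small d))))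
      where
      small : ∀ d → suc (r ℕ.+ d) < p ^ suc d
      small zero = subst₂ _<_ (cong suc (sym (ℕP.+-identityʳ r))) (sym (ℕP.*-identityʳ p))
        (ℕP.≤-<-trans (s≤s r≤5) (≤p 7))
      small (suc d) = ℕP.<-≤-trans (subst (_< p ^ suc d ℕ.+ p ^ suc d) (trans (ℕP.+-comm _ 1) (cong suc (sym (ℕP.+-suc r d)))) 
          (ℕP.+-mono-<-≤ (small d) (ℕP.≤-trans (s≤s z≤n) (small d))))
        (subst (_≤ p ^ suc (suc d)) (cong (p ^ suc d ℕ.+_) (ℕP.+-identityʳ _)) (ℕP.*-monoˡ-≤ (p ^ suc d) {2} {p} (≤p 2)))

    -- One factor p is attached to the Bernoulli number: p B is always integral, whereas B may have
    -- p in its denominator.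
    term : ℕ → ℕ → ℚ
    term k j = ι (k C j) * weight j * (P * B (k ∸ j))

    faulhaber-p : ∀ k → powerSum p k ≡ ∑ (suc k) (term k)
    faulhaber-p k = trans (faulhaber p k) (∑-cong (suc k) (λ j _ →
      solve 5 (λ c x y r b → c :* ((x :* y) :* r) :* b := c :* (y :* r) :* (x :* b)) refl (ι (k C j)) P (P ↑ j) (recipℕ (suc j)) (B (k ∸ j))))

    term-0 : ∀ k → term k 0 ≡ P * B k
    term-0 k = trans (cong (λ t → t * (1ℚ * 1ℚ) * (P * B k)) (C-0 k)) (ℚP.*-identityˡ _)

    V-powerSum : ∀ n k → V 0 (powerSum n k)
    V-powerSum n k = V-∑ n (λ a _ → subst (λ t → V t (ι a ↑ k)) (ℕP.*-zeroʳ k) (V-↑ k (V-ι a)))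

    -- The weak form of von Staudt-Clausen: Faulhaber's formula expresses p B k as an integer minus
    -- terms with integral weights times p B j, j < k.
    V-pB : ∀ k → V 0 (P * B k)
    V-pB = <-rec (λ k → V 0 (P * B k)) step
      where
      step : ∀ k → (∀ {j} → j < k → V 0 (P * B j)) → V 0 (P * B k)
      step k rec = V-resp (trans (cong₂ _-_ (faulhaber-p k) refl)
          (trans (solve 2 (λ a b → (a :+ b) :- b := a) refl (term k 0) (∑ k (λ j → term k (suc j)))) (term-0 k)))
        (V-- (V-powerSum p k) (V-∑ k (λ j j<k → V-*ˡ (V-*ˡ (V-ι (k C suc j)) (V-≤ z≤n (V-weight 1 j (s≤s z≤n))))
          (rec (ℕP.∸-monoʳ-< {k} (s≤s z≤n) j<k)))))

    V-term : ∀ r k d → r ≤ 5 → V r (term k (r ℕ.+ d))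
    V-term r k d r≤5 = V-*ʳ (V-*ˡ (V-ι (k C (r ℕ.+ d))) (V-weight r d r≤5)) (V-pB (k ∸ (r ℕ.+ d)))

    powerSum-≈ : ∀ r k → r ≤ 5 → r ≤ suc k → powerSum p k ≈[ r ] ∑ r (term k)
    powerSum-≈ r k r≤5 r≤k = mk≈ (V-resp
      (trans (solve 2 (λ a b → b := (a :+ b) :- a) refl (∑ r (term k)) (∑ (suc k ∸ r) (λ i → term k (r ℕ.+ i))))
        (cong (_- ∑ r (term k)) (trans (sym (∑-split r (suc k ∸ r) (term k))) (trans (cong (λ t → ∑ t (term k)) (ℕP.m+[n∸m]≡n r≤k)) (sym (faulhaber-p k))))))
      (V-∑ (suc k ∸ r) (λ d _ → V-term r k d r≤5)))

    powerSum-≈1 : ∀ k → powerSum p k ≈[ 1 ] P * B k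
    powerSum-≈1 k = ≈-trans (powerSum-≈ 1 k (s≤s z≤n) (s≤s z≤n)) (≈-reflexive (trans (ℚP.+-identityʳ _) (term-0 k)))

    V-B : ∀ k → suc k < p → V 0 (B k)
    V-B = <-rec (λ k → suc k < p → V 0 (B k)) step
      where
      step : ∀ k → (∀ {j} → j < k → suc j < p → V 0 (B j)) → suc k < p → V 0 (B k)
      step zero rec h = V-ι 1
      step (suc n) rec h = V-resp (sym (B-suc n)) (V-neg (V-*ˡ (V-recip< (suc (suc n)) h)
        (V-∑ (suc n) (λ i i<n → V-*ˡ (V-ι (suc (suc n) C i)) (rec i<n (ℕP.<-trans (s≤s i<n) h))))))

    V1-powerSum : ∀ k → suc k < p → V 1 (powerSum p k)
    V1-powerSum k h = ≈⇒V (powerSum-≈1 k) (V-* V-p (V-B k h))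

    zero-term : ∀ k j → B (k ∸ j) ≡ 0ℚ → term k j ≡ 0ℚ
    zero-term k j eq = trans (cong (λ t → ι (k C j) * weight j * (P * t)) eq)
      (solve 2 (λ a b → a :* (b :* con 0ℚ) := con 0ℚ) refl (ι (k C j) * weight j) P)

    odd-pred : ∀ {k} → Even k → 1 ≤ k → Odd (k ∸ 1)
    odd-pred e h = even∸odd e (0 , refl) h

    term-1 : ∀ k → Even k → 4 ≤ k → term k 1 ≡ 0ℚ
    term-1 k e 4≤k = zero-term k 1 (B-odd′ (even∸odd e (0 , refl) (ℕP.≤-trans (ℕP.m≤m+n 1 3) 4≤k)) (ℕP.∸-monoˡ-≤ 1 4≤k))

    term-3 : ∀ k → Even k → 6 ≤ k → term k 3 ≡ 0ℚ
    term-3 k e 6≤k = zero-term k 3 (B-odd′ (even∸odd e (1 , refl) (ℕP.≤-trans (ℕP.m≤m+n 3 3) 6≤k)) (ℕP.∸-monoˡ-≤ 3 6≤k))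

    term-2 : ∀ k → 2 ≤ k → term k 2 ≡ (+ 1 / 6) * (ι k * (ι k - 1ℚ)) * P * P * (P * B (k ∸ 2))
    term-2 k 2≤k = trans (cong (λ t → t * weight 2 * (P * B (k ∸ 2))) (C-2 2≤k))
      (solve 3 (λ a x b → con (+ 1 / 2) :* a :* (x :* (x :* con 1ℚ) :* con (+ 1 / 3)) :* b := con (+ 1 / 6) :* a :* x :* x :* b) refl
        (ι k * (ι k - 1ℚ)) P (P * B (k ∸ 2)))

    powerSum-≈2 : ∀ k → Even k → 4 ≤ k → powerSum p k ≈[ 2 ] P * B k
    powerSum-≈2 k e 4≤k = ≈-trans (powerSum-≈ 2 k (s≤s (s≤s z≤n)) (ℕP.≤-trans (ℕP.≤-trans (ℕP.m≤m+n 2 2) 4≤k) (ℕP.n≤1+n k)))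
      (≈-reflexive (trans (cong₂ (λ s t → s + (t + 0ℚ)) (term-0 k) (term-1 k e 4≤k)) (ℚP.+-identityʳ _)))

    -- The quadratic term already carries p²; divisibility of p B (k-2) by p supplies the third
    -- order.
    powerSum-≈3 : ∀ k → Even k → 4 ≤ k → V 1 (P * B (k ∸ 2)) → powerSum p k ≈[ 3 ] P * B k
    powerSum-≈3 k e 4≤k v = ≈-trans (powerSum-≈ 3 k (s≤s (s≤s (s≤s z≤n))) (ℕP.≤-trans (ℕP.≤-trans (ℕP.m≤m+n 3 1) 4≤k) (ℕP.n≤1+n k)))
      (mk≈ (V-resp (sym (trans (cong₂ (λ s t → s + (t + (term k 2 + 0ℚ)) - P * B k) (term-0 k) (term-1 k e 4≤k))
          (solve 2 (λ a b → a :+ (con 0ℚ :+ (b :+ con 0ℚ)) :- a := b) refl (P * B k) (term k 2))))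
        (V-* (V-*ˡ (V-ι (k C 2)) (V-weight 2 0 (s≤s (s≤s z≤n)))) v)))

    -- Meant for k = p+1 and k = 2p, where k - 2 is a multiple of p - 1: there p B (k-2) is a unit
    -- and the quadratic term must be kept.
    powerSum-≈5 : ∀ k → Even k → 6 ≤ k → powerSum p k ≈[ 5 ] P * B k + (+ 1 / 6) * (ι k * (ι k - 1ℚ)) * P * P * (P * B (k ∸ 2)) + term k 4
    powerSum-≈5 k e 6≤k = ≈-trans (powerSum-≈ 5 k ℕP.≤-refl (ℕP.≤-trans (ℕP.≤-trans (ℕP.m≤m+n 5 1) 6≤k) (ℕP.n≤1+n k)))
      (≈-reflexive (trans (cong₂ (λ s t → s + (term k 1 + (t + (term k 3 + (term k 4 + 0ℚ))))) (term-0 k) (term-2 k (ℕP.≤-trans (ℕP.m≤m+n 2 4) 6≤k)))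
        (trans (cong₂ (λ s t → P * B k + (s + (X + (t + (term k 4 + 0ℚ))))) (term-1 k e (ℕP.≤-trans (ℕP.m≤m+n 4 2) 6≤k)) (term-3 k e 6≤k))
          (solve 3 (λ a b c → a :+ (con 0ℚ :+ (b :+ (con 0ℚ :+ (c :+ con 0ℚ)))) := a :+ b :+ c) refl (P * B k) X (term k 4)))))
      where X = (+ 1 / 6) * (ι k * (ι k - 1ℚ)) * P * P * (P * B (k ∸ 2))

  -- Teichmüller representatives

  geometric : ∀ n x y → (x - y) * ∑ n (λ i → x ↑ i * y ↑ (n ∸ suc i)) ≡ x ↑ n - y ↑ n
  geometric zero x y = ℚP.*-zeroʳ (x - y)
  geometric (suc n) x y = begin
    (x - y) * ∑ (suc n) (λ i → x ↑ i * y ↑ (n ∸ i))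
      ≡⟨ cong ((x - y) *_) (trans (∑-last n (λ i → x ↑ i * y ↑ (n ∸ i))) (cong₂ _+_
           (trans (∑-cong n (λ i i<n → trans (cong (λ t → x ↑ i * y ↑ t) (ℕP.+-∸-assoc 1 i<n))
             (solve 3 (λ a b c → a :* (b :* c) := b :* (a :* c)) refl (x ↑ i) y (y ↑ (n ∸ suc i))))) (∑-*ˡ n y _))
           (trans (cong (λ t → x ↑ n * y ↑ t) (ℕP.n∸n≡0 n)) (ℚP.*-identityʳ _)))) ⟩
    (x - y) * (y * G + x ↑ n)
      ≡⟨ solve 4 (λ x y g z → (x :- y) :* (y :* g :+ z) := y :* ((x :- y) :* g) :+ (x :- y) :* z) refl x y G (x ↑ n) ⟩
    y * ((x - y) * G) + (x - y) * x ↑ n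
      ≡⟨ cong (λ t → y * t + (x - y) * x ↑ n) (geometric n x y) ⟩
    y * (x ↑ n - y ↑ n) + (x - y) * x ↑ n
      ≡⟨ solve 4 (λ x y a b → y :* (a :- b) :+ (x :- y) :* a := x :* a :- y :* b) refl x y (x ↑ n) (y ↑ n) ⟩
    x * x ↑ n - y * y ↑ n ∎
    where
    open ≡-Reasoning
    G = ∑ n (λ i → x ↑ i * y ↑ (n ∸ suc i))

  ↑-swap : ∀ x m n → (x ↑ m) ↑ n ≡ (x ↑ n) ↑ m
  ↑-swap x m n = trans (sym (↑-* x n m)) (trans (cong (x ↑_) (ℕP.*-comm n m)) (↑-* x m n))

  module Teichmüller (p : ℕ) (pp : Prime p) (11≤p : 11 ≤ p) where
    open Integrality p pp 11≤p public

    M : ℕ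
    M = p ∸ 1

    p≡1+M : p ≡ suc M
    p≡1+M = sym (ℕP.m+[n∸m]≡n {1} {p} (≤p 1))

    ιM : ι M ≡ P - 1ℚ
    ιM = ι-∸ {p} {1} (≤p 1)

    p-odd : Odd p
    p-odd with even⊎odd p
    ... | inj₂ o = o
    ... | inj₁ (h , eq) with prime⇒irreducible pp (divides h eq)
    ...   | inj₁ ()
    ...   | inj₂ 2≡p = ⊥-elim (ℕP.<-irrefl 2≡p (≤p 3))

    M-even : Even M
    M-even = even-pred p-odd
      where
      even-pred : ∀ {n} → Odd n → Even (n ∸ 1)
      even-pred (h , refl) = h , refl

    p∣p! : p ∣ p !
    p∣p! = subst (λ t → p ∣ t !) (sym p≡1+M) (subst (_∣ suc M ℕ.* M !) (sym p≡1+M) (m∣m*n (M !)))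

    V-C : ∀ k → 0 < k → k < p → V 1 (ι (p C k))
    V-C k 0<k k<p with euclidsLemma (p C k) (k ! ℕ.* (p ∸ k) !) pp (subst (p ∣_) (sym (C-*! (ℕP.<⇒≤ k<p))) p∣p!)
    ... | inj₁ d = V-∣ d
    ... | inj₂ d = ⊥-elim (p∤product (p∤! k k<p) (p∤! (p ∸ k) (ℕP.∸-monoʳ-< {p} {k} {0} 0<k (ℕP.<⇒≤ k<p))) d)

    fermat : ∀ a → ι a ↑ p ≈[ 1 ] ι a
    fermat zero = ≈-reflexive (trans (cong (0ℚ ↑_) p≡1+M) (ℚP.*-zeroˡ (0ℚ ↑ M)))
    fermat (suc a) = subst (λ x → x ↑ p ≈[ 1 ] x) (sym (trans (ι-suc a) (ℚP.+-comm 1ℚ (ι a))))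
      (≈-trans (≈-reflexive (binomial p (ι a) 1ℚ))
        (≈-trans (subst (λ t → ∑ (suc t) f ≈[ 1 ] f t + 1ℚ) (sym p≡1+M)
            (≈-trans (≈-reflexive (∑-last (suc M) f)) (≈-trans (≈-+ head≈ (≈-refl {x = f (suc M)})) (≈-reflexive (ℚP.+-comm 1ℚ (f (suc M)))))))
          (≈-+ (≈-trans (≈-reflexive last≡) (fermat a)) (≈-refl {x = 1ℚ}))))
      where
      f : ℕ → ℚ
      f k = ι (p C k) * (ι a ↑ k * 1ℚ ↑ (p ∸ k))
      head≈ : f 0 + ∑ M (λ k → f (suc k)) ≈[ 1 ] 1ℚ
      head≈ = ≈-trans (≈-+ (≈-reflexive (trans (cong₂ (λ s t → s * (1ℚ * t)) (C-0 p) (1-↑ p)) refl))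
          (V⇒≈0 (V-∑ M (λ k k<M → V-*ʳ (V-C (suc k) (s≤s z≤n) (subst (suc k <_) (sym p≡1+M) (s≤s k<M)))
            (V-resp (trans (sym (ℚP.*-identityʳ _)) (cong (ι a ↑ suc k *_) (sym (1-↑ (p ∸ suc k)))))
              (V-≤ z≤n (V-↑ (suc k) (V-ι a))))))))
        (≈-reflexive (ℚP.+-identityʳ 1ℚ))
      last≡ : f p ≡ ι a ↑ p
      last≡ = trans (cong₂ (λ s t → ι s * (ι a ↑ p * t)) (nCn≡1 p) (1-↑ (p ∸ p)))
        (solve 1 (λ x → con 1ℚ :* (x :* con 1ℚ) := x) refl (ι a ↑ p))

    fermat-unit : ∀ a → 0 < a → a < p → ι a ↑ M ≈[ 1 ] 1ℚ
    fermat-unit a@(suc _) 0<a a<p = mk≈ (V-cancel {n = a} (>⇒∤ a<p) (V-resp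
      (trans (cong (_- ι a) (cong (ι a ↑_) p≡1+M)) (solve 2 (λ a b → a :* b :- a := a :* (b :- con 1ℚ)) refl (ι a) (ι a ↑ M)))
      (diff (fermat a))))

    V0-↑ : ∀ {x} n → V 0 x → V 0 (x ↑ n)
    V0-↑ {x} n v = subst (λ t → V t (x ↑ n)) (ℕP.*-zeroʳ n) (V-↑ n v)

    -- The cofactor of x - y in xᵖ - yᵖ is congruent to p yᵖ⁻¹ modulo p, which gains one order.
    ↑p-lift : ∀ {r x y} → V 0 x → V 0 y → x ≈[ suc r ] y → x ↑ p ≈[ suc (suc r) ] y ↑ p
    ↑p-lift {r} {x} {y} vx vy e = mk≈ (subst (λ t → V t (x ↑ p - y ↑ p)) (ℕP.+-comm (suc r) 1) (V-resp (geometric p x y) (V-* (diff e) v)))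
      where
      v : V 1 (∑ p (λ i → x ↑ i * y ↑ (p ∸ suc i)))
      v = ≈⇒V {y = P * y ↑ M} (≈-trans (≈-∑ p (λ i i<p → ≈-trans (≈-*ʳ (V0-↑ (p ∸ suc i) vy) (≈-↑ i vx vy (≈-≤ (s≤s z≤n) e)))
              (≈-reflexive (trans (sym (↑-+ y i (p ∸ suc i))) (cong (y ↑_)
                (cong ℕ.pred (ℕP.m+[n∸m]≡n i<p)))))))
            (≈-reflexive (∑-const p (y ↑ M))))
          (V-*ʳ V-p (V0-↑ M vy))

    frob : ℕ → ℚ → ℚ
    frob zero x = x
    frob (suc r) x = frob r x ↑ p

    V-frob : ∀ r {x} → V 0 x → V 0 (frob r x)
    V-frob zero v = v
    V-frob (suc r) v = V0-↑ p (V-frob r v)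

    frob-≈ : ∀ r {x y} → V 0 x → V 0 y → x ≈[ 1 ] y → frob r x ≈[ suc r ] frob r y
    frob-≈ zero vx vy e = e
    frob-≈ (suc r) vx vy e = ↑p-lift (V-frob r vx) (V-frob r vy) (frob-≈ r vx vy e)

    frob-* : ∀ r x y → frob r (x * y) ≡ frob r x * frob r y
    frob-* zero x y = refl
    frob-* (suc r) x y = trans (cong (_↑ p) (frob-* r x y)) (*-↑ (frob r x) (frob r y) p)

    frob-1 : ∀ r → frob r 1ℚ ≡ 1ℚ
    frob-1 zero = refl
    frob-1 (suc r) = trans (cong (_↑ p) (frob-1 r)) (1-↑ p)

    frob--1 : ∀ r → frob r -1ℚ ≡ -1ℚ
    frob--1 zero = refl
    frob--1 (suc r) = trans (cong (_↑ p) (frob--1 r)) (subst (λ t → -1ℚ ↑ t ≡ -1ℚ) (sym (proj₂ p-odd)) (-1-odd (proj₁ p-odd)))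

    frob-↑ : ∀ r x n → frob r (x ↑ n) ≡ frob r x ↑ n
    frob-↑ zero x n = refl
    frob-↑ (suc r) x n = trans (cong (_↑ p) (frob-↑ r x n)) (↑-swap (frob r x) n p)

    frob-fermat : ∀ r a → frob r (ι a) ≈[ 1 ] ι a
    frob-fermat zero a = ≈-refl
    frob-fermat (suc r) a = ≈-trans (≈-↑ p (V-frob r (V-ι a)) (V-ι a) (frob-fermat r a)) (fermat a)

    -- w a = a^(p⁴) is the Teichmüller representative of a modulo p⁵, and a = w a (1 + y a).
    w winv y : ℕ → ℚ
    w a = frob 4 (ι a)
    winv a = frob 4 (recipℕ a)
    y a = ι a * winv a - 1ℚ

    V-w : ∀ a → V 0 (w a)
    V-w a = V-frob 4 (V-ι a)

    V-winv : ∀ a → a < p → V 0 (winv a)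
    V-winv a a<p = V-frob 4 (V-recip< a a<p)

    -- An exact equality, although `w a` is a root of unity only modulo p⁵: the same power is taken
    -- of a and of 1/a.
    w-inverse : ∀ a → 0 < a → w a * winv a ≡ 1ℚ
    w-inverse a@(suc _) _ = trans (sym (frob-* 4 (ι a) (recipℕ a))) (trans (cong (frob 4) (ι-recip a)) (frob-1 4))

    w-≈ : ∀ a → w a ≈[ 1 ] ι a
    w-≈ = frob-fermat 4

    -- Four p-th powers lift Fermat's congruence from p to p⁵.
    w-order : ∀ a → 0 < a → a < p → w a ↑ M ≈[ 5 ] 1ℚ
    w-order a 0<a a<p = ≈-trans (≈-reflexive (sym (frob-↑ 4 (ι a) M)))
      (≈-trans (frob-≈ 4 (V0-↑ M (V-ι a)) (V-ι 1) (fermat-unit a 0<a a<p)) (≈-reflexive (frob-1 4)))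

    decompose : ∀ a → 0 < a → ι a ≡ w a * (1ℚ + y a)
    decompose a 0<a = sym (trans (solve 3 (λ a w v → w :* (con 1ℚ :+ (a :* v :- con 1ℚ)) := (w :* v) :* a) refl (ι a) (w a) (winv a))
      (trans (cong (_* ι a) (w-inverse a 0<a)) (ℚP.*-identityˡ _)))

    V-y : ∀ a → 0 < a → a < p → V 1 (y a)
    V-y a 0<a a<p = V-resp (trans (cong (λ t → (ι a - w a) * winv a + (t - t)) (sym (w-inverse a 0<a)))
        (trans (solve 3 (λ a w v → (a :- w) :* v :+ (w :* v :- w :* v) := a :* v :- w :* v) refl (ι a) (w a) (winv a))
          (cong (λ t → ι a * winv a - t) (w-inverse a 0<a))))
      (V-+ (V-*ʳ (diff (≈-sym (w-≈ a))) (V-winv a a<p)) (V-resp (sym (ℚP.+-inverseʳ 1ℚ)) V-0))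

    -- Negative frequencies are replaced by complementary ones, so that every exponent of `w` is a
    -- natural number.
    winv-w : ∀ a k → 0 < a → a < p → k ≤ M → winv a ↑ k ≈[ 5 ] w a ↑ (M ∸ k)
    winv-w a k 0<a a<p k≤M = ≈-sym (≈-trans (≈-reflexive (sym eq))
        (≈-trans (≈-*ʳ (V0-↑ k (V-winv a a<p)) (w-order a 0<a a<p)) (≈-reflexive (ℚP.*-identityˡ _))))
      where
      eq : w a ↑ M * winv a ↑ k ≡ w a ↑ (M ∸ k)
      eq = trans (cong (λ t → w a ↑ t * winv a ↑ k) (sym (ℕP.m∸n+n≡m k≤M)))
        (trans (cong (_* winv a ↑ k) (↑-+ (w a) (M ∸ k) k))
          (trans (ℚP.*-assoc (w a ↑ (M ∸ k)) _ _) (trans (cong (w a ↑ (M ∸ k) *_)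
            (trans (sym (*-↑ (w a) (winv a) k)) (trans (cong (_↑ k) (w-inverse a 0<a)) (1-↑ k)))) (ℚP.*-identityʳ _))))

    -- The unit `u` is known only through a natural number c ≡ u modulo p. In c x = u x - (u - c) x
    -- the last term gains an order from u - c, so divisibility is built up one order at a time.
    V-unit-cancel : ∀ {u x} c k → ¬ p ∣ c → u ≈[ 1 ] ι c → V 0 x → V k (u * x) → V k x
    V-unit-cancel c zero h e vx v = vx
    V-unit-cancel {u} {x} c (suc k) h e vx v = V-cancel {n = c} h (V-resp
        (solve 3 (λ u c x → u :* x :- (u :- c) :* x := c :* x) refl u (ι c) x)
        (V-- v (V-* (diff e) (V-unit-cancel c k h e vx (V-≤ (ℕP.n≤1+n k) v)))))

    -- Fourier analysis on the representatives

    kernel : ℕ → ℕ → ℚ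
    kernel a b = ∑ M (λ k → w b ↑ k * winv a ↑ k)

    kernel-diag : ∀ a → 0 < a → kernel a a ≡ ι M
    kernel-diag a 0<a = trans (∑-cong M (λ k _ → trans (sym (*-↑ (w a) (winv a) k)) (trans (cong (_↑ k) (w-inverse a 0<a)) (1-↑ k))))
      (trans (∑-const M 1ℚ) (ℚP.*-identityʳ _))

    V-kernel : ∀ a b → a < p → V 0 (kernel a b)
    V-kernel a b a<p = V-∑ M (λ k _ → V-*ˡ (V0-↑ k (V-w b)) (V0-↑ k (V-winv a a<p)))

    -- Orthogonality of characters: with ρ = w b / w a, the kernel times w b - w a is w a (ρᴹ - 1) ≡
    -- 0 modulo p⁵, and w b - w a ≡ b - a is a unit.
    kernel-off : ∀ a b → 0 < a → a < p → 0 < b → b < p → a ≢ b → V 5 (kernel a b)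
    kernel-off a b 0<a a<p 0<b b<p a≢b = go (ℕP.<-cmp a b)
      where
      ρ = w b * winv a
      ρ^M : ρ ↑ M ≈[ 5 ] 1ℚ
      ρ^M = ≈-trans (≈-reflexive (*-↑ (w b) (winv a) M)) (≈-trans
        (≈-* (V0-↑ M (V-w b)) (V-ι 1) (w-order b 0<b b<p) (≈-trans (winv-w a M 0<a a<p ℕP.≤-refl) (≈-reflexive (cong (w a ↑_) (ℕP.n∸n≡0 M)))))
        (≈-reflexive refl))
      K≡ : kernel a b ≡ ∑ M (λ i → ρ ↑ i * 1ℚ ↑ (M ∸ suc i))
      K≡ = ∑-cong M (λ i _ → trans (sym (*-↑ (w b) (winv a) i)) (sym (trans (cong (ρ ↑ i *_) (1-↑ (M ∸ suc i))) (ℚP.*-identityʳ _))))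
      prod : V 5 ((w b - w a) * kernel a b)
      prod = V-resp (trans (cong (w a *_) (trans (sym (geometric M ρ 1ℚ)) (cong ((ρ - 1ℚ) *_) (sym K≡))))
          (trans (solve 4 (λ a v b k → a :* ((b :* v :- con 1ℚ) :* k) := ((a :* v) :* b :- a) :* k) refl (w a) (winv a) (w b) (kernel a b))
            (cong (λ t → (t - w a) * kernel a b) (trans (cong (_* w b) (w-inverse a 0<a)) (ℚP.*-identityˡ (w b))))))
        (V-*ˡ (V-w a) (diff (≈-trans ρ^M (≈-reflexive (sym (1-↑ M))))))
      go : _ → V 5 (kernel a b)
      go (tri< a<b _ _) = V-unit-cancel (b ∸ a) 5 (p∤∸ 0<a a<b b<p)
          (≈-trans (≈-- (w-≈ b) (w-≈ a)) (≈-reflexive (sym (ι-∸ (ℕP.<⇒≤ a<b))))) (V-kernel a b a<p) prod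
        where
        p∤∸ : ∀ {a b} → 0 < a → a < b → b < p → ¬ p ∣ b ∸ a
        p∤∸ {a} {b} 0<a a<b b<p = >⇒∤ {{ℕ.>-nonZero (ℕP.m<n⇒0<n∸m a<b)}} (ℕP.≤-<-trans (ℕP.m∸n≤m b a) b<p)
      go (tri≈ _ a≡b _) = ⊥-elim (a≢b a≡b)
      go (tri> _ _ b<a) = V-unit-cancel {u = w a - w b} (a ∸ b) 5 (p∤∸ b<a a<p)
          (≈-trans (≈-- (w-≈ a) (w-≈ b)) (≈-reflexive (sym (ι-∸ (ℕP.<⇒≤ b<a))))) (V-kernel a b a<p)
          (V-resp (solve 3 (λ a b k → :- ((b :- a) :* k) := (a :- b) :* k) refl (w a) (w b) (kernel a b)) (V-neg prod))
        where
        p∤∸ : ∀ {a b} → b < a → a < p → ¬ p ∣ a ∸ b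
        p∤∸ {a} {b} b<a a<p = >⇒∤ {{ℕ.>-nonZero (ℕP.m<n⇒0<n∸m b<a)}} (ℕP.≤-<-trans (ℕP.m∸n≤m a b) a<p)

    ∑-single : ∀ k n {g} j → j < n → (∀ i → i < n → i ≢ j → V k (g i)) → ∑ n g ≈[ k ] g j
    ∑-single k (suc n) {g} zero _ h = ≈-trans (≈-+ (≈-refl {x = g 0}) (V⇒≈0 (V-∑ n (λ i i<n → h (suc i) (s≤s i<n) (λ ()))))) (≈-reflexive (ℚP.+-identityʳ _))
    ∑-single k (suc n) {g} (suc j) (s≤s j<n) h = ≈-trans (≈-+ (V⇒≈0 (h 0 (s≤s z≤n) (λ ())))
      (∑-single k n {λ i → g (suc i)} j j<n (λ i i<n i≢j → h (suc i) (s≤s i<n) (λ e → i≢j (ℕP.suc-injective e))))) (≈-reflexive (ℚP.+-identityˡ _))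

    ∑* : (ℕ → ℚ) → ℚ
    ∑* f = ∑ M (λ i → f (suc i))

    <M⇒<p : ∀ {i} → i < M → suc i < p
    <M⇒<p {i} i<M = subst (suc i <_) (sym p≡1+M) (s≤s i<M)

    ≈-∑* : ∀ {k f g} → (∀ a → 0 < a → a < p → f a ≈[ k ] g a) → ∑* f ≈[ k ] ∑* g
    ≈-∑* h = ≈-∑ M (λ i i<M → h (suc i) (s≤s z≤n) (<M⇒<p i<M))

    V-∑* : ∀ {k f} → (∀ a → 0 < a → a < p → V k (f a)) → V k (∑* f)
    V-∑* h = V-∑ M (λ i i<M → h (suc i) (s≤s z≤n) (<M⇒<p i<M))

    Integral : (ℕ → ℚ) → Set
    Integral f = ∀ a → 0 < a → a < p → V 0 (f a)

    hat : (ℕ → ℚ) → ℕ → ℚ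
    hat f k = ∑* (λ a → w a ↑ k * f a)

    V-hat : ∀ {r f} k → (∀ a → 0 < a → a < p → V r (f a)) → V r (hat f k)
    V-hat k h = V-∑* (λ a u v → V-*ˡ (V0-↑ k (V-w a)) (h a u v))

    inversion : ∀ f a → Integral f → 0 < a → a < p → ∑ M (λ k → hat f k * winv a ↑ k) ≈[ 5 ] ι M * f a
    inversion f a@(suc j) vf 0<a a<p = ≈-trans (≈-reflexive eq)
        (≈-trans (∑-single 5 M j (ℕ.s≤s⁻¹ (subst (a <_) p≡1+M a<p))
          (λ i i<M i≢j → V-*ˡ (vf (suc i) (s≤s z≤n) (<M⇒<p i<M))
            (kernel-off a (suc i) 0<a a<p (s≤s z≤n) (<M⇒<p i<M) (λ e → i≢j (sym (ℕP.suc-injective e))))))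
          (≈-reflexive (trans (cong (f a *_) (kernel-diag a 0<a)) (ℚP.*-comm (f a) (ι M)))))
      where
      eq : ∑ M (λ k → hat f k * winv a ↑ k) ≡ ∑ M (λ i → f (suc i) * kernel a (suc i))
      eq = trans (∑-cong M (λ k _ → sym (∑-*ʳ M (λ i → w (suc i) ↑ k * f (suc i)) (winv a ↑ k))))
        (trans (∑-swap M M (λ k i → w (suc i) ↑ k * f (suc i) * winv a ↑ k))
          (∑-cong M (λ i _ → trans (∑-cong M (λ k _ → solve 3 (λ a b c → a :* b :* c := b :* (a :* c)) refl (w (suc i) ↑ k) (f (suc i)) (winv a ↑ k)))
            (∑-*ˡ M (f (suc i)) _))))

    -- The convolution theorem, obtained by inverting `f` inside the transform of the product. The
    -- frequency m - k is written m + (M - k) to remain in ℕ.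
    hat-product : ∀ f g m → Integral f → Integral g →
      ι M * hat (λ a → f a * g a) m ≈[ 5 ] ∑ M (λ k → hat f k * hat g (m ℕ.+ (M ∸ k)))
    hat-product f g m vf vg = ≈-trans (≈-reflexive (sym (∑-*ˡ M (ι M) (λ i → w (suc i) ↑ m * (f (suc i) * g (suc i))))))
        (≈-trans (≈-∑* {f = λ a → ι M * (w a ↑ m * (f a * g a))} {g = λ a → ∑ M (λ k → hat f k * (w a ↑ (m ℕ.+ (M ∸ k)) * g a))} step)
          (≈-reflexive (trans (∑-swap M M (λ i k → hat f k * (w (suc i) ↑ (m ℕ.+ (M ∸ k)) * g (suc i)))) (∑-cong M (λ k _ → ∑-*ˡ M (hat f k) _)))))
      where
      step : ∀ a → 0 < a → a < p → ι M * (w a ↑ m * (f a * g a)) ≈[ 5 ] ∑ M (λ k → hat f k * (w a ↑ (m ℕ.+ (M ∸ k)) * g a))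
      step a u v = ≈-trans (≈-reflexive (solve 4 (λ M w f g → M :* (w :* (f :* g)) := (w :* g) :* (M :* f)) refl (ι M) (w a ↑ m) (f a) (g a)))
        (≈-trans (≈-*ˡ (V-*ˡ (V0-↑ m (V-w a)) (vg a u v)) (≈-sym (inversion f a vf u v)))
          (≈-trans (≈-reflexive (sym (∑-*ˡ M (w a ↑ m * g a) _)))
            (≈-∑ M (λ k k<M → ≈-trans (≈-reflexive (solve 4 (λ w g h v → (w :* g) :* (h :* v) := h :* (w :* g) :* v) refl (w a ↑ m) (g a) (hat f k) (winv a ↑ k)))
              (≈-trans (≈-*ˡ (V-*ˡ (V-hat k vf) (V-*ˡ (V0-↑ m (V-w a)) (vg a u v))) (winv-w a k u v (ℕP.<⇒≤ k<M)))
                (≈-reflexive (trans (solve 4 (λ h w g v → h :* (w :* g) :* v := h :* ((w :* v) :* g)) refl (hat f k) (w a ↑ m) (g a) (w a ↑ (M ∸ k)))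
                  (cong (λ t → hat f k * (t * g a)) (sym (↑-+ (w a) m (M ∸ k)))))))))))

    hat-periodic : ∀ f k → Integral f → hat f (k ℕ.+ M) ≈[ 5 ] hat f k
    hat-periodic f k vf = ≈-∑* {g = λ a → w a ↑ k * f a} (λ a u v → ≈-*ʳ (vf a u v) (≈-trans (≈-reflexive (↑-+ (w a) k M))
      (≈-trans (≈-*ˡ (V0-↑ k (V-w a)) (w-order a u v)) (≈-reflexive (ℚP.*-identityʳ (w a ↑ k))))))

    s : ℕ → ℚ
    s = hat (λ _ → 1ℚ)

    V-1 : Integral (λ _ → 1ℚ)
    V-1 _ _ _ = V-ι 1

    s-0 : s 0 ≡ ι M
    s-0 = trans (∑-const M (1ℚ * 1ℚ)) (ℚP.*-identityʳ _)

    powerSum-∑* : ∀ k → 0 < k → powerSum p k ≡ ∑* (λ a → ι a ↑ k)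
    powerSum-∑* (suc k) _ = subst (λ t → ∑ t (λ a → ι a ↑ suc k) ≡ ∑* (λ a → ι a ↑ suc k)) (sym p≡1+M)
      (trans (cong (_+ ∑* (λ a → ι a ↑ suc k)) (ℚP.*-zeroˡ (0ℚ ↑ k))) (ℚP.+-identityˡ _))

    s-V1 : ∀ m → 0 < m → m < M → V 1 (s m)
    s-V1 m 0<m m<M = ≈⇒V (≈-∑* {g = λ a → ι a ↑ m} (λ a u v → ≈-trans (≈-reflexive (ℚP.*-identityʳ _)) (≈-↑ m (V-w a) (V-ι a) (w-≈ a))))
      (V-resp (powerSum-∑* m 0<m) (V1-powerSum m (<M⇒<p m<M)))

    p∤M : ¬ p ∣ M
    p∤M = >⇒∤ {{ℕ.>-nonZero (ℕP.m<n⇒0<n∸m (≤p 2))}} (subst (M <_) (sym p≡1+M) ℕP.≤-refl)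

    s-periodic : ∀ k → s (k ℕ.+ M) ≈[ 5 ] s k
    s-periodic k = hat-periodic (λ _ → 1ℚ) k V-1

    s-M : s M ≈[ 5 ] ι M
    s-M = ≈-trans (s-periodic 0) (≈-reflexive s-0)

    V0-s : ∀ k → V 0 (s k)
    V0-s k = V-hat k V-1

    -- Since s 0 = M, the product formula for s m reads M s m ≈ 2 M s m + ∑ s k s (m - k) over k ≠ 0, m.
    s-double : ∀ r t → t ≤ r ℕ.+ r → t ≤ 5 → r ≤ 5 → (∀ m → 0 < m → m < M → V r (s m)) → ∀ m → 0 < m → m < M → V t (s m)
    s-double r t t≤2r t≤5 r≤5 vs m@(suc u) 0<m m<M = V-cancel {n = M} p∤M (V-resp
        (solve 3 (λ M S F → :- ((M :* S :- F) :+ (F :- (M :* S :+ S :* M))) := M :* S) refl (ι M) (s m) (∑ M f))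
        (V-neg (V-+ (V-≤ t≤5 (diff (hat-product (λ _ → 1ℚ) (λ _ → 1ℚ) m V-1 V-1))) (diff rest))))
      where
      f : ℕ → ℚ
      f k = s k * s (m ℕ.+ (M ∸ k))
      v = M ∸ suc m
      M≡ : suc (u ℕ.+ suc v) ≡ M
      M≡ = trans (ℕP.+-suc m v) (ℕP.m+[n∸m]≡n m<M)
      f0 : f 0 ≈[ t ] ι M * s m
      f0 = ≈-≤ t≤5 (≈-trans (≈-reflexive (cong (_* s (m ℕ.+ M)) s-0)) (≈-*ˡ (V-ι M) (s-periodic m)))
      fm : f (suc (u ℕ.+ 0)) ≈[ t ] s m * ι M
      fm = ≈-≤ t≤5 (≈-trans (≈-reflexive (trans (cong (λ j → f (suc j)) (ℕP.+-identityʳ u)) (cong (λ j → s m * s j) (ℕP.m+[n∸m]≡n (ℕP.<⇒≤ m<M)))))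
        (≈-*ˡ (V0-s m) s-M))
      V-prod : ∀ {x y} → V r x → V r y → V t (x * y)
      V-prod vx vy = V-≤ t≤2r (V-* vx vy)
      low : ∀ i → i < u → V t (f (suc i))
      low i i<u = V-prod (vs (suc i) (s≤s z≤n) (ℕP.<-trans (s≤s i<u) m<M))
        (≈⇒V (≈-≤ r≤5 (≈-trans (≈-reflexive (cong s index)) (s-periodic (m ∸ suc i))))
          (vs (m ∸ suc i) (ℕP.m<n⇒0<n∸m (s≤s i<u)) (ℕP.≤-<-trans (ℕP.m∸n≤m m (suc i)) m<M)))
        where
        index : m ℕ.+ (M ∸ suc i) ≡ m ∸ suc i ℕ.+ M
        index = trans (sym (ℕP.+-∸-assoc m (ℕP.<⇒≤ (ℕP.<-trans (s≤s i<u) m<M)))) (ℕP.+-∸-comm M (ℕP.<⇒≤ (s≤s i<u)))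
      high : ∀ i → i < v → V t (f (suc (u ℕ.+ suc i)))
      high i i<v = V-prod (vs k (s≤s z≤n) k<M) (vs (m ℕ.+ (M ∸ k)) (s≤s z≤n)
          (subst (m ℕ.+ (M ∸ k) <_) (ℕP.m+[n∸m]≡n (ℕP.<⇒≤ k<M)) (ℕP.+-monoˡ-< (M ∸ k) (s≤s (subst (u <_) (sym (ℕP.+-suc u i)) (s≤s (ℕP.m≤m+n u i)))))))
        where
        k = suc (u ℕ.+ suc i)
        k<M : k < M
        k<M = subst (k <_) M≡ (s≤s (ℕP.+-monoʳ-< u (s≤s i<v)))
      rest : ∑ M f ≈[ t ] ι M * s m + s m * ι M
      rest = ≈-trans (≈-reflexive (trans (cong (λ n → ∑ n f) (sym M≡)) (cong (_+_ (f 0)) (∑-split u (suc v) (λ i → f (suc i))))))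
        (≈-trans (≈-+ f0 (≈-+ (V⇒≈0 (V-∑ u low)) (≈-+ fm (V⇒≈0 (V-∑ v high)))))
          (≈-reflexive (solve 2 (λ a b → a :+ (con 0ℚ :+ (b :+ con 0ℚ)) := a :+ b) refl (ι M * s m) (s m * ι M))))

    -- The orders run through 1, 2, 4 and then 8, capped at the available 5. This takes the place of
    -- the usual argument with a primitive root.
    s-vanish : ∀ m → 0 < m → m < M → V 5 (s m)
    s-vanish = s-double 4 5 (ℕP.m≤m+n 5 3) ℕP.≤-refl (ℕP.m≤m+n 4 1)
      (s-double 2 4 ℕP.≤-refl (ℕP.m≤m+n 4 1) (ℕP.m≤m+n 2 3) (s-double 1 2 ℕP.≤-refl (ℕP.m≤m+n 2 3) (ℕP.m≤m+n 1 4) s-V1))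

  -- Wilson’s theorem and the moments of y

  Δ : ℕ → (ℕ → ℚ) → ℕ → ℚ
  Δ zero f x = f x
  Δ (suc n) f x = Δ n f (suc x) - Δ n f x

  -- The discrete Leibniz rule Δⁿ⁺¹(x g) = x Δⁿ⁺¹ g + (n+1) Δⁿ g(x+1) for g = xᵐ.
  Δ-↑-suc : ∀ n m x → Δ (suc n) (λ t → ι t ↑ suc m) x ≡
    ι x * Δ (suc n) (λ t → ι t ↑ m) x + ι (suc n) * Δ n (λ t → ι t ↑ m) (suc x)
  Δ-↑-suc zero m x = trans (cong (λ t → t * ι (suc x) ↑ m - ι x * ι x ↑ m) (ι-suc x))
    (solve 3 (λ x a b → (con 1ℚ :+ x) :* a :- x :* b := x :* (a :- b) :+ con 1ℚ :* a) refl (ι x) (ι (suc x) ↑ m) (ι x ↑ m))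
  Δ-↑-suc (suc n) m x = trans (cong₂ _-_ (Δ-↑-suc n m (suc x)) (Δ-↑-suc n m x))
    (trans (cong (λ t → t * (d₂ - d₁) + ι (suc n) * d₂ - (ι x * (d₁ - d₀) + ι (suc n) * d₁)) (ι-suc x))
      (trans (solve 5 (λ x n a b c → (con 1ℚ :+ x) :* (a :- b) :+ n :* a :- (x :* (b :- c) :+ n :* b) :=
          x :* (a :- b :- (b :- c)) :+ (con 1ℚ :+ n) :* (a :- b)) refl (ι x) (ι (suc n)) d₂ d₁ d₀)
        (cong (λ t → ι x * (d₂ - d₁ - (d₁ - d₀)) + t * (d₂ - d₁)) (sym (ι-suc (suc n))))))
    where
    d₀ = Δ n (λ t → ι t ↑ m) x
    d₁ = Δ n (λ t → ι t ↑ m) (suc x)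
    d₂ = Δ n (λ t → ι t ↑ m) (suc (suc x))

  Δ-const : ∀ n x → Δ (suc n) (λ _ → 1ℚ) x ≡ 0ℚ
  Δ-const zero x = refl
  Δ-const (suc n) x = cong₂ _-_ (Δ-const n (suc x)) (Δ-const n x)

  Δ-low : ∀ n m x → m < n → Δ n (λ t → ι t ↑ m) x ≡ 0ℚ
  Δ-low (suc n) zero x _ = Δ-const n x
  Δ-low (suc n) (suc m) x (s≤s m<n) = trans (Δ-↑-suc n m x)
    (trans (cong₂ (λ s t → ι x * s + ι (suc n) * t) (Δ-low (suc n) m x (ℕP.<-trans m<n ℕP.≤-refl)) (Δ-low n m (suc x) m<n))
      (solve 2 (λ a b → a :* con 0ℚ :+ b :* con 0ℚ := con 0ℚ) refl (ι x) (ι (suc n))))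

  Δ-! : ∀ n x → Δ n (λ t → ι t ↑ n) x ≡ ι (n !)
  Δ-! zero x = refl
  Δ-! (suc n) x = trans (Δ-↑-suc n n x)
    (trans (cong₂ (λ s t → ι x * s + ι (suc n) * t) (Δ-low (suc n) n x ℕP.≤-refl) (Δ-! n (suc x)))
      (trans (solve 2 (λ a b → a :* con 0ℚ :+ b := b) refl (ι x) (ι (suc n) * ι (n !))) (sym (ι-* (suc n) (n !)))))

  -- Syntax for `binomial₄`, as `momentsᵖ` is for `momentSum`; both are bracketed like their values
  -- so that the interpretations agree definitionally. Degree 4 suffices since y⁵ has order 5.
  binomialᵖ : ∀ {m} → Polynomial m → Polynomial m → Polynomial m
  binomialᵖ κ x = con 1ℚ :+ κ :* x :+ con (+ 1 / 2) :* (κ :* (κ :- con 1ℚ)) :* (x :* x) :+ con (+ 1 / 6) :* (κ :* (κ :- con 1ℚ) :* (κ :- con (+ 2 / 1))) :* (x :* (x :* x))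
    :+ con (+ 1 / 24) :* (κ :* (κ :- con 1ℚ) :* (κ :- con (+ 2 / 1)) :* (κ :- con (+ 3 / 1))) :* (x :* (x :* (x :* x)))

  momentsᵖ : ∀ {m} → Polynomial m → Polynomial m → Polynomial m → Polynomial m → Polynomial m → Polynomial m → Polynomial m
  momentsᵖ s κ a b d e = s :+ κ :* a :+ con (+ 1 / 2) :* (κ :* (κ :- con 1ℚ)) :* b :+ con (+ 1 / 6) :* (κ :* (κ :- con 1ℚ) :* (κ :- con (+ 2 / 1))) :* d
    :+ con (+ 1 / 24) :* (κ :* (κ :- con 1ℚ) :* (κ :- con (+ 2 / 1)) :* (κ :- con (+ 3 / 1))) :* e

  module Moments (p : ℕ) (pp : Prime p) (11≤p : 11 ≤ p) where
    open Teichmüller p pp 11≤p public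

    private instance
      nzp : NonZero p
      nzp = prime⇒nonZero pp

    M-pred : M ≡ suc (M ∸ 1)
    M-pred = sym (ℕP.m+[n∸m]≡n {1} {M} (ℕP.∸-monoˡ-≤ 1 (≤p 2)))

    10≤M : 10 ≤ M
    10≤M = ℕP.∸-monoˡ-≤ 1 11≤p

    ≤M : ∀ k {_ : Bool.T (k ℕ.≤ᵇ 10)} → k ≤ M
    ≤M k {h} = ℕP.≤-trans (ℕP.≤ᵇ⇒≤ k 10 h) 10≤M

    -- The M-th difference of xᴹ is M!. Modulo p the values of xᴹ at 0, 1, ..., p-1 are 0, 1, ...,
    -- 1, so only the jump at 0 contributes, with the sign (-1)^(M-1) = -1.
    wilson : ι (M !) ≈[ 1 ] -1ℚ
    wilson = ≈-trans (≈-reflexive (sym (Δ-! M 0)))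
        (≈-trans (subst (λ t → Δ t f 0 ≈[ 1 ] -1ℚ ↑ (M ∸ 1)) (sym M-pred) (at0 (M ∸ 1) (subst₂ _<_ M-pred (sym p≡1+M) ℕP.≤-refl)))
          (≈-reflexive (subst (λ t → -1ℚ ↑ t ≡ -1ℚ) (sym (proj₂ odd)) (-1-odd (proj₁ odd)))))
      where
      f : ℕ → ℚ
      f t = ι t ↑ M
      odd : Odd (M ∸ 1)
      odd = even∸odd M-even (0 , refl) (≤M 1)
      flat : ∀ n x → 0 < x → x ℕ.+ suc n < p → Δ (suc n) f x ≈[ 1 ] 0ℚ
      flat zero x 0<x h = ≈-trans (≈-- (fermat-unit (suc x) (s≤s z≤n) (subst (_< p) (ℕP.+-comm x 1) h))
          (fermat-unit x 0<x (ℕP.≤-<-trans (ℕP.m≤m+n x 1) h))) (≈-reflexive (ℚP.+-inverseʳ 1ℚ))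
      flat (suc n) x 0<x h = ≈-trans (≈-- (flat n (suc x) (s≤s z≤n) (subst (_< p) (ℕP.+-suc x (suc n)) h))
          (flat n x 0<x (ℕP.<-trans (ℕP.+-monoʳ-< x ℕP.≤-refl) h))) (≈-reflexive refl)
      at0 : ∀ n → suc n < p → Δ (suc n) f 0 ≈[ 1 ] -1ℚ ↑ n
      at0 zero h = ≈-trans (≈-- (fermat-unit 1 (s≤s z≤n) h) (≈-reflexive (trans (cong (0ℚ ↑_) M-pred) (ℚP.*-zeroˡ (0ℚ ↑ (M ∸ 1))))))
        (≈-reflexive (ℚP.+-identityʳ 1ℚ))
      at0 (suc n) h = ≈-trans (≈-- (flat n 1 (s≤s z≤n) h) (at0 n (ℕP.<-trans ℕP.≤-refl h)))
        (≈-reflexive (solve 1 (λ a → con 0ℚ :- a := con -1ℚ :* a) refl (-1ℚ ↑ n)))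

    y² y³ y⁴ : ℕ → ℚ
    y² a = y a * y a
    y³ a = y a * y² a
    y⁴ a = y a * y³ a

    V-y² : ∀ a → 0 < a → a < p → V 2 (y² a)
    V-y² a u v = V-* (V-y a u v) (V-y a u v)
    V-y³ : ∀ a → 0 < a → a < p → V 3 (y³ a)
    V-y³ a u v = V-* (V-y a u v) (V-y² a u v)
    V-y⁴ : ∀ a → 0 < a → a < p → V 4 (y⁴ a)
    V-y⁴ a u v = V-* (V-y a u v) (V-y³ a u v)

    n n₂ n₃ n₄ : ℕ → ℚ
    n = hat y
    n₂ = hat y²
    n₃ = hat y³
    n₄ = hat y⁴

    V-n : ∀ k → V 1 (n k)
    V-n k = V-hat k V-y
    V-n₂ : ∀ k → V 2 (n₂ k)
    V-n₂ k = V-hat k V-y²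
    V-n₃ : ∀ k → V 3 (n₃ k)
    V-n₃ k = V-hat k V-y³
    V-n₄ : ∀ k → V 4 (n₄ k)
    V-n₄ k = V-hat k V-y⁴

    Int-y : Integral y
    Int-y a u v = V-≤ z≤n (V-y a u v)
    Int-y² : Integral y²
    Int-y² a u v = V-≤ z≤n (V-y² a u v)

    binomial₄ : ℚ → ℚ → ℚ
    binomial₄ κ x = 1ℚ + κ * x + (+ 1 / 2) * (κ * (κ - 1ℚ)) * (x * x) + (+ 1 / 6) * (κ * (κ - 1ℚ) * (κ - (+ 2 / 1))) * (x * (x * x))
      + (+ 1 / 24) * (κ * (κ - 1ℚ) * (κ - (+ 2 / 1)) * (κ - (+ 3 / 1))) * (x * (x * (x * x)))

    -- The binomial coefficients are treated as polynomials in κ = k, a variable of weight 0;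
    -- Pascal's rule then is a polynomial congruence modulo weight 5.
    ↑-expand : ∀ {x} k → V 1 x → (1ℚ + x) ↑ k ≈[ 5 ] binomial₄ (ι k) x
    ↑-expand {x} zero v = ≈-reflexive (solve 1 (λ x → con 1ℚ := con 1ℚ :+ con 0ℚ :* x :+ con 0ℚ :* (x :* x) :+ con 0ℚ :* (x :* (x :* x)) :+ con 0ℚ :* (x :* (x :* (x :* x)))) refl x)
    ↑-expand {x} (suc k) v = ≈-trans (≈-*ˡ (V-+ (V-ι 1) (V-≤ z≤n v)) (↑-expand k v))
      (≈-trans (≈-poly (v ∷ V-ι k ∷ []) 5
        (λ x κ → (con 1ℚ :+ x) :* binomialᵖ κ x)
        (λ x κ → binomialᵖ (con 1ℚ :+ κ) x) refl)
        (≈-reflexive (cong (λ t → binomial₄ t x) (sym (ι-suc k)))))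

    hat-+ : ∀ f g k → hat (λ a → f a + g a) k ≡ hat f k + hat g k
    hat-+ f g k = trans (∑-cong M (λ i _ → ℚP.*-distribˡ-+ (w (suc i) ↑ k) (f (suc i)) (g (suc i)))) (∑-+ M _ _)

    hat-scale : ∀ c f k → hat (λ a → c * f a) k ≡ c * hat f k
    hat-scale c f k = trans (∑-cong M (λ i _ → solve 3 (λ w c f → w :* (c :* f) := c :* (w :* f)) refl (w (suc i) ↑ k) c (f (suc i)))) (∑-*ˡ M c _)

    momentSum : ℚ → ℕ → ℚ
    momentSum κ k = s k + κ * n k + (+ 1 / 2) * (κ * (κ - 1ℚ)) * n₂ k + (+ 1 / 6) * (κ * (κ - 1ℚ) * (κ - (+ 2 / 1))) * n₃ k
        + (+ 1 / 24) * (κ * (κ - 1ℚ) * (κ - (+ 2 / 1)) * (κ - (+ 3 / 1))) * n₄ k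

    powerSum-moments : ∀ k → 0 < k → powerSum p k ≈[ 5 ] momentSum (ι k) k
    powerSum-moments k 0<k = ≈-trans (≈-reflexive (powerSum-∑* k 0<k))
      (≈-trans (≈-∑* {f = λ a → ι a ↑ k} {g = λ a → w a ↑ k * binomial₄ κ (y a)} (λ a u v →
        ≈-trans (≈-reflexive (trans (cong (_↑ k) (decompose a u)) (*-↑ (w a) (1ℚ + y a) k))) (≈-*ˡ (V0-↑ k (V-w a)) (↑-expand k (V-y a u v)))))
      (≈-reflexive (trans (hat-+ e₃ (λ a → c₄ * y⁴ a) k) (cong₂ _+_ (trans (hat-+ e₂ (λ a → c₃ * y³ a) k)
        (cong₂ _+_ (trans (hat-+ e₁ (λ a → c₂ * y² a) k) (cong₂ _+_ (trans (hat-+ (λ _ → 1ℚ) (λ a → κ * y a) k) (cong (_+_ (s k)) (hat-scale κ y k)))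
          (hat-scale c₂ y² k))) (hat-scale c₃ y³ k))) (hat-scale c₄ y⁴ k)))))
      where
      κ = ι k
      c₂ = (+ 1 / 2) * (κ * (κ - 1ℚ))
      c₃ = (+ 1 / 6) * (κ * (κ - 1ℚ) * (κ - (+ 2 / 1)))
      c₄ = (+ 1 / 24) * (κ * (κ - 1ℚ) * (κ - (+ 2 / 1)) * (κ - (+ 3 / 1)))

      e₁ e₂ e₃ : ℕ → ℚ
      e₁ a = 1ℚ + κ * y a
      e₂ a = e₁ a + c₂ * y² a
      e₃ a = e₂ a + c₃ * y³ a

    powerSum-1 : powerSum p 1 ≡ (+ 1 / 2) * P * (P - 1ℚ)
    powerSum-1 = trans (faulhaber p 1) (solve 1 (λ x → con 1ℚ :* (x :* con 1ℚ :* con 1ℚ) :* con (B 1) :+ (con 1ℚ :* (x :* (x :* con 1ℚ) :* con (+ 1 / 2)) :* con 1ℚ :+ con 0ℚ)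
      := con (+ 1 / 2) :* x :* (x :- con 1ℚ)) refl P)

    powerSum-2 : powerSum p 2 ≡ (+ 1 / 6) * P * (P - 1ℚ) * ((+ 2 / 1) * P - 1ℚ)
    powerSum-2 = trans (faulhaber p 2) (solve 1 (λ x → con 1ℚ :* (x :* con 1ℚ :* con 1ℚ) :* con (B 2) :+ (con (+ 2 / 1) :* (x :* (x :* con 1ℚ) :* con (+ 1 / 2)) :* con (B 1)
        :+ (con 1ℚ :* (x :* (x :* (x :* con 1ℚ)) :* con (+ 1 / 3)) :* con 1ℚ :+ con 0ℚ))
      := con (+ 1 / 6) :* x :* (x :- con 1ℚ) :* (con (+ 2 / 1) :* x :- con 1ℚ)) refl P)

    -- ∑ a = s 1 + n 1 exactly, and s 1 is negligible.
    n-1 : n 1 ≈[ 5 ] (+ 1 / 2) * P * (P - 1ℚ)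
    n-1 = ≈-trans (mk≈ (V-resp (solve 2 (λ s n → :- s := n :- (s :+ n)) refl (s 1) (n 1)) (V-neg (s-vanish 1 (s≤s z≤n) (≤M 2)))))
      (≈-reflexive (trans (sym (trans (powerSum-∑* 1 (s≤s z≤n)) (trans (∑-cong M (λ i _ → trans (cong (_* 1ℚ) (decompose (suc i) (s≤s z≤n)))
          (solve 2 (λ w y → w :* (con 1ℚ :+ y) :* con 1ℚ := w :* con 1ℚ :* con 1ℚ :+ w :* con 1ℚ :* y) refl (w (suc i)) (y (suc i))))) (∑-+ M _ _)))) powerSum-1))

    w-reflect : ∀ a → 0 < a → a < p → w (p ∸ a) ≈[ 5 ] -1ℚ * w a
    w-reflect a u v = ≈-trans (frob-≈ 4 (V-ι (p ∸ a)) (V-*ˡ (V-neg (V-ι 1)) (V-ι a))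
        (mk≈ (V-resp (sym (trans (cong (_- -1ℚ * ι a) (ι-∸ (ℕP.<⇒≤ v))) (solve 2 (λ p a → p :- a :- con -1ℚ :* a := p) refl P (ι a)))) V-p)))
      (≈-reflexive (trans (frob-* 4 -1ℚ (ι a)) (cong (_* w a) (frob--1 4))))

    p∸-pos : ∀ {a} → a < p → 0 < p ∸ a
    p∸-pos = ℕP.m<n⇒0<n∸m

    p∸-small : ∀ {a} → 0 < a → a < p → p ∸ a < p
    p∸-small {a} u v = ℕP.∸-monoʳ-< {p} {a} {0} u (ℕP.<⇒≤ v)

    winv-reflect : ∀ a → 0 < a → a < p → winv (p ∸ a) ≈[ 5 ] -1ℚ * winv a
    winv-reflect a u v = ≈-trans (≈-reflexive (trans (sym (ℚP.*-identityʳ x)) (trans (cong (x *_) (sym (w-inverse a u)))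
        (solve 3 (λ x w v → x :* (w :* v) := con -1ℚ :* ((con -1ℚ :* w) :* x) :* v) refl x (w a) (winv a)))))
      (≈-trans (≈-*ʳ (V-winv a v) (≈-*ˡ (V-neg (V-ι 1)) (≈-*ʳ (V-winv (p ∸ a) (p∸-small u v)) (≈-sym (w-reflect a u v)))))
        (≈-reflexive (cong (λ t → -1ℚ * t * winv a) (w-inverse (p ∸ a) (p∸-pos v)))))
      where x = winv (p ∸ a)

    y-reflect : ∀ a → 0 < a → a < p → y (p ∸ a) ≈[ 5 ] y a - P * winv a
    y-reflect a u v = ≈-trans (≈-- (≈-*ˡ (V-ι (p ∸ a)) (winv-reflect a u v)) (≈-refl {x = 1ℚ}))
      (≈-reflexive (trans (cong (λ t → t * (-1ℚ * winv a) - 1ℚ) (ι-∸ (ℕP.<⇒≤ v)))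
        (solve 3 (λ p a v → (p :- a) :* (con -1ℚ :* v) :- con 1ℚ := a :* v :- con 1ℚ :- p :* v) refl P (ι a) (winv a))))

    ∑*-reflect : ∀ f → ∑* f ≡ ∑* (λ a → f (p ∸ a))
    ∑*-reflect f = trans (∑-reverse M (λ i → f (suc i))) (∑-cong M (λ i i<M →
      cong f (trans (sym (ℕP.+-∸-assoc 1 i<M)) (cong (_∸ suc i) (sym p≡1+M)))))

    -- The reflection a ↦ p - a sends w to -w and y to y - p/w, whence n k ≡ p s (k-1) - n k. The
    -- case k = 1 is excluded because s 0 = p - 1 does not vanish.
    n-odd : ∀ k → Odd k → 3 ≤ k → k < M → V 5 (n k)
    n-odd (suc k) (h , eq) (s≤s 2≤k) k<M = V-cancel {n = 2} (>⇒∤ (≤p 3))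
        (V-resp (solve 3 (λ n p s → (n :- (p :* s :- n)) :+ p :* s := con (ι 2) :* n) refl (n (suc k)) P (s k))
          (V-+ (diff reflect) (V-*ˡ (V-≤ z≤n V-p) (s-vanish k (ℕP.≤-trans (s≤s z≤n) 2≤k) (ℕP.<-trans ℕP.≤-refl k<M)))))
      where
      reflect : n (suc k) ≈[ 5 ] P * s k - n (suc k)
      reflect = ≈-trans (≈-reflexive (∑*-reflect (λ a → w a ↑ suc k * y a)))
        (≈-trans (≈-∑* {g = λ a → P * (w a ↑ k * 1ℚ) - w a ↑ suc k * y a} (λ a u v →
            ≈-trans (≈-* (V0-↑ (suc k) (V-w (p ∸ a))) (V-- (Int-y a u v) (V-*ˡ (V-≤ z≤n V-p) (V-winv a v)))
                (≈-↑ (suc k) (V-w (p ∸ a)) (V-*ˡ (V-neg (V-ι 1)) (V-w a)) (w-reflect a u v)) (y-reflect a u v))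
              (≈-reflexive (trans (cong (_* (y a - P * winv a)) (trans (*-↑ -1ℚ (w a) (suc k)) (cong (_* w a ↑ suc k) (trans (cong (-1ℚ ↑_) eq) (-1-odd h)))))
                (trans (solve 5 (λ w wk y p v → con -1ℚ :* (w :* wk) :* (y :- p :* v) := p :* (wk :* (w :* v)) :- (w :* wk) :* y) refl (w a) (w a ↑ k) (y a) P (winv a))
                  (cong (λ t → P * (w a ↑ k * t) - w a ↑ suc k * y a) (w-inverse a u)))))))
          (≈-reflexive (trans (∑-- M (λ i → P * (w (suc i) ↑ k * 1ℚ)) (λ i → w (suc i) ↑ suc k * y (suc i)))
            (cong (_- n (suc k)) (∑-*ˡ M P (λ i → w (suc i) ↑ k * 1ℚ))))))

    ∏ : ℕ → (ℕ → ℚ) → ℚ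
    ∏ zero f = 1ℚ
    ∏ (suc m) f = ∏ m f * f m

    factorial-w : ∀ m → ι (m !) ≡ frob 4 (ι (m !)) * ∏ m (λ i → 1ℚ + y (suc i))
    factorial-w zero = sym (trans (ℚP.*-identityʳ _) (frob-1 4))
    factorial-w (suc m) = trans (ι-* (suc m) (m !)) (trans (cong₂ _*_ (decompose (suc m) (s≤s z≤n)) (factorial-w m))
      (trans (solve 4 (λ a b c d → (a :* b) :* (c :* d) := (a :* c) :* (d :* b)) refl (w (suc m)) (1ℚ + y (suc m)) (frob 4 (ι (m !))) (∏ m (λ i → 1ℚ + y (suc i))))
        (cong (_* (∏ m (λ i → 1ℚ + y (suc i)) * (1ℚ + y (suc m)))) (trans (sym (frob-* 4 (ι (suc m)) (ι (m !)))) (cong (frob 4) (sym (ι-* (suc m) (m !))))))))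

    -- The second elementary symmetric function appears as (e₁² - p₂)/2, with p₂ the sum of squares;
    -- the third has order 3.
    ∏-expand : ∀ m {f} → (∀ i → i < m → V 1 (f i)) →
      ∏ m (λ i → 1ℚ + f i) ≈[ 3 ] 1ℚ + ∑ m f + (+ 1 / 2) * (∑ m f * ∑ m f - ∑ m (λ i → f i * f i))
    ∏-expand zero h = ≈-reflexive refl
    ∏-expand (suc m) {f} h = ≈-trans (≈-*ʳ (V-+ (V-ι 1) (V-≤ z≤n vm)) (∏-expand m (λ i i<m → h i (ℕP.<-trans i<m ℕP.≤-refl))))
      (≈-trans (≈-poly (V-∑ m (λ i i<m → h i (ℕP.<-trans i<m ℕP.≤-refl)) ∷ V-∑ m (λ i i<m → V-* (h i (ℕP.<-trans i<m ℕP.≤-refl)) (h i (ℕP.<-trans i<m ℕP.≤-refl))) ∷ vm ∷ []) 3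
        (λ a b x → (con 1ℚ :+ a :+ con (+ 1 / 2) :* (a :* a :- b)) :* (con 1ℚ :+ x))
        (λ a b x → con 1ℚ :+ (a :+ x) :+ con (+ 1 / 2) :* ((a :+ x) :* (a :+ x) :- (b :+ x :* x))) refl)
        (≈-reflexive (cong₂ (λ s t → 1ℚ + s + (+ 1 / 2) * (s * s - t)) (sym (∑-last m f)) (sym (∑-last m (λ i → f i * f i))))))
      where vm = h m ℕP.≤-refl

    -- The Teichmüller part of M! is the p⁴-th power of M!, hence -1 by Wilson's theorem lifted.
    factorial-≈ : ι (M !) ≈[ 3 ] - (1ℚ + n 0 + (+ 1 / 2) * (n 0 * n 0 - n₂ 0))
    factorial-≈ = ≈-trans (≈-reflexive (factorial-w M))
      (≈-trans (≈-* (V-frob 4 (V-ι (M !))) (V-+ (V-+ (V-ι 1) va) (V-*ˡ (V-/2) (V-- (V-*ˡ va va) vb)))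
          (≈-≤ (ℕP.m≤m+n 3 2) (≈-trans (frob-≈ 4 (V-ι (M !)) (V-neg (V-ι 1)) wilson) (≈-reflexive (frob--1 4))))
          (∏-expand M (λ i i<M → V-y (suc i) (s≤s z≤n) (<M⇒<p i<M))))
        (≈-reflexive (trans (cong₂ (λ a b → -1ℚ * (1ℚ + a + (+ 1 / 2) * (a * a - b))) (∑-cong M (λ i _ → sym (ℚP.*-identityˡ _))) (∑-cong M (λ i _ → sym (ℚP.*-identityˡ _))))
          (solve 1 (λ a → con -1ℚ :* a := :- a) refl (1ℚ + n 0 + (+ 1 / 2) * (n 0 * n 0 - n₂ 0))))))
      where
      va : V 0 (∑ M (λ i → y (suc i)))
      va = V-∑ M (λ i i<M → Int-y (suc i) (s≤s z≤n) (<M⇒<p i<M))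
      vb : V 0 (∑ M (λ i → y² (suc i)))
      vb = V-∑ M (λ i i<M → Int-y² (suc i) (s≤s z≤n) (<M⇒<p i<M))
      V-/2 : V 0 (+ 1 / 2)
      V-/2 = V-recip< 2 (≤p 3)

    wilson-quotient : P * wq p ≈[ 2 ] - n 0
    wilson-quotient = ≈-trans (≈-reflexive (trans (solve 3 (λ p f r → p :* (f :* r) := f :* (p :* r)) refl P (ι (M !) + 1ℚ) (recipℕ p))
        (trans (cong ((ι (M !) + 1ℚ) *_) (ι-recip p)) (ℚP.*-identityʳ _))))
      (≈-trans (≈-+ (≈-≤ (ℕP.m≤m+n 2 1) factorial-≈) (≈-refl {x = 1ℚ}))
        (≈-poly (V-n 0 ∷ V-n₂ 0 ∷ []) 2 (λ a b → :- (con 1ℚ :+ a :+ con (+ 1 / 2) :* (a :* a :- b)) :+ con 1ℚ) (λ a b → :- a) refl))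

    -- aᴹ = wᴹ (1 + y)ᴹ ≡ 1 + (p-1) y.
    fermat-quotient : ∀ a → 0 < a → a < p → P * fq p a ≈[ 2 ] - y a
    fermat-quotient a u v = ≈-trans (≈-reflexive (trans (solve 3 (λ p f r → p :* (f :* r) := f :* (p :* r)) refl P (ι (a ℕ.^ M) - 1ℚ) (recipℕ p))
        (trans (cong ((ι (a ℕ.^ M) - 1ℚ) *_) (ι-recip p)) (trans (ℚP.*-identityʳ _) (cong (_- 1ℚ) (trans (ι-^ a M) (trans (cong (_↑ M) (decompose a u)) (*-↑ (w a) (1ℚ + y a) M))))))))
      (≈-trans (≈-- (≈-≤ (ℕP.m≤m+n 2 3) (≈-* (V0-↑ M (V-w a)) (value-loc (V-y a u v ∷ V-ι M ∷ []) 5 (close (V-y a u v ∷ V-ι M ∷ []) (λ x κ → binomialᵖ κ x)) refl) (w-order a u v) (↑-expand M (V-y a u v)))) (≈-refl {x = 1ℚ}))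
        (≈-trans (≈-reflexive (cong (λ t → 1ℚ * binomial₄ t (y a) - 1ℚ) ιM))
          (≈-poly (V-y a u v ∷ V-p ∷ []) 2 (λ x q → con 1ℚ :* binomialᵖ (q :- con 1ℚ) x :- con 1ℚ) (λ x q → :- x) refl)))

  -- Products of moments

  select : {A : Set} → Dec A → ℚ → ℚ
  select (yes _) x = x
  select (no _) _ = 0ℚ

  select-yes : {A : Set} (d : Dec A) {x : ℚ} → A → select d x ≡ x
  select-yes (yes _) _ = refl
  select-yes (no ¬a) a = ⊥-elim (¬a a)

  select-no : {A : Set} (d : Dec A) {x : ℚ} → ¬ A → select d x ≡ 0ℚ
  select-no (yes a) ¬a = ⊥-elim (¬a a)
  select-no (no _) _ = refl

  select-0 : {A : Set} (d : Dec A) → select d 0ℚ ≡ 0ℚ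
  select-0 (yes _) = refl
  select-0 (no _) = refl

  even? : ∀ k → Dec (Even k)
  even? k with even⊎odd k
  ... | inj₁ e = yes e
  ... | inj₂ o = no (λ e → even-odd-⊥ e o)

  ⋆-support : ∀ {f} g m n → (∀ i → m ≤ i → f i ≡ 0ℚ) → m ≤ suc n → (f ⋆ g) n ≡ ∑ m (λ i → f i * g (n ∸ i))
  ⋆-support {f} g m n h m≤ = trans (⋆-∑ n f g) (trans (cong (λ t → ∑ t F) (sym (ℕP.m+[n∸m]≡n m≤)))
    (trans (∑-split m (suc n ∸ m) F) (trans (cong (_+_ (∑ m F)) (trans
      (∑-cong (suc n ∸ m) (λ i _ → trans (cong (_* g (n ∸ (m ℕ.+ i))) (h (m ℕ.+ i) (ℕP.m≤m+n m i))) (ℚP.*-zeroˡ (g (n ∸ (m ℕ.+ i)))))) (∑-0 (suc n ∸ m)))) (ℚP.+-identityʳ _))))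
    where
    F : ℕ → ℚ
    F i = f i * g (n ∸ i)

  ∑-select : ∀ m L (f : ℕ → ℚ) x → m < L → ∑ L (λ k → f k * select (k ℕ.≟ m) x) ≡ f m * x
  ∑-select m (suc L) f x m<L = last (ℕP.m≤n⇒m<n∨m≡n (ℕ.s≤s⁻¹ m<L))
    where
    F : ℕ → ℚ
    F k = f k * select (k ℕ.≟ m) x
    off : ∀ k → k ≢ m → F k ≡ 0ℚ
    off k h = trans (cong (f k *_) (select-no (k ℕ.≟ m) h)) (ℚP.*-zeroʳ (f k))
    last : m < L ⊎ m ≡ L → ∑ (suc L) F ≡ f m * x
    last (inj₁ lt) = trans (∑-last L F) (trans (cong₂ _+_ {∑ L F} {f m * x} {F L} {0ℚ} (∑-select m L f x lt) (off L (λ e → ℕP.<-irrefl (sym e) lt))) (ℚP.+-identityʳ (f m * x)))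
    last (inj₂ refl) = trans (∑-last m F) (trans (cong₂ _+_ (trans (∑-cong m (λ k k<m → off k (ℕP.<⇒≢ k<m))) (∑-0 m))
      (cong (f m *_) (select-yes (m ℕ.≟ m) refl))) (ℚP.+-identityˡ (f m * x)))

  module Convolutions (p : ℕ) (pp : Prime p) (11≤p : 11 ≤ p) where
    open Moments p pp 11≤p public

    -- `top` = p - 3 is the last even index below a full period. `N` = p + 1 is written M + 2
    -- because it is the frequency 2 shifted by one period.
    top N : ℕ
    top = p ∸ 3
    N = suc (suc M)

    2+top : suc (suc top) ≡ M
    2+top = trans (cong (λ t → suc (suc t)) (sym (ℕP.∸-+-assoc p 1 2))) (ℕP.m+[n∸m]≡n {2} {M} (≤M 2))

    top-even : Even top
    top-even = subst Even (cong (λ t → t ∸ 2) (sym 2+top)) (even-∸ M-even (1 , refl))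

    8≤top : 8 ≤ top
    8≤top = ℕP.∸-monoˡ-≤ 3 11≤p

    top<M : top < M
    top<M = subst (top <_) 2+top (s≤s (ℕP.n≤1+n top))

    ιN : ι N ≡ P + 1ℚ
    ιN = trans (cong ι (cong suc (sym p≡1+M))) (trans (ι-suc p) (ℚP.+-comm 1ℚ P))

    V-select : ∀ {r x} {A : Set} (d : Dec A) → V r x → V r (select d x)
    V-select (yes _) v = v
    V-select (no _) v = V-0

    -- Sealed so that type checking never unfolds the decisions; only the lemmas of this block are
    -- used.
    abstract
      restrict : (ℕ → ℚ) → ℕ → ℚ
      restrict f k = select (2 ≤? k) (select (k ≤? top) (f k))

      restrict-in : ∀ f {k} → 2 ≤ k → k ≤ top → restrict f k ≡ f k
      restrict-in f {k} a b = trans (select-yes (2 ≤? k) a) (select-yes (k ≤? top) b)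

      restrict-low : ∀ f {k} → k < 2 → restrict f k ≡ 0ℚ
      restrict-low f {k} a = select-no (2 ≤? k) (ℕP.<⇒≱ a)

      restrict-high : ∀ f {k} → top < k → restrict f k ≡ 0ℚ
      restrict-high f {k} a = trans (cong (select (2 ≤? k)) (select-no (k ≤? top) (ℕP.<⇒≱ a))) (select-0 (2 ≤? k))

      restrict-elim : ∀ {A : ℚ → Set} f k → A 0ℚ → (2 ≤ k → k ≤ top → A (f k)) → A (restrict f k)
      restrict-elim {A} f k a0 h with 2 ≤? k | k ≤? top
      ... | yes u | yes v = h u v
      ... | yes u | no _ = a0
      ... | no _ | _ = a0

      -- Parity is built in: at odd indices `n₂` has order 2 only (see `n₂-1`), while the Bernoulli
      -- number vanishes. The range starts at 4 because `n₂-2` has another shape; at degree `N` the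
      -- partners of 2, ..., top are M, ..., 4, and M is treated separately.
      qᵣ : ℕ → ℚ
      qᵣ k = select (even? k) (select (4 ≤? k) (select (k ≤? top) (n₂ k)))

      qᵣ-in : ∀ {k} → Even k → 4 ≤ k → k ≤ top → qᵣ k ≡ n₂ k
      qᵣ-in {k} e u v = trans (select-yes (even? k) e) (trans (select-yes (4 ≤? k) u) (select-yes (k ≤? top) v))

      qᵣ-low : ∀ {k} → k < 4 → qᵣ k ≡ 0ℚ
      qᵣ-low {k} u = trans (cong (select (even? k)) (select-no (4 ≤? k) (ℕP.<⇒≱ u))) (select-0 (even? k))

      qᵣ-high : ∀ {k} → top < k → qᵣ k ≡ 0ℚ
      qᵣ-high {k} u = trans (cong (λ t → select (even? k) (select (4 ≤? k) t)) (select-no (k ≤? top) (ℕP.<⇒≱ u)))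
        (trans (cong (select (even? k)) (select-0 (4 ≤? k))) (select-0 (even? k)))

      qᵣ-odd : ∀ {k} → Odd k → qᵣ k ≡ 0ℚ
      qᵣ-odd {k} o = select-no (even? k) (λ e → even-odd-⊥ e o)

      V-qᵣ : ∀ k → V 2 (qᵣ k)
      V-qᵣ k = V-select (even? k) (V-select (4 ≤? k) (V-select (k ≤? top) (V-n₂ k)))

    -- Supported on [2, p-3], these sequences turn the sums of the statement into Cauchy products.
    P𝓑 nᵣ bᵣ : ℕ → ℚ
    P𝓑 k = P * 𝓑 k
    nᵣ = restrict n
    bᵣ = restrict P𝓑

    V-nᵣ : ∀ k → V 1 (nᵣ k)
    V-nᵣ k = restrict-elim {V 1} n k V-0 (λ _ _ → V-n k)

    V0-nᵣ : ∀ k → V 0 (nᵣ k)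
    V0-nᵣ k = V-≤ z≤n (V-nᵣ k)

    V0-n : ∀ k → V 0 (n k)
    V0-n k = V-≤ z≤n (V-n k)

    odd-≥3 : ∀ {k} → Odd k → 2 ≤ k → 3 ≤ k
    odd-≥3 (zero , refl) (s≤s ())
    odd-≥3 (suc h , refl) _ = s≤s (s≤s (s≤s z≤n))

    nᵣ-odd : ∀ {k} → Odd k → V 5 (nᵣ k)
    nᵣ-odd {k} o = restrict-elim {V 5} n k V-0 (λ u v → n-odd k o (odd-≥3 o u) (ℕP.≤-<-trans v top<M))

    nᵣ-beyond : ∀ k → M ≤ k → nᵣ k ≡ 0ℚ
    nᵣ-beyond k h = restrict-high n (ℕP.<-≤-trans top<M h)

    n-M-1 : V 5 (n (suc top))
    n-M-1 = n-odd (suc top) (suc-even top-even) (ℕP.≤-trans (ℕP.m≤m+n 3 6) (s≤s 8≤top)) (subst (suc top <_) 2+top ℕP.≤-refl)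

    -- Among the moments n k with 2 ≤ k < M only the even ones, hence those with k ≤ top, matter modulo p⁵.
    circular : ∀ (X : ℕ → ℚ) → (∀ k → V 0 (X k)) → ∑ M (λ k → n k * X k) ≈[ 5 ] n 0 * X 0 + n 1 * X 1 + ∑ M (λ k → nᵣ k * X k)
    circular X vX = subst (λ m → ∑ m (λ k → n k * X k) ≈[ 5 ] n 0 * X 0 + n 1 * X 1 + ∑ m (λ k → nᵣ k * X k)) 2+top
      (≈-trans (≈-reflexive (sym (ℚP.+-assoc (n 0 * X 0) (n 1 * X 1) _)))
        (≈-+ (≈-refl {x = n 0 * X 0 + n 1 * X 1}) (≈-trans (≈-∑ top middle)
          (≈-reflexive (trans (solve 3 (λ a b c → c := con 0ℚ :* a :+ (con 0ℚ :* b :+ c)) refl (X 0) (X 1) (∑ top (λ i → nᵣ (suc (suc i)) * X (suc (suc i)))))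
            (sym (cong₂ (λ s t → s * X 0 + (t * X 1 + ∑ top (λ i → nᵣ (suc (suc i)) * X (suc (suc i))))) (restrict-low n {0} (s≤s z≤n)) (restrict-low n {1} (s≤s (s≤s z≤n))))))))))
      where
      middle : ∀ i → i < top → n (suc (suc i)) * X (suc (suc i)) ≈[ 5 ] nᵣ (suc (suc i)) * X (suc (suc i))
      middle i i<top = last (ℕP.m≤n⇒m<n∨m≡n i<top)
        where
        last : suc (suc i) ≤ top ⊎ suc i ≡ top → n (suc (suc i)) * X (suc (suc i)) ≈[ 5 ] nᵣ (suc (suc i)) * X (suc (suc i))
        last (inj₁ 1+i<top) = ≈-reflexive (cong (_* X (suc (suc i))) (sym (restrict-in n (s≤s (s≤s z≤n)) 1+i<top)))
        last (inj₂ eq) = ≈-*ʳ (vX (suc (suc i))) (≈-trans (V⇒≈0 (subst (λ t → V 5 (n (suc t))) (sym eq) n-M-1))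
          (≈-reflexive (sym (restrict-high n {suc (suc i)} (subst (_< suc (suc i)) eq ℕP.≤-refl)))))

    even-≤top : ∀ {k} → Even k → k < M → k ≤ top
    even-≤top {k} e k<M with ℕP.m≤n⇒m<n∨m≡n (ℕ.s≤s⁻¹ (subst (k <_) (sym 2+top) k<M))
    ... | inj₁ (s≤s h) = h
    ... | inj₂ refl = ⊥-elim (even-odd-⊥ e (suc-even top-even))

    even-≥2 : ∀ {k} → Even k → 0 < k → 2 ≤ k
    even-≥2 (suc h , refl) _ = s≤s (s≤s z≤n)

    n-periodic : ∀ k → n (k ℕ.+ M) ≈[ 5 ] n k
    n-periodic k = hat-periodic y k Int-y

    n₂-periodic : ∀ k → n₂ (k ℕ.+ M) ≈[ 5 ] n₂ k
    n₂-periodic k = hat-periodic y² k Int-y²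

    c : ℕ → ℚ
    c = nᵣ ⋆ nᵣ

    V-⋆ : ∀ {r s f g} m → (∀ i → V r (f i)) → (∀ i → V s (g i)) → V (r ℕ.+ s) ((f ⋆ g) m)
    V-⋆ {f = f} {g} m vf vg = V-resp (sym (⋆-∑ m f g)) (V-∑ (suc m) (λ i _ → V-* (vf i) (vg (m ∸ i))))

    V-c : ∀ m → V 2 (c m)
    V-c m = V-⋆ m V-nᵣ V-nᵣ

    c-high : ∀ m → top ℕ.+ top < m → c m ≡ 0ℚ
    c-high m h = trans (⋆-∑ m nᵣ nᵣ) (trans (∑-cong (suc m) (λ i _ → zeros i)) (∑-0 (suc m)))
      where
      zeros : ∀ i → nᵣ i * nᵣ (m ∸ i) ≡ 0ℚ
      zeros i = at (i ≤? top)
        where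
        at : Dec (i ≤ top) → nᵣ i * nᵣ (m ∸ i) ≡ 0ℚ
        at (no i≰) = trans (cong (_* nᵣ (m ∸ i)) (restrict-high n (ℕP.≰⇒> i≰))) (ℚP.*-zeroˡ (nᵣ (m ∸ i)))
        at (yes i≤) = trans (cong (nᵣ i *_) (restrict-high n (ℕP.m+n≤o⇒m≤o∸n (suc top) (ℕP.≤-trans (s≤s (ℕP.+-monoʳ-≤ top i≤)) h)))) (ℚP.*-zeroʳ (nᵣ i))

    c-low : ∀ m → m < 4 → c m ≡ 0ℚ
    c-low m h = trans (⋆-∑ m nᵣ nᵣ) (trans (∑-cong (suc m) (λ i _ → zeros i)) (∑-0 (suc m)))
      where
      zeros : ∀ i → nᵣ i * nᵣ (m ∸ i) ≡ 0ℚ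
      zeros i = at (2 ≤? i)
        where
        at : Dec (2 ≤ i) → nᵣ i * nᵣ (m ∸ i) ≡ 0ℚ
        at (no i≱) = trans (cong (_* nᵣ (m ∸ i)) (restrict-low n (ℕP.≰⇒> i≱))) (ℚP.*-zeroˡ (nᵣ (m ∸ i)))
        at (yes i≥) = trans (cong (nᵣ i *_) (restrict-low n (ℕP.≤-<-trans (ℕP.∸-monoʳ-≤ m i≥) (s≤s (ℕP.∸-monoˡ-≤ 2 (ℕ.s≤s⁻¹ h)))))) (ℚP.*-zeroʳ (nᵣ i))

    select-sum : ∀ m (X : ℕ → ℚ) → m < M → ∑ M (λ k → nᵣ k * select (k ≤? m) (X k)) ≡ ∑ (suc m) (λ k → nᵣ k * X k)
    select-sum m X m<M = trans (cong (λ t → ∑ t F) (sym (ℕP.m+[n∸m]≡n m<M)))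
      (trans (∑-split (suc m) (M ∸ suc m) F) (trans (cong₂ _+_
        (∑-cong (suc m) {F} {λ k → nᵣ k * X k} (λ k k≤m → cong (nᵣ k *_) (select-yes (k ≤? m) (ℕ.s≤s⁻¹ k≤m))))
        (trans (∑-cong (M ∸ suc m) (λ i _ → trans (cong (nᵣ (suc m ℕ.+ i) *_) (select-no (suc m ℕ.+ i ≤? m) (ℕP.<⇒≱ (s≤s (ℕP.m≤m+n m i))))) (ℚP.*-zeroʳ (nᵣ (suc m ℕ.+ i))))) (∑-0 (M ∸ suc m))))
        (ℚP.+-identityʳ _)))
      where
      F : ℕ → ℚ
      F k = nᵣ k * select (k ≤? m) (X k)

    -- The circular convolution of nᵣ with itself splits into the ordinary ones at m and at m + M; the index 0 accounts for n 0 nᵣ m.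
    fold : ∀ m → Even m → m < M → ∑ M (λ k → nᵣ k * n (m ℕ.+ (M ∸ k))) ≈[ 5 ] n 0 * nᵣ m + c m + c (m ℕ.+ M)
    fold m em m<M = ≈-trans (≈-∑ M termwise) (≈-reflexive (trans (∑-+ M _ _) (cong₂ _+_ (trans (∑-+ M _ _) (cong₂ _+_ atm lower)) upper)))
      where
      -- The frequency m - k is zero, positive or wraps around according as k = m, k < m or k > m;
      -- one summand for each case, the other two being zero.
      α β′ γ : ℕ → ℚ
      α k = select (k ℕ.≟ m) (n 0)
      β′ k = select (k ≤? m) (nᵣ (m ∸ k))
      γ k = nᵣ (m ℕ.+ M ∸ k)
      atm : ∑ M (λ k → nᵣ k * α k) ≡ n 0 * nᵣ m
      atm = trans (∑-select m M nᵣ (n 0) m<M) (ℚP.*-comm (nᵣ m) (n 0))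
      lower : ∑ M (λ k → nᵣ k * β′ k) ≡ c m
      lower = trans (select-sum m (λ k → nᵣ (m ∸ k)) m<M) (sym (⋆-∑ m nᵣ nᵣ))
      upper : ∑ M (λ k → nᵣ k * γ k) ≡ c (m ℕ.+ M)
      upper = sym (⋆-support nᵣ M (m ℕ.+ M) nᵣ-beyond (ℕP.≤-trans (ℕP.m≤n+m M m) (ℕP.n≤1+n _)))
      V-α : ∀ k → V 0 (α k)
      V-α k = V-select (k ℕ.≟ m) (V0-n 0)
      V-β : ∀ k → V 0 (β′ k)
      V-β k = V-select (k ≤? m) (V0-nᵣ (m ∸ k))
      combine : ∀ {k x} → α k ≡ x → ∀ {y} → β′ k ≡ y → ∀ {z} → γ k ≡ z → n (m ℕ.+ (M ∸ k)) ≈[ 5 ] x + y + z →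
        nᵣ k * n (m ℕ.+ (M ∸ k)) ≈[ 5 ] nᵣ k * α k + nᵣ k * β′ k + nᵣ k * γ k
      combine {k} refl refl refl e = ≈-trans (≈-*ˡ (V0-nᵣ k) e) (≈-reflexive
        (solve 4 (λ n a b c → n :* (a :+ b :+ c) := n :* a :+ n :* b :+ n :* c) refl (nᵣ k) (α k) (β′ k) (γ k)))
      zero-case : ∀ k → nᵣ k ≡ 0ℚ → nᵣ k * n (m ℕ.+ (M ∸ k)) ≈[ 5 ] nᵣ k * α k + nᵣ k * β′ k + nᵣ k * γ k
      zero-case k e = ≈-reflexive (trans (cong (_* n (m ℕ.+ (M ∸ k))) e) (trans
        (solve 4 (λ a b c d → con 0ℚ :* a := con 0ℚ :* b :+ con 0ℚ :* c :+ con 0ℚ :* d) refl (n (m ℕ.+ (M ∸ k))) (α k) (β′ k) (γ k))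
        (cong (λ t → t * α k + t * β′ k + t * γ k) (sym e))))
      even-case : ∀ k → Even k → 2 ≤ k → k ≤ top → nᵣ k * n (m ℕ.+ (M ∸ k)) ≈[ 5 ] nᵣ k * α k + nᵣ k * β′ k + nᵣ k * γ k
      even-case k e 2≤k k≤top = go (ℕP.<-cmp k m)
        where
        k≤M : k ≤ M
        k≤M = ℕP.≤-trans k≤top (ℕP.<⇒≤ top<M)
        index : k < m → m ℕ.+ (M ∸ k) ≡ m ∸ k ℕ.+ M
        index k<m = trans (sym (ℕP.+-∸-assoc m k≤M)) (ℕP.+-∸-comm M (ℕP.<⇒≤ k<m))
        go : Tri (k < m) (k ≡ m) (m < k) → nᵣ k * n (m ℕ.+ (M ∸ k)) ≈[ 5 ] nᵣ k * α k + nᵣ k * β′ k + nᵣ k * γ k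
        go (tri< k<m k≢m _) = combine (select-no (k ℕ.≟ m) k≢m)
          (trans (select-yes (k ≤? m) (ℕP.<⇒≤ k<m)) (restrict-in n (even-≥2 (even-∸ em e) (ℕP.m<n⇒0<n∸m k<m)) (ℕP.≤-trans (ℕP.m∸n≤m m k) (even-≤top em m<M))))
          (restrict-high n (subst (top <_) (sym (trans (ℕP.+-∸-assoc m k≤M) (index k<m))) (ℕP.<-≤-trans top<M (ℕP.m≤n+m M (m ∸ k)))))
          (≈-trans (≈-reflexive (cong n (index k<m))) (≈-trans (n-periodic (m ∸ k)) (≈-reflexive (solve 1 (λ a → a := con 0ℚ :+ a :+ con 0ℚ) refl (n (m ∸ k))))))
        go (tri≈ _ refl _) = combine (select-yes (k ℕ.≟ k) refl)
          (trans (select-yes (k ≤? k) ℕP.≤-refl) (restrict-low n (subst (_< 2) (sym (ℕP.n∸n≡0 k)) (s≤s z≤n))))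
          (restrict-high n (subst (top <_) (sym (ℕP.m+n∸m≡n k M)) top<M))
          (≈-trans (≈-reflexive (cong n (ℕP.m+[n∸m]≡n (ℕP.<⇒≤ m<M)))) (≈-trans (n-periodic 0) (≈-reflexive (solve 1 (λ a → a := a :+ con 0ℚ :+ con 0ℚ) refl (n 0)))))
        go (tri> _ k≢m m<k) = combine (select-no (k ℕ.≟ m) k≢m) (select-no (k ≤? m) (ℕP.<⇒≱ m<k))
          (trans (cong nᵣ (ℕP.+-∸-assoc m k≤M)) (restrict-in n
            (ℕP.≤-trans (subst (_≤ M ∸ k) (trans (cong (_∸ top) (sym 2+top)) (ℕP.m+n∸n≡m 2 top)) (ℕP.∸-monoʳ-≤ M k≤top)) (ℕP.m≤n+m (M ∸ k) m))
            (even-≤top (even-+ em (even-∸ M-even e)) (subst (m ℕ.+ (M ∸ k) <_) (ℕP.m+[n∸m]≡n k≤M) (ℕP.+-monoˡ-< (M ∸ k) m<k)))))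
          (≈-reflexive (solve 1 (λ a → a := con 0ℚ :+ con 0ℚ :+ a) refl (n (m ℕ.+ (M ∸ k)))))
      termwise : ∀ k → k < M → nᵣ k * n (m ℕ.+ (M ∸ k)) ≈[ 5 ] nᵣ k * α k + nᵣ k * β′ k + nᵣ k * γ k
      termwise k k<M = split (even⊎odd k)
        where
        zones : Even k → Dec (2 ≤ k) → Dec (k ≤ top) → nᵣ k * n (m ℕ.+ (M ∸ k)) ≈[ 5 ] nᵣ k * α k + nᵣ k * β′ k + nᵣ k * γ k
        zones e (no h) _ = zero-case k (restrict-low n (ℕP.≰⇒> h))
        zones e (yes _) (no h) = zero-case k (restrict-high n (ℕP.≰⇒> h))
        zones e (yes u) (yes v) = even-case k e u v
        split : Even k ⊎ Odd k → nᵣ k * n (m ℕ.+ (M ∸ k)) ≈[ 5 ] nᵣ k * α k + nᵣ k * β′ k + nᵣ k * γ k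
        split (inj₁ e) = zones e (2 ≤? k) (k ≤? top)
        split (inj₂ o) = mk≈ (V-- (V-*ʳ (nᵣ-odd o) (V0-n (m ℕ.+ (M ∸ k)))) (V-+ (V-+ (V-*ʳ (nᵣ-odd o) (V-α k)) (V-*ʳ (nᵣ-odd o) (V-β k))) (V-*ʳ (nᵣ-odd o) (V0-nᵣ (m ℕ.+ M ∸ k)))))

    n₂-expand : ∀ m → ι M * n₂ m ≈[ 5 ] n 0 * n (m ℕ.+ M) + n 1 * n (m ℕ.+ (M ∸ 1)) + ∑ M (λ k → nᵣ k * n (m ℕ.+ (M ∸ k)))
    n₂-expand m = ≈-trans (hat-product y y m Int-y Int-y) (circular (λ k → n (m ℕ.+ (M ∸ k))) (λ k → V0-n (m ℕ.+ (M ∸ k))))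

    nᵣ-in : ∀ {k} → 2 ≤ k → k ≤ top → nᵣ k ≡ n k
    nᵣ-in = restrict-in n

    index-1 : ∀ m → 0 < m → m ℕ.+ (M ∸ 1) ≡ m ∸ 1 ℕ.+ M
    index-1 (suc m) _ = trans (sym (ℕP.+-suc m (M ∸ 1))) (cong (m ℕ.+_) (sym M-pred))

    -- The product with n 1 drops out since its partner n (m-1) is an odd moment of index at least
    -- 3. One n 0 n m comes from the index 0, the other from k = m in `fold`.
    n₂-even : ∀ m → Even m → 4 ≤ m → m ≤ top → ι M * n₂ m ≈[ 5 ] (+ 2 / 1) * n 0 * nᵣ m + c m + c (m ℕ.+ M)
    n₂-even m em 4≤m m≤top = ≈-trans (n₂-expand m)
      (≈-trans (≈-+ (≈-+ (≈-*ˡ (V0-n 0) (≈-trans (n-periodic m) (≈-reflexive (sym (nᵣ-in 2≤m m≤top)))))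
          (V⇒≈0 (V-*ˡ (V0-n 1) (≈⇒V (≈-trans (≈-reflexive (cong n (index-1 m (ℕP.≤-trans (s≤s z≤n) 4≤m)))) (n-periodic (m ∸ 1)))
            (n-odd (m ∸ 1) (odd-pred em (ℕP.≤-trans (s≤s z≤n) 4≤m)) (ℕP.∸-monoˡ-≤ 1 4≤m) (ℕP.≤-<-trans (ℕP.m∸n≤m m 1) m<M))))))
          (fold m em m<M))
        (≈-reflexive (solve 4 (λ a b c d → a :* b :+ con 0ℚ :+ (a :* b :+ c :+ d) := con (+ 2 / 1) :* a :* b :+ c :+ d) refl (n 0) (nᵣ m) (c m) (c (m ℕ.+ M)))))
      where
      2≤m = ℕP.≤-trans (s≤s (s≤s z≤n)) 4≤m
      m<M = ℕP.≤-<-trans m≤top top<M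

    -- Here 2 = 1 + 1 leaves the product n 1 · n 1; all pairs of larger indices wrap around, hence
    -- `c N` alone.
    n₂-2 : ι M * n₂ 2 ≈[ 5 ] (+ 2 / 1) * n 0 * n 2 + n 1 * n 1 + c N
    n₂-2 = ≈-trans (n₂-expand 2)
      (≈-trans (≈-+ (≈-+ (≈-*ˡ (V0-n 0) (n-periodic 2)) (≈-*ˡ (V0-n 1) (≈-trans (≈-reflexive (cong n (index-1 2 (s≤s z≤n)))) (n-periodic 1))))
          (≈-trans (fold 2 (1 , refl) (≤M 3)) (≈-reflexive (cong₂ (λ s t → n 0 * s + t + c N) (nᵣ-in ℕP.≤-refl (ℕP.≤-trans (ℕP.m≤m+n 2 6) 8≤top)) (c-low 2 (ℕP.m≤m+n 3 1))))))
        (≈-reflexive (solve 4 (λ a b c d → a :* b :+ c :+ (a :* b :+ con 0ℚ :+ d) := con (+ 2 / 1) :* a :* b :+ c :+ d) refl (n 0) (n 2) (n 1 * n 1) (c N))))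

    n₂-0 : ι M * n₂ 0 ≈[ 5 ] n 0 * n 0 + c M
    n₂-0 = ≈-trans (n₂-expand 0)
      (≈-trans (≈-+ (≈-+ (≈-*ˡ (V0-n 0) (n-periodic 0)) (V⇒≈0 (V-*ˡ (V0-n 1) (subst (λ t → V 5 (n t)) (cong (_∸ 1) 2+top) n-M-1))))
          (≈-trans (fold 0 (0 , refl) (ℕP.≤-trans (s≤s z≤n) 10≤M)) (≈-reflexive (cong₂ (λ s t → n 0 * s + t + c M) (restrict-low n {0} (s≤s z≤n)) (c-low 0 (s≤s z≤n))))))
        (≈-reflexive (solve 2 (λ a d → a :* a :+ con 0ℚ :+ (a :* con 0ℚ :+ con 0ℚ :+ d) := a :* a :+ d) refl (n 0) (c M))))

    -- Every pair of indices ≥ 2 with odd sum modulo M has an odd member, so only 2 n 0 n 1 ≡ p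
    -- (p-1) n 0 remains.
    n₂-1 : n₂ 1 ≈[ 5 ] P * n 0
    n₂-1 = mk≈ (V-cancel {n = M} p∤M (V-resp
        (trans (cong (λ t → (ι M * n₂ 1 - E) + (E - (n 0 * (h * t) + h * t * n 0 + 0ℚ))) (sym ιM))
          (solve 5 (λ M q E p n → (M :* q :- E) :+ (E :- (n :* (con (+ 1 / 2) :* p :* M) :+ con (+ 1 / 2) :* p :* M :* n :+ con 0ℚ)) := M :* (q :- p :* n)) refl (ι M) (n₂ 1) E P (n 0)))
        (V-+ (diff (n₂-expand 1)) (diff (≈-+ (≈-+ (≈-*ˡ (V0-n 0) (≈-trans (n-periodic 1) n-1))
            (≈-* (V0-n 1) (V0-n 0) n-1 (≈-trans (≈-reflexive (cong n (index-1 1 (s≤s z≤n)))) (n-periodic 0))))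
          (V⇒≈0 (V-∑ M vanish)))))))
      where
      h = (+ 1 / 2) * P
      E = n 0 * n (1 ℕ.+ M) + n 1 * n (1 ℕ.+ (M ∸ 1)) + ∑ M (λ k → nᵣ k * n (1 ℕ.+ (M ∸ k)))
      vanish : ∀ k → k < M → V 5 (nᵣ k * n (1 ℕ.+ (M ∸ k)))
      vanish k k<M = split (even⊎odd k)
        where
        split : Even k ⊎ Odd k → V 5 (nᵣ k * n (1 ℕ.+ (M ∸ k)))
        split (inj₂ o) = V-*ʳ (nᵣ-odd o) (V0-n (1 ℕ.+ (M ∸ k)))
        split (inj₁ e) = restrict-elim {λ t → V 5 (t * n (1 ℕ.+ (M ∸ k)))} n k (V-resp (sym (ℚP.*-zeroˡ (n (1 ℕ.+ (M ∸ k))))) V-0)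
          (λ u v → V-*ˡ (V0-n k) (n-odd (suc (M ∸ k)) (suc-even (even-∸ M-even e))
            (s≤s (subst (_≤ M ∸ k) (trans (cong (_∸ top) (sym 2+top)) (ℕP.m+n∸n≡m 2 top)) (ℕP.∸-monoʳ-≤ M v)))
            (ℕP.≤-<-trans (s≤s (subst (M ∸ k ≤_) (cong (_∸ 2) (sym 2+top)) (ℕP.∸-monoʳ-≤ M u))) (subst (suc top <_) 2+top ℕP.≤-refl))))

  -- The third moment and the index-weighted convolution

  module Congruences (p : ℕ) (pp : Prime p) (11≤p : 11 ≤ p) where
    open Convolutions p pp 11≤p public

    -- `W` is what the third moment contributes. The double sum yields U - 2 W up to boundary terms,
    -- and 𝓣𝓒(4) yields -U as its correction of third order.
    U W T : ℚ
    U = (θ nᵣ ⋆ qᵣ) N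
    W = (nᵣ ⋆ qᵣ) N
    T = (nᵣ ⋆ c) N

    V-θ : ∀ {r f} → (∀ i → V r (f i)) → ∀ i → V r (θ f i)
    V-θ h i = V-*ˡ (V-ι i) (h i)

    V-U : V 3 U
    V-U = V-⋆ N (V-θ V-nᵣ) V-qᵣ

    V-W : V 3 W
    V-W = V-⋆ N V-nᵣ V-qᵣ

    V-T : V 3 T
    V-T = V-⋆ N V-nᵣ V-c

    θnᵣ-beyond : ∀ k → M ≤ k → θ nᵣ k ≡ 0ℚ
    θnᵣ-beyond k h = trans (cong (ι k *_) (nᵣ-beyond k h)) (ℚP.*-zeroʳ (ι k))

    M≤1+N : M ≤ suc N
    M≤1+N = ℕP.m≤n+m M 3

    V0-qᵣ : ∀ k → V 0 (qᵣ k)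
    V0-qᵣ k = V-≤ z≤n (V-qᵣ k)

    V0-n₂ : ∀ k → V 0 (n₂ k)
    V0-n₂ k = V-≤ z≤n (V-n₂ k)

    even-≥4 : ∀ {k} → Even k → 2 ≤ k → k ≢ 2 → 4 ≤ k
    even-≥4 (suc zero , refl) _ h = ⊥-elim (h refl)
    even-≥4 (suc (suc h) , refl) _ _ = s≤s (s≤s (s≤s (s≤s z≤n)))

    N∸ : ∀ {k} → k ≤ top → N ∸ k ≡ 2 ℕ.+ (M ∸ k)
    N∸ k≤top = ℕP.+-∸-assoc 2 (ℕP.≤-trans k≤top (ℕP.<⇒≤ top<M))

    N-even : Even N
    N-even = suc-odd (suc-even M-even)

    partner-≥4 : ∀ {k} → k ≤ top → 4 ≤ N ∸ k
    partner-≥4 {k} k≤top = subst (4 ≤_) (sym (N∸ k≤top)) (s≤s (s≤s (subst (_≤ M ∸ k) (trans (cong (_∸ top) (sym 2+top)) (ℕP.m+n∸n≡m 2 top)) (ℕP.∸-monoʳ-≤ M k≤top))))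

    partner-≤top : ∀ {k} → 4 ≤ k → N ∸ k ≤ top
    partner-≤top {k} 4≤k = subst (N ∸ k ≤_) (cong (_∸ 2) (sym 2+top)) (ℕP.∸-monoʳ-≤ N 4≤k)

    nᵣ-termwise : ∀ k {X Y} → V 0 X → V 0 Y → (Even k → 2 ≤ k → k ≤ top → X ≈[ 5 ] Y) → nᵣ k * X ≈[ 5 ] nᵣ k * Y
    nᵣ-termwise k {X} {Y} vX vY h = split (even⊎odd k)
      where
      split : Even k ⊎ Odd k → nᵣ k * X ≈[ 5 ] nᵣ k * Y
      split (inj₂ o) = mk≈ (V-- (V-*ʳ (nᵣ-odd o) vX) (V-*ʳ (nᵣ-odd o) vY))
      split (inj₁ e) = restrict-elim {λ t → t * X ≈[ 5 ] t * Y} n k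
        (≈-reflexive (trans (ℚP.*-zeroˡ X) (sym (ℚP.*-zeroˡ Y)))) (λ u v → ≈-*ˡ (V0-n k) (h e u v))

    2≤top : 2 ≤ top
    2≤top = ℕP.≤-trans (ℕP.m≤m+n 2 6) 8≤top

    4≤top : 4 ≤ top
    4≤top = ℕP.≤-trans (ℕP.m≤m+n 4 4) 8≤top

    2<M : 2 < M
    2<M = ≤M 3

    -- The convolution theorem for y · y². The indices 0 and 1 stand apart, k = 2 meets n₂ M ≡ n₂ 0,
    -- and the other even indices form `W`.
    n₃-2 : ι M * n₃ 2 ≈[ 5 ] n 0 * n₂ 2 + n 1 * n₂ 1 + (n 2 * n₂ 0 + W)
    n₃-2 = ≈-trans (hat-product y y² 2 Int-y Int-y²) (≈-trans (circular (λ k → n₂ (2 ℕ.+ (M ∸ k))) (λ k → V0-n₂ (2 ℕ.+ (M ∸ k))))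
        (≈-+ (≈-+ (≈-*ˡ (V0-n 0) (n₂-periodic 2)) (≈-*ˡ (V0-n 1) (≈-trans (≈-reflexive (cong n₂ (index-1 2 (s≤s z≤n)))) (n₂-periodic 1))))
          (≈-trans (≈-∑ M {g = λ k → nᵣ k * (α k + qᵣ (N ∸ k))} (λ k _ → nᵣ-termwise k (V0-n₂ (2 ℕ.+ (M ∸ k))) (V-+ (V-select (k ℕ.≟ 2) (V0-n₂ 0)) (V0-qᵣ (N ∸ k))) (step k)))
            (≈-reflexive (trans (∑-cong M (λ k _ → ℚP.*-distribˡ-+ (nᵣ k) (α k) (qᵣ (N ∸ k)))) (trans (∑-+ M _ _)
              (cong₂ _+_ (trans (∑-select 2 M nᵣ (n₂ 0) 2<M) (cong (_* n₂ 0) (nᵣ-in ℕP.≤-refl 2≤top))) (sym (⋆-support qᵣ M N nᵣ-beyond M≤1+N)))))))))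
      where
      α : ℕ → ℚ
      α k = select (k ℕ.≟ 2) (n₂ 0)
      step : ∀ k → Even k → 2 ≤ k → k ≤ top → n₂ (2 ℕ.+ (M ∸ k)) ≈[ 5 ] α k + qᵣ (N ∸ k)
      step k e 2≤k k≤top = at (k ℕ.≟ 2)
        where
        at : Dec (k ≡ 2) → n₂ (2 ℕ.+ (M ∸ k)) ≈[ 5 ] α k + qᵣ (N ∸ k)
        at (yes refl) = ≈-trans (≈-trans (≈-reflexive (cong n₂ (ℕP.m+[n∸m]≡n {2} {M} (ℕP.<⇒≤ 2<M)))) (n₂-periodic 0))
          (≈-reflexive (sym (trans (cong₂ _+_ (select-yes (2 ℕ.≟ 2) {n₂ 0} refl) (qᵣ-high {N ∸ 2} top<M)) (ℚP.+-identityʳ (n₂ 0)))))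
        at (no k≢2) = ≈-reflexive (sym (trans (cong₂ _+_ (select-no (k ℕ.≟ 2) k≢2) (trans (qᵣ-in (even-∸ N-even e) (partner-≥4 k≤top) (partner-≤top (even-≥4 e 2≤k k≢2))) (cong n₂ (N∸ k≤top))))
          (ℚP.+-identityˡ (n₂ (2 ℕ.+ (M ∸ k))))))

    c-M+M : c (M ℕ.+ M) ≡ 0ℚ
    c-M+M = c-high (M ℕ.+ M) (ℕP.+-mono-< top<M top<M)

    U-expand : ι M * U ≈[ 5 ] (+ 2 / 1) * n 0 * (θ nᵣ ⋆ nᵣ) N + (θ nᵣ ⋆ c) N + (θ nᵣ ⋆ c) (N ℕ.+ M) - ι 2 * n 2 * c M
    U-expand = ≈-trans (≈-reflexive (trans (cong (ι M *_) (⋆-support qᵣ M N θnᵣ-beyond M≤1+N)) (trans (sym (∑-*ˡ M (ι M) _))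
          (∑-cong M (λ k _ → solve 4 (λ m k n q → m :* (k :* n :* q) := k :* (n :* (m :* q))) refl (ι M) (ι k) (nᵣ k) (qᵣ (N ∸ k)))))))
      (≈-trans (≈-∑ M {g = λ k → ι k * (nᵣ k * Y k)} (λ k _ → ≈-*ˡ (V-ι k) (nᵣ-termwise k (V-*ˡ (V-ι M) (V0-qᵣ (N ∸ k))) (V-Y k) (step k))))
        (≈-reflexive (trans (∑-cong M (λ k _ → solve 7 (λ k n a x y z s → k :* (n :* (a :* x :+ y :+ z :- s)) := a :* (k :* n :* x) :+ k :* n :* y :+ k :* n :* z :- k :* n :* s) refl
            (ι k) (nᵣ k) ((+ 2 / 1) * n 0) (nᵣ (N ∸ k)) (c (N ∸ k)) (c (N ∸ k ℕ.+ M)) (α k)))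
          (trans (∑-- M _ _) (cong₂ _-_ (trans (∑-+ M _ _) (cong₂ _+_ (trans (∑-+ M _ _) (cong₂ _+_
              (trans (∑-*ˡ M ((+ 2 / 1) * n 0) _) (cong ((+ 2 / 1) * n 0 *_) (sym (⋆-support nᵣ M N θnᵣ-beyond M≤1+N))))
              (sym (⋆-support c M N θnᵣ-beyond M≤1+N))))
              (trans (∑-cong M (λ k k<M → cong (λ t → θ nᵣ k * c t) (sym (ℕP.+-∸-comm M (ℕP.≤-trans (ℕP.<⇒≤ k<M) (ℕP.m≤n+m M 2))))))
                (sym (⋆-support c M (N ℕ.+ M) θnᵣ-beyond (ℕP.≤-trans M≤1+N (s≤s (ℕP.m≤m+n N M))))))))
            (trans (∑-select 2 M (θ nᵣ) (c M) 2<M) (cong (λ t → ι 2 * t * c M) (nᵣ-in ℕP.≤-refl 2≤top))))))))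
      where
      α Y : ℕ → ℚ
      -- For k = 2 the partner M lies outside the support of `qᵣ`, although `c M` need not vanish;
      -- this term corrects for it.
      α k = select (k ℕ.≟ 2) (c M)
      Y k = (+ 2 / 1) * n 0 * nᵣ (N ∸ k) + c (N ∸ k) + c (N ∸ k ℕ.+ M) - α k
      V-2 : V 0 (+ 2 / 1)
      V-2 = V-ι 2
      V0-c : ∀ k → V 0 (c k)
      V0-c k = V-≤ z≤n (V-c k)
      V-Y : ∀ k → V 0 (Y k)
      V-Y k = V-- (V-+ (V-+ (V-*ˡ (V-*ˡ V-2 (V0-n 0)) (V0-nᵣ (N ∸ k))) (V0-c (N ∸ k))) (V0-c (N ∸ k ℕ.+ M))) (V-select (k ℕ.≟ 2) (V0-c M))
      step : ∀ k → Even k → 2 ≤ k → k ≤ top → ι M * qᵣ (N ∸ k) ≈[ 5 ] Y k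
      step k e 2≤k k≤top = at (k ℕ.≟ 2)
        where
        at : Dec (k ≡ 2) → ι M * qᵣ (N ∸ k) ≈[ 5 ] Y k
        at (yes refl) = ≈-reflexive (trans (cong (ι M *_) (qᵣ-high {M} top<M)) (trans
          (solve 3 (λ m a g → m :* con 0ℚ := a :* con 0ℚ :+ g :+ con 0ℚ :- g) refl (ι M) ((+ 2 / 1) * n 0) (c M))
          (sym (cong₂ (λ s t → (+ 2 / 1) * n 0 * s + c M + t - α 2) (restrict-high n {M} top<M) c-M+M))))
        at (no k≢2) = ≈-trans (≈-reflexive (cong (ι M *_) (qᵣ-in em 4≤m m≤top))) (≈-trans (n₂-even (N ∸ k) em 4≤m m≤top)
          (≈-reflexive (sym (trans (cong (_-_ ((+ 2 / 1) * n 0 * nᵣ (N ∸ k) + c (N ∸ k) + c (N ∸ k ℕ.+ M))) (select-no (k ℕ.≟ 2) k≢2)) (ℚP.+-identityʳ _)))))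
          where
          em = even-∸ N-even e
          4≤m = partner-≥4 k≤top
          m≤top = partner-≤top (even-≥4 e 2≤k k≢2)

    -- The wrapped part has degree N + M = 2p, so removing the weight with `θ-cube` produces an
    -- additional factor p.
    X₂-V : V 4 ((θ nᵣ ⋆ c) (N ℕ.+ M))
    X₂-V = V-cancel {n = 3} (>⇒∤ (≤p 4)) (V-resp (trans (cong (_* (nᵣ ⋆ c) (N ℕ.+ M)) (sym ι2p)) (θ-cube (N ℕ.+ M) nᵣ))
        (V-* (V-*ˡ (V-ι 2) V-p) (V-⋆ (N ℕ.+ M) V-nᵣ V-c)))
      where
      ι2p : ι (N ℕ.+ M) ≡ ι 2 * P
      ι2p = trans (ι-+ N M) (trans (cong₂ _+_ ιN ιM) (solve 1 (λ x → x :+ con 1ℚ :+ (x :- con 1ℚ) := con (ι 2) :* x) refl P))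

    -- `n₂-even` turns (p-1) U into convolutions of `nᵣ` alone. At degree p + 1 the weights become
    -- (p+1)/2 and (p+1)/3, and products of p with terms of order 3 are dropped.
    U-≈ : U ≈[ 4 ] - (n 0 * c N) - (+ 1 / 3) * T + (+ 2 / 1) * n 2 * c M
    U-≈ = mk≈ (V-resp (trans (cong₂ (λ s t → P * U - P * n 0 * c N - (+ 1 / 3) * P * T - X₃ - (s * U - ((+ 2 / 1) * n 0 * X₁ + X₂ + X₃ - t))) ιM refl)
          (trans (solve 9 (λ p u n d t n₂ g x z → p :* u :- p :* n :* d :- con (+ 1 / 3) :* p :* t :- z :- ((p :- con 1ℚ) :* u :- (con (+ 2 / 1) :* n :* x :+ g :+ z :- n₂))
                 := u :+ n :* (con (+ 2 / 1) :* x) :+ con (+ 1 / 3) :* (con (+ 3 / 1) :* g) :- p :* n :* d :- con (+ 1 / 3) :* p :* t :- n₂) refl P U (n 0) (c N) T (ι 2 * n 2 * c M) X₂ X₁ X₃)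
            (trans (cong₂ (λ s t → U + n 0 * s + (+ 1 / 3) * t - P * n 0 * c N - (+ 1 / 3) * P * T - ι 2 * n 2 * c M)
                (trans (sym (θ-square N nᵣ)) (cong (_* c N) ιN)) (trans (sym (θ-cube N nᵣ)) (cong (_* T) ιN)))
              (solve 7 (λ p u n d t n₂ g → u :+ n :* ((p :+ con 1ℚ) :* d) :+ con (+ 1 / 3) :* ((p :+ con 1ℚ) :* t) :- p :* n :* d :- con (+ 1 / 3) :* p :* t :- con (ι 2) :* n₂ :* g
                := u :- (:- (n :* d) :- con (+ 1 / 3) :* t :+ con (+ 2 / 1) :* n₂ :* g)) refl P U (n 0) (c N) T (n 2) (c M)))))
        (V-- (V-- (V-- (V-- (V-* V-p V-U) (V-*ʳ' (V-* V-p (V-n 0)) (V-c N))) (V-third (V-* V-p V-T))) X₂-V) (V-≤ (ℕP.m≤m+n 4 1) (diff U-expand))))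
      where
      X₁ = (θ nᵣ ⋆ nᵣ) N
      X₂ = (θ nᵣ ⋆ c) N
      X₃ = (θ nᵣ ⋆ c) (N ℕ.+ M)
      V-*ʳ' : ∀ {x y} → V 2 x → V 2 y → V 4 (x * y)
      V-*ʳ' = V-*
      V-third : ∀ {x} → V 4 (P * x) → V 4 ((+ 1 / 3) * P * x)
      V-third {x} v = V-resp (sym (ℚP.*-assoc (+ 1 / 3) P x)) (V-*ˡ (V-recip< 3 (≤p 4)) v)

  -- Bernoulli numbers in terms of moments

  sumFT-*ˡ : ∀ lo hi x g → sumFT lo hi (λ i → x * g i) ≡ x * sumFT lo hi g
  sumFT-*ˡ lo hi x g = trans (sumFT≡∑ lo hi (λ i → x * g i)) (trans (∑-*ˡ (suc hi ∸ lo) x (λ i → g (lo ℕ.+ i))) (cong (x *_) (sym (sumFT≡∑ lo hi g))))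

  ∑-support : ∀ lo hi n (f g : ℕ → ℚ) → lo ≤ suc hi → hi ≤ n → (∀ i → i < lo → f i ≡ 0ℚ) → (∀ i → hi < i → i ≤ n → f i ≡ 0ℚ) →
    (∀ i → lo ≤ i → i ≤ hi → f i ≡ g i) → ∑ (suc n) f ≡ sumFT lo hi g
  ∑-support lo hi n f g lo≤ hi≤n low high mid = trans (cong (λ t → ∑ t f) (sym (ℕP.m+[n∸m]≡n (s≤s hi≤n))))
    (trans (∑-split (suc hi) (n ∸ hi) f) (trans (cong₂ _+_ below above) (trans (ℚP.+-identityʳ _) (sym (sumFT≡∑ lo hi g)))))
    where
    above : ∑ (n ∸ hi) (λ i → f (suc hi ℕ.+ i)) ≡ 0ℚ
    above = trans (∑-cong (n ∸ hi) (λ i h → high (suc hi ℕ.+ i) (s≤s (ℕP.m≤m+n hi i))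
      (subst (suc hi ℕ.+ i ≤_) (ℕP.m+[n∸m]≡n hi≤n) (subst (_≤ hi ℕ.+ (n ∸ hi)) (ℕP.+-suc hi i) (ℕP.+-monoʳ-≤ hi h))))) (∑-0 (n ∸ hi))
    below : ∑ (suc hi) f ≡ ∑ (suc hi ∸ lo) (λ i → g (lo ℕ.+ i))
    below = trans (cong (λ t → ∑ t f) (sym (ℕP.m+[n∸m]≡n lo≤))) (trans (∑-split lo (suc hi ∸ lo) f)
      (trans (cong₂ _+_ (trans (∑-cong lo low) (∑-0 lo)) (∑-cong (suc hi ∸ lo) (λ i h → mid (lo ℕ.+ i) (ℕP.m≤m+n lo i)
        (ℕ.s≤s⁻¹ (subst (suc (lo ℕ.+ i) ≤_) (ℕP.m+[n∸m]≡n lo≤) (subst (_≤ lo ℕ.+ (suc hi ∸ lo)) (ℕP.+-suc lo i) (ℕP.+-monoʳ-≤ lo h)))))))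
        (ℚP.+-identityˡ _)))

  module Bernoulli (p : ℕ) (pp : Prime p) (11≤p : 11 ≤ p) where
    open Congruences p pp 11≤p public

    V1-pB : ∀ j → 0 < j → V 1 (s j) → V 1 (P * B j)
    V1-pB j 0<j vs = ≈⇒V (≈-sym (powerSum-≈1 j)) (≈⇒V (≈-≤ (s≤s z≤n) (powerSum-moments j 0<j))
      (V-poly (vs ∷ V-ι j ∷ V-n j ∷ V-n₂ j ∷ V-n₃ j ∷ V-n₄ j ∷ []) 1
        momentsᵖ refl))

    -- The two expansions of ∑ aᵏ compared and divided by k. The condition on s (k-2) disposes of
    -- the quadratic Faulhaber term; y³ is beyond the precision.
    𝓑-≈ : ∀ k → Even k → 4 ≤ k → ¬ p ∣ k → V 3 (s k) → V 1 (s (k ∸ 2)) → P * 𝓑 k ≈[ 3 ] n k + (+ 1 / 2) * (ι k - 1ℚ) * n₂ k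
    𝓑-≈ k@(suc _) e 4≤k p∤k vs vs′ = mk≈ (V-cancel {n = k} p∤k (V-resp
        (trans (cong (_- ι k * X) (trans (sym (ℚP.*-identityʳ (P * B k))) (trans (cong (P * B k *_) (sym (ι-recip k)))
          (solve 4 (λ p b k r → p :* b :* (k :* r) := k :* (p :* (b :* r))) refl P (B k) (ι k) (recipℕ k)))))
          (solve 3 (λ k a x → k :* a :- k :* x := k :* (a :- x)) refl (ι k) (P * 𝓑 k) X))
        (diff (≈-trans (≈-sym (powerSum-≈3 k e 4≤k (V1-pB (k ∸ 2) (ℕP.m<n⇒0<n∸m (ℕP.≤-trans (s≤s (s≤s (s≤s z≤n))) 4≤k)) vs′)))
          (≈-trans (≈-≤ (ℕP.m≤m+n 3 2) (powerSum-moments k (s≤s z≤n)))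
            (≈-poly (vs ∷ V-ι k ∷ V-n k ∷ V-n₂ k ∷ V-n₃ k ∷ V-n₄ k ∷ []) 3
              momentsᵖ
              (λ s κ a b d e → κ :* (a :+ con (+ 1 / 2) :* (κ :- con 1ℚ) :* b)) refl))))))
      where X = n k + (+ 1 / 2) * (ι k - 1ℚ) * n₂ k

    2<p : 2 < p
    2<p = ≤p 3

    -- At exponent 2 the binomial expansion stops at y², so `n₃` and `n₄` enter with coefficient 0.
    n-2 : n 2 ≈[ 5 ] (+ 1 / 2) * ((+ 1 / 6) * P * (P - 1ℚ) * ((+ 2 / 1) * P - 1ℚ) - n₂ 2)
    n-2 = mk≈ (V-cancel {n = 2} (>⇒∤ 2<p) (V-resp
        (trans (cong (λ t → - ((t - momentSum (ι 2) 2) + s 2)) powerSum-2)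
          (solve 6 (λ S s n a b d → :- ((S :- (s :+ con (ι 2) :* n :+ con (+ 1 / 2) :* con (ι 2) :* a :+ con 0ℚ :* b :+ con 0ℚ :* d)) :+ s) := con (ι 2) :* (n :- con (+ 1 / 2) :* (S :- a))) refl
            ((+ 1 / 6) * P * (P - 1ℚ) * ((+ 2 / 1) * P - 1ℚ)) (s 2) (n 2) (n₂ 2) (n₃ 2) (n₄ 2)))
        (V-neg (V-+ (diff (powerSum-moments 2 (s≤s z≤n))) (s-vanish 2 (s≤s z≤n) 2<M)))))

    M<p : M < p
    M<p = subst (M <_) (sym p≡1+M) ℕP.≤-refl

    top<p : top < p
    top<p = ℕP.<-trans top<M M<p

    p∤ : ∀ {k} → 0 < k → k ≤ top → ¬ p ∣ k
    p∤ 0<k k≤top = >⇒∤ {{ℕ.>-nonZero 0<k}} (ℕP.≤-<-trans k≤top top<p)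

    𝓑-≈-mid : ∀ k → Even k → 4 ≤ k → k ≤ top → P * 𝓑 k ≈[ 3 ] n k + (+ 1 / 2) * (ι k - 1ℚ) * n₂ k
    𝓑-≈-mid k e 4≤k k≤top = 𝓑-≈ k e 4≤k (p∤ 0<k k≤top) (V-≤ (ℕP.m≤m+n 3 2) (s-vanish k 0<k k<M))
        (V-≤ (s≤s z≤n) (s-vanish (k ∸ 2) (ℕP.m<n⇒0<n∸m (ℕP.≤-trans (s≤s (s≤s (s≤s z≤n))) 4≤k)) (ℕP.≤-<-trans (ℕP.m∸n≤m k 2) k<M)))
      where
      0<k : 0 < k
      0<k = ℕP.≤-trans (s≤s z≤n) 4≤k
      k<M : k < M
      k<M = ℕP.≤-<-trans k≤top top<M

    -- `h` is `P𝓑` to third order expressed in moments, and `ε` its part of order 2.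
    ε h : ℕ → ℚ
    ε i = (+ 1 / 2) * (ι i - 1ℚ) * qᵣ i
    h i = nᵣ i + ε i

    V-½ : V 0 (+ 1 / 2)
    V-½ = V-recip< 2 2<p

    V-ε : ∀ i → V 2 (ε i)
    V-ε i = V-*ˡ (V-*ˡ V-½ (V-- (V-ι i) (V-ι 1))) (V-qᵣ i)

    V-h : ∀ i → V 1 (h i)
    V-h i = V-+ (V-nᵣ i) (V-≤ (s≤s z≤n) (V-ε i))

    h-zero : ∀ {i} → nᵣ i ≡ 0ℚ → qᵣ i ≡ 0ℚ → h i ≡ 0ℚ
    h-zero {i} a b = trans (cong₂ (λ s t → s + (+ 1 / 2) * (ι i - 1ℚ) * t) a b) (trans (ℚP.+-identityˡ _) (ℚP.*-zeroʳ ((+ 1 / 2) * (ι i - 1ℚ))))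

    -- The index 2 is exempt: B 1 ≠ 0 adds a linear Faulhaber term at exponent 2, so the formula of
    -- `𝓑-≈` fails there.
    bᵣ-≈3 : ∀ i → i ≢ 2 → bᵣ i ≈[ 3 ] h i
    bᵣ-≈3 i i≢2 = zones (2 ≤? i) (i ≤? top) (even⊎odd i)
      where
      zones : Dec (2 ≤ i) → Dec (i ≤ top) → Even i ⊎ Odd i → bᵣ i ≈[ 3 ] h i
      zones (no l) _ _ = ≈-reflexive (trans (restrict-low P𝓑 (ℕP.≰⇒> l)) (sym (h-zero (restrict-low n (ℕP.≰⇒> l)) (qᵣ-low (ℕP.<-trans (ℕP.≰⇒> l) (ℕP.m≤m+n 3 1))))))
      zones (yes _) (no r) _ = ≈-reflexive (trans (restrict-high P𝓑 (ℕP.≰⇒> r)) (sym (h-zero (restrict-high n (ℕP.≰⇒> r)) (qᵣ-high (ℕP.≰⇒> r)))))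
      zones (yes u) (yes v) (inj₁ e) = ≈-trans (≈-reflexive (restrict-in P𝓑 u v)) (≈-trans (𝓑-≈-mid i e (even-≥4 e u i≢2) v)
        (≈-reflexive (sym (cong₂ (λ s t → s + (+ 1 / 2) * (ι i - 1ℚ) * t) (nᵣ-in u v) (qᵣ-in e (even-≥4 e u i≢2) v)))))
      zones (yes u) (yes v) (inj₂ o) = ≈-trans (≈-reflexive (trans (restrict-in P𝓑 u v) (trans (cong (λ t → P * (t * recipℕ i)) (B-odd′ o (odd-≥3 o u)))
          (solve 2 (λ a b → a :* (con 0ℚ :* b) := con 0ℚ) refl P (recipℕ i)))))
        (≈-sym (≈-trans (≈-reflexive (trans (cong (λ t → nᵣ i + (+ 1 / 2) * (ι i - 1ℚ) * t) (qᵣ-odd o)) (trans (cong (_+_ (nᵣ i)) (ℚP.*-zeroʳ ((+ 1 / 2) * (ι i - 1ℚ)))) (ℚP.+-identityʳ _))))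
          (V⇒≈0 (V-≤ (ℕP.m≤m+n 3 2) (nᵣ-odd o)))))

    h-≈ : ∀ i → h i ≈[ 2 ] nᵣ i
    h-≈ i = mk≈ (V-resp (solve 2 (λ a b → b := (a :+ b) :- a) refl (nᵣ i) (ε i)) (V-ε i))

    bᵣ-≈2 : ∀ i → bᵣ i ≈[ 2 ] nᵣ i
    bᵣ-≈2 i = at (i ℕ.≟ 2)
      where
      at : Dec (i ≡ 2) → bᵣ i ≈[ 2 ] nᵣ i
      at (no i≢2) = ≈-trans (≈-≤ (ℕP.m≤m+n 2 1) (bᵣ-≈3 i i≢2)) (h-≈ i)
      at (yes refl) = ≈-trans (≈-reflexive (restrict-in P𝓑 ℕP.≤-refl 2≤top)) (≈-sym (≈-trans (≈-reflexive (nᵣ-in ℕP.≤-refl 2≤top))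
        (≈-trans (≈-≤ (ℕP.m≤m+n 2 3) n-2) (≈-poly (V-p ∷ V-n₂ 2 ∷ []) 2
          (λ x q → con (+ 1 / 2) :* (con (+ 1 / 6) :* x :* (x :- con 1ℚ) :* (con (+ 2 / 1) :* x :- con 1ℚ) :- q)) (λ x q → x :* con (𝓑 2)) refl))))

    V-bᵣ : ∀ i → V 1 (bᵣ i)
    V-bᵣ i = ≈⇒V (≈-≤ (s≤s z≤n) (bᵣ-≈2 i)) (V-nᵣ i)

    ⋆-≈ : ∀ {k} f f′ g g′ m → (∀ i → i ≤ m → f i * g (m ∸ i) ≈[ k ] f′ i * g′ (m ∸ i)) → (f ⋆ g) m ≈[ k ] (f′ ⋆ g′) m
    ⋆-≈ f f′ g g′ m e = ≈-trans (≈-reflexive (⋆-∑ m f g)) (≈-trans (≈-∑ (suc m) (λ i i≤m → e i (ℕ.s≤s⁻¹ i≤m))) (≈-reflexive (sym (⋆-∑ m f′ g′))))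

    -- If each factor is known to one order beyond its own, so is the product: the error of one
    -- factor is multiplied by the order of the other.
    ≈-*-weighted : ∀ {a b x x′ y y′} → V b y → V a x′ → x ≈[ suc a ] x′ → y ≈[ suc b ] y′ → x * y ≈[ suc (a ℕ.+ b) ] x′ * y′
    ≈-*-weighted {a} {b} {x} {x′} {y} {y′} vy vx e f = ≈-trans (≈-*ʳ' e) (subst (λ t → x′ * y ≈[ t ] x′ * y′) (ℕP.+-suc a b) (≈-*ˡ vx f))
      where
      ≈-*ʳ' : x ≈[ suc a ] x′ → x * y ≈[ suc (a ℕ.+ b) ] x′ * y
      ≈-*ʳ' e = subst (λ t → x * y ≈[ t ] x′ * y) (trans (ℕP.+-suc b a) (cong suc (ℕP.+-comm b a))) (≈-*ʳ vy e)

    bb-≈ : ∀ m → (bᵣ ⋆ bᵣ) m ≈[ 3 ] c m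
    bb-≈ m = ⋆-≈ bᵣ nᵣ bᵣ nᵣ m (λ i _ → ≈-*-weighted (V-bᵣ (m ∸ i)) (V-nᵣ i) (bᵣ-≈2 i) (bᵣ-≈2 (m ∸ i)))

    V-bb : ∀ m → V 2 ((bᵣ ⋆ bᵣ) m)
    V-bb m = V-⋆ m V-bᵣ V-bᵣ

    bbb-≈ : (bᵣ ⋆ (bᵣ ⋆ bᵣ)) N ≈[ 4 ] T
    bbb-≈ = ⋆-≈ bᵣ nᵣ (bᵣ ⋆ bᵣ) c N (λ i _ → ≈-*-weighted (V-bb (N ∸ i)) (V-nᵣ i) (bᵣ-≈2 i) (bb-≈ (N ∸ i)))

    -- Twice ε ⋆ n is (θq ⋆ n) - (q ⋆ n). Leibniz moves θ to the other factor, giving (N - 1) W - U,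
    -- and N - 1 = p.
    hh : (h ⋆ h) N ≡ c N + (P * W - U) + (ε ⋆ ε) N
    hh = trans (⋆-addˡ N nᵣ ε h) (trans (cong₂ _+_ (trans (⋆-comm N nᵣ h) (⋆-addˡ N nᵣ ε nᵣ)) (trans (⋆-comm N ε h) (⋆-addˡ N nᵣ ε ε)))
      (trans (cong (λ t → c N + (ε ⋆ nᵣ) N + (t + (ε ⋆ ε) N)) (⋆-comm N nᵣ ε))
      (trans (cong (λ t → c N + t + (t + (ε ⋆ ε) N)) εn)
        (solve 3 (λ a x e → a :+ con (+ 1 / 2) :* x :+ (con (+ 1 / 2) :* x :+ e) := a :+ x :+ e) refl (c N) (P * W - U) ((ε ⋆ ε) N)))))
      where
      θqn : (θ qᵣ ⋆ nᵣ) N ≡ (P + 1ℚ) * W - U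
      θqn = trans (solve 2 (λ a b → a := (b :+ a) :- b) refl ((θ qᵣ ⋆ nᵣ) N) U) (cong (_- U) (sym (trans (cong (_* W) (sym ιN)) (trans (θ-⋆ N nᵣ qᵣ) (cong (_+_ U) (⋆-comm N nᵣ (θ qᵣ)))))))
      εn : (ε ⋆ nᵣ) N ≡ (+ 1 / 2) * (P * W - U)
      εn = trans (⋆-cong N {g = nᵣ} (λ i → solve 2 (λ k q → con (+ 1 / 2) :* (k :- con 1ℚ) :* q := con (+ 1 / 2) :* (k :* q) :+ con (- (+ 1 / 2)) :* q) refl (ι i) (qᵣ i)) (λ _ → refl))
        (trans (⋆-linearˡ N (+ 1 / 2) (θ qᵣ) (λ i → - (+ 1 / 2) * qᵣ i) nᵣ)
          (trans (cong₂ (λ s t → (+ 1 / 2) * s + t) θqn (trans (⋆-scaleˡ N (- (+ 1 / 2)) qᵣ nᵣ) (cong (- (+ 1 / 2) *_) (⋆-comm N qᵣ nᵣ))))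
            (solve 3 (λ p w u → con (+ 1 / 2) :* ((p :+ con 1ℚ) :* w :- u) :+ con (- (+ 1 / 2)) :* w := con (+ 1 / 2) :* (p :* w :- u)) refl P W U)))

    -- The exempt index 2 is paired with M at degree `N`, where both restricted sequences vanish.
    τ-≈ : (bᵣ ⋆ bᵣ) N ≈[ 4 ] c N - U
    τ-≈ = ≈-trans (⋆-≈ bᵣ h bᵣ h N step) (≈-trans (≈-reflexive hh) (mk≈ (V-resp
        (solve 4 (λ d x u e → x :+ e := d :+ (x :- u) :+ e :- (d :- u)) refl (c N) (P * W) U ((ε ⋆ ε) N)) (V-+ (V-* V-p V-W) (V-⋆ N V-ε V-ε)))))
      where
      bM hM : _
      bM = restrict-high P𝓑 top<M
      hM = h-zero (restrict-high n top<M) (qᵣ-high top<M)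
      step : ∀ i → i ≤ N → bᵣ i * bᵣ (N ∸ i) ≈[ 4 ] h i * h (N ∸ i)
      step i i≤N = at (i ℕ.≟ 2) (N ∸ i ℕ.≟ 2)
        where
        at : Dec (i ≡ 2) → Dec (N ∸ i ≡ 2) → bᵣ i * bᵣ (N ∸ i) ≈[ 4 ] h i * h (N ∸ i)
        at (yes refl) _ = ≈-reflexive (trans (cong (bᵣ 2 *_) bM) (trans (ℚP.*-zeroʳ (bᵣ 2)) (sym (trans (cong (h 2 *_) hM) (ℚP.*-zeroʳ (h 2))))))
        at (no _) (yes eq) = ≈-reflexive (subst (λ j → bᵣ j * bᵣ (N ∸ i) ≡ h j * h (N ∸ i)) (sym i≡M)
            (trans (cong (_* bᵣ (N ∸ i)) bM) (trans (ℚP.*-zeroˡ (bᵣ (N ∸ i))) (sym (trans (cong (_* h (N ∸ i)) hM) (ℚP.*-zeroˡ (h (N ∸ i))))))))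
          where
          i≡M : i ≡ M
          i≡M = trans (sym (ℕP.m∸[m∸n]≡n i≤N)) (cong (N ∸_) eq)
        at (no a) (no b) = ≈-trans (≈-*ʳ (V-bᵣ (N ∸ i)) (bᵣ-≈3 i a)) (≈-*ˡ (V-h i) (bᵣ-≈3 (N ∸ i) b))

    𝓒-conv : ∀ m → 4 ≤ m → m ≤ M → P * P * 𝓒 m ≡ (bᵣ ⋆ bᵣ) m
    𝓒-conv m 4≤m m≤M = sym (trans (⋆-∑ m bᵣ bᵣ) (trans (∑-support 2 (m ∸ 2) m (λ i → bᵣ i * bᵣ (m ∸ i)) (λ i → P * P * (𝓑 i * 𝓑 (m ∸ i)))
        (ℕP.≤-trans (ℕP.∸-monoˡ-≤ 2 4≤m) (ℕP.n≤1+n _)) (ℕP.m∸n≤m m 2)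
        (λ i i<2 → trans (cong (_* bᵣ (m ∸ i)) (restrict-low P𝓑 i<2)) (ℚP.*-zeroˡ (bᵣ (m ∸ i))))
        (λ i lt i≤m → trans (cong (bᵣ i *_) (restrict-low P𝓑 (ℕP.m<n+o⇒m∸n<o m i {2} (subst (m <_) (ℕP.+-comm 2 i) (subst (_< 2 ℕ.+ i) (ℕP.m+[n∸m]≡n 2≤m) (ℕP.+-monoʳ-< 2 lt)))))) (ℚP.*-zeroʳ (bᵣ i)))
        (λ i 2≤i i≤ → trans (cong₂ _*_ (restrict-in P𝓑 2≤i (ℕP.≤-trans i≤ m-2≤top)) (restrict-in P𝓑 (ℕP.m+n≤o⇒m≤o∸n 2 (subst (2 ℕ.+ i ≤_) (ℕP.m+[n∸m]≡n 2≤m) (ℕP.+-monoʳ-≤ 2 i≤)))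
              (ℕP.≤-trans (ℕP.∸-monoʳ-≤ m 2≤i) m-2≤top)))
            (solve 3 (λ p a b → p :* a :* (p :* b) := p :* p :* (a :* b)) refl P (𝓑 i) (𝓑 (m ∸ i)))))
      (sumFT-*ˡ 2 (m ∸ 2) (P * P) (λ i → 𝓑 i * 𝓑 (m ∸ i)))))
      where
      2≤m = ℕP.≤-trans (s≤s (s≤s z≤n)) 4≤m
      m-2≤top : m ∸ 2 ≤ top
      m-2≤top = subst (m ∸ 2 ≤_) (cong (_∸ 2) (sym 2+top)) (ℕP.∸-monoˡ-≤ 2 m≤M)

    N≡1+p : N ≡ suc p
    N≡1+p = cong suc (sym p≡1+M)

    N-4 : N ∸ 4 ≡ top
    N-4 = cong (λ t → suc (suc t) ∸ 4) (sym 2+top)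

    -- The truncation at 4 is automatic: for i < 4 the partner exceeds p - 3 and lies outside the
    -- support of `bᵣ`.
    𝓣𝓒-conv : P * P * 𝓣𝓒4 p ≡ (bᵣ ⋆ bᵣ) N
    𝓣𝓒-conv = sym (trans (⋆-∑ N bᵣ bᵣ) (trans (∑-support 4 top N (λ i → bᵣ i * bᵣ (N ∸ i)) (λ i → P * P * (𝓑 i * 𝓑 (suc p ∸ i)))
        (ℕP.≤-trans 4≤top (ℕP.n≤1+n top)) (ℕP.≤-trans (ℕP.<⇒≤ top<M) (ℕP.m≤n+m M 2)) low
        (λ i lt _ → trans (cong (_* bᵣ (N ∸ i)) (restrict-high P𝓑 lt)) (ℚP.*-zeroˡ (bᵣ (N ∸ i))))
        (λ i 4≤i i≤ → trans (cong₂ _*_ (restrict-in P𝓑 (ℕP.≤-trans (s≤s (s≤s z≤n)) 4≤i) i≤) (restrict-in P𝓑 (ℕP.≤-trans (s≤s (s≤s z≤n)) (partner-≥4 i≤)) (partner-≤top 4≤i)))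
            (trans (solve 3 (λ p a b → p :* a :* (p :* b) := p :* p :* (a :* b)) refl P (𝓑 i) (𝓑 (N ∸ i))) (cong (λ t → P * P * (𝓑 i * 𝓑 (t ∸ i))) N≡1+p))))
      (sumFT-*ˡ 4 top (P * P) (λ i → 𝓑 i * 𝓑 (suc p ∸ i)))))
      where
      low : ∀ i → i < 4 → bᵣ i * bᵣ (N ∸ i) ≡ 0ℚ
      low i i<4 = trans (cong (bᵣ i *_) (restrict-high P𝓑 (subst (_< N ∸ i) N-4 (ℕP.∸-monoʳ-< {N} {4} {i} i<4 (ℕP.≤-trans (ℕP.≤-trans 4≤top (ℕP.<⇒≤ top<M)) (ℕP.m≤n+m M 2)))))) (ℚP.*-zeroʳ (bᵣ i))

    𝓣-conv : P * P * P * 𝓣 N ≡ (bᵣ ⋆ (bᵣ ⋆ bᵣ)) N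
    𝓣-conv = sym (trans (⋆-∑ N bᵣ (bᵣ ⋆ bᵣ)) (trans (∑-support 2 (N ∸ 4) N (λ i → bᵣ i * (bᵣ ⋆ bᵣ) (N ∸ i)) (λ i → P * P * P * (𝓑 i * 𝓒 (N ∸ i)))
        (subst (λ t → 2 ≤ suc t) (sym N-4) (ℕP.≤-trans 2≤top (ℕP.n≤1+n top))) (ℕP.m∸n≤m N 4)
        (λ i i<2 → trans (cong (_* (bᵣ ⋆ bᵣ) (N ∸ i)) (restrict-low P𝓑 i<2)) (ℚP.*-zeroˡ ((bᵣ ⋆ bᵣ) (N ∸ i))))
        (λ i lt _ → trans (cong (_* (bᵣ ⋆ bᵣ) (N ∸ i)) (restrict-high P𝓑 (subst (_< i) N-4 lt))) (ℚP.*-zeroˡ ((bᵣ ⋆ bᵣ) (N ∸ i))))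
        (λ i 2≤i i≤ → trans (cong₂ _*_ (restrict-in P𝓑 2≤i (subst (i ≤_) N-4 i≤)) (sym (𝓒-conv (N ∸ i) (partner-≥4 (subst (i ≤_) N-4 i≤)) (ℕP.∸-monoʳ-≤ N 2≤i))))
            (solve 3 (λ p a b → p :* a :* (p :* p :* b) := p :* p :* p :* (a :* b)) refl P (𝓑 i) (𝓒 (N ∸ i)))))
      (sumFT-*ˡ 2 (N ∸ 4) (P * P * P) (λ i → 𝓑 i * 𝓒 (N ∸ i)))))

  -- The factor `n` stands in front so that C(2p, 4) is visibly divisible by p.
  C-4 : ∀ n → 4 ≤ n → ι (n C 4) ≡ ι n * ((+ 1 / 24) * ι ((n ∸ 1) ℕ.* ((n ∸ 2) ℕ.* (n ∸ 3))))
  C-4 (suc (suc (suc (suc m)))) h = trans (ι-C h) (trans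
      (cong (_* (invFact 4 * invFact m)) (trans (ι-* N₀ (suc N₂ !)) (cong (ι N₀ *_) (trans (ι-* (suc N₂) (N₂ !)) (cong (ι (suc N₂) *_) (trans (ι-* N₂ (suc m !)) (cong (ι N₂ *_) (ι-* (suc m) (m !)))))))))
      (trans (solve 6 (λ a b c d f i → a :* (b :* (c :* (d :* f))) :* (con (invFact 4) :* i) := a :* (con (+ 1 / 24) :* (b :* (c :* d))) :* (f :* i)) refl (ι N₀) (ι (suc N₂)) (ι N₂) (ι (suc m)) (ι (m !)) (invFact m))
        (trans (cong (λ t → ι N₀ * ((+ 1 / 24) * (ι (suc N₂) * (ι N₂ * ι (suc m)))) * t) (fact-invFact m)) (trans (ℚP.*-identityʳ _)
          (cong (λ t → ι N₀ * ((+ 1 / 24) * t)) (sym (trans (ι-* (suc N₂) (N₂ ℕ.* suc m)) (cong (ι (suc N₂) *_) (ι-* N₂ (suc m))))))))))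
    where
    N₂ = suc (suc m)
    N₀ = suc (suc N₂)
  C-4 (suc zero) (s≤s ())
  C-4 (suc (suc zero)) (s≤s (s≤s ()))
  C-4 (suc (suc (suc zero))) (s≤s (s≤s (s≤s ())))

  -- The individual Bernoulli numbers of the statement

  module Values (p : ℕ) (pp : Prime p) (11≤p : 11 ≤ p) where
    open Bernoulli p pp 11≤p public

    PB-≈ : ∀ k → Even k → 4 ≤ k → ∀ κ → ι k ≡ κ → V 0 κ → s k ≈[ 5 ] P - 1ℚ → n k ≈[ 5 ] n 0 → P * B k ≈[ 2 ] P - 1ℚ + κ * n 0
    PB-≈ k e 4≤k κ refl vκ es en = ≈-trans (≈-sym (powerSum-≈2 k e 4≤k)) (≈-trans (≈-≤ (ℕP.m≤m+n 2 3) (powerSum-moments k (ℕP.≤-trans (s≤s z≤n) 4≤k)))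
      (≈-trans (≈-poly (V0-s k ∷ V-ι k ∷ V-n k ∷ V-n₂ k ∷ V-n₃ k ∷ V-n₄ k ∷ []) 2 momentsᵖ (λ s κ a b d e → s :+ κ :* a) refl)
        (≈-+ (≈-≤ (ℕP.m≤m+n 2 3) es) (≈-*ˡ (V-ι k) (≈-≤ (ℕP.m≤m+n 2 3) en)))))

    s-M′ : s M ≈[ 5 ] P - 1ℚ
    s-M′ = ≈-trans s-M (≈-reflexive ιM)

    PB-M : P * B M ≈[ 2 ] P - 1ℚ - n 0
    PB-M = ≈-trans (PB-≈ M M-even (≤M 4) (P - 1ℚ) ιM (V-- (V-≤ z≤n V-p) (V-ι 1)) s-M′ (n-periodic 0))
      (≈-poly (V-p ∷ V-n 0 ∷ []) 2 (λ x a → x :- con 1ℚ :+ (x :- con 1ℚ) :* a) (λ x a → x :- con 1ℚ :- a) refl)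

    ι-M+M : ι (M ℕ.+ M) ≡ (+ 2 / 1) * (P - 1ℚ)
    ι-M+M = trans (ι-+ M M) (trans (cong₂ _+_ ιM ιM) (solve 1 (λ x → x :+ x := con (+ 2 / 1) :* x) refl (P - 1ℚ)))

    V0-P : V 0 P
    V0-P = V-≤ z≤n V-p

    V0-P-1 : V 0 (P - 1ℚ)
    V0-P-1 = V-- V0-P (V-ι 1)

    PB-2M : P * B (M ℕ.+ M) ≈[ 2 ] P - 1ℚ - (+ 2 / 1) * n 0
    PB-2M = ≈-trans (PB-≈ (M ℕ.+ M) (even-+ M-even M-even) (ℕP.≤-trans (≤M 4) (ℕP.m≤m+n M M)) ((+ 2 / 1) * (P - 1ℚ)) ι-M+M (V-*ˡ (V-ι 2) V0-P-1)
        (≈-trans (s-periodic M) s-M′) (≈-trans (n-periodic M) (n-periodic 0)))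
      (≈-poly (V-p ∷ V-n 0 ∷ []) 2 (λ x a → x :- con 1ℚ :+ con (+ 2 / 1) :* (x :- con 1ℚ) :* a) (λ x a → x :- con 1ℚ :- con (+ 2 / 1) :* a) refl)

    n₃-periodic : ∀ k → n₃ (k ℕ.+ M) ≈[ 5 ] n₃ k
    n₃-periodic k = hat-periodic y³ k (λ a u v → V-≤ z≤n (V-y³ a u v))

    V-s2 : V 5 (s 2)
    V-s2 = s-vanish 2 (s≤s z≤n) 2<M

    6≤M : 6 ≤ M
    6≤M = ≤M 6

    index-p+1 : p ℕ.+ 1 ≡ N
    index-p+1 = trans (ℕP.+-comm p 1) (cong suc p≡1+M)

    ∤-p+ : ∀ j → 0 < j → j < p → ¬ p ∣ p ℕ.+ j
    ∤-p+ j 0<j j<p d = >⇒∤ {{ℕ.>-nonZero 0<j}} j<p (∣m+n∣m⇒∣n d ∣-refl)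

    unscale : ∀ k .{{_ : ℕ.NonZero k}} → P * B k ≡ ι k * (P * 𝓑 k)
    unscale k = trans (sym (ℚP.*-identityʳ (P * B k))) (trans (cong (P * B k *_) (sym (ι-recip k)))
      (solve 4 (λ p b k r → p :* b :* (k :* r) := k :* (p :* (b :* r))) refl P (B k) (ι k) (recipℕ k)))

    offset : ∀ x y → x ≡ y + (x - y)
    offset = solve 2 (λ x y → x := y :+ (x :- y)) refl

    move : ∀ {k S A B C} → S ≈[ k ] A + B + C → A ≈[ k ] S - B - C
    move {k} {S} {A} {B} {C} (mk≈ v) = mk≈ (V-resp (solve 4 (λ s a b c → :- (s :- (a :+ b :+ c)) := a :- (s :- b :- c)) refl S A B C) (V-neg v))

    private
      -- The polynomial part of `𝓑-p+1`, with every moment a variable and every congruence an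
      -- equation with an error term. Thus the certificate is evaluated without unfolding the sums
      -- themselves.
      core-p+1 : ∀ {A β S s′ a a′ q q′ r u t n₀ κ δA δS δa δq δβ} →
        V 5 s′ → V 1 a′ → V 2 q′ → V 3 r → V 4 u → V 4 t → V 1 n₀ → V 5 δA → V 5 δS → V 5 δa → V 5 δq → V 2 δβ →
        κ ≡ P + 1ℚ → a ≡ a′ + δa → q ≡ q′ + δq → β ≡ P - 1ℚ - n₀ + δβ →
        S ≡ s′ + κ * a + (+ 1 / 2) * (κ * (κ - 1ℚ)) * q + (+ 1 / 6) * (κ * (κ - 1ℚ) * (κ - (+ 2 / 1))) * r
          + (+ 1 / 24) * (κ * (κ - 1ℚ) * (κ - (+ 2 / 1)) * (κ - (+ 3 / 1))) * u + δS →
        A ≡ S - (+ 1 / 6) * (κ * (κ - 1ℚ)) * P * P * β - t + δA →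
        V 4 (A - κ * (a′ + (+ 1 / 2) * P * q′ + (+ 1 / 6) * P * P * P))
      core-p+1 v₁ v₂ v₃ v₄ v₅ v₆ v₇ w₁ w₂ w₃ w₄ w₅ refl refl refl refl refl refl =
        V-poly (V-p ∷ v₁ ∷ v₂ ∷ v₃ ∷ v₄ ∷ v₅ ∷ v₆ ∷ v₇ ∷ w₁ ∷ w₂ ∷ w₃ ∷ w₄ ∷ w₅ ∷ []) 4
          (λ P s a q r u t n₀ δA δS δa δq δβ → let κ = P :+ con 1ℚ in
            momentsᵖ s κ (a :+ δa) (q :+ δq) r u :+ δS :- con (+ 1 / 6) :* (κ :* (κ :- con 1ℚ)) :* P :* P :* (P :- con 1ℚ :- n₀ :+ δβ) :- t :+ δA
              :- κ :* (a :+ con (+ 1 / 2) :* P :* q :+ con (+ 1 / 6) :* P :* P :* P)) refl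

      core-2p : ∀ {A β S s′ a a′ q q′ r r′ u t n₀ κ δA δS δa δq δr δβ} →
        V 5 s′ → V 1 a′ → V 2 q′ → V 3 r′ → V 4 u → V 5 t → V 1 n₀ → V 5 δA → V 5 δS → V 5 δa → V 5 δq → V 5 δr → V 2 δβ →
        κ ≡ (+ 2 / 1) * P → a ≡ a′ + δa → q ≡ q′ + δq → r ≡ r′ + δr → β ≡ P - 1ℚ - (+ 2 / 1) * n₀ + δβ →
        S ≡ s′ + κ * a + (+ 1 / 2) * (κ * (κ - 1ℚ)) * q + (+ 1 / 6) * (κ * (κ - 1ℚ) * (κ - (+ 2 / 1))) * r
          + (+ 1 / 24) * (κ * (κ - 1ℚ) * (κ - (+ 2 / 1)) * (κ - (+ 3 / 1))) * u + δS →
        A ≡ S - (+ 1 / 6) * (κ * (κ - 1ℚ)) * P * P * β - t + δA →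
        V 5 (A - κ * (a′ + (+ 1 / 2) * ((+ 2 / 1) * P - 1ℚ) * q′ + (+ 1 / 3) * r′ - (+ 1 / 6) * ((+ 2 / 1) * P - 1ℚ) * P * P * (P - 1ℚ - (+ 2 / 1) * n₀)))
      core-2p v₁ v₂ v₃ v₄ v₅ v₆ v₇ w₁ w₂ w₃ w₄ w₅ w₆ refl refl refl refl refl refl refl =
        V-poly (V-p ∷ v₁ ∷ v₂ ∷ v₃ ∷ v₄ ∷ v₅ ∷ v₆ ∷ v₇ ∷ w₁ ∷ w₂ ∷ w₃ ∷ w₄ ∷ w₅ ∷ w₆ ∷ []) 5
          (λ P s a q r u t n₀ δA δS δa δq δr δβ → let κ = con (+ 2 / 1) :* P in
            momentsᵖ s κ (a :+ δa) (q :+ δq) (r :+ δr) u :+ δS :- con (+ 1 / 6) :* (κ :* (κ :- con 1ℚ)) :* P :* P :* (P :- con 1ℚ :- con (+ 2 / 1) :* n₀ :+ δβ) :- t :+ δA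
              :- κ :* (a :+ con (+ 1 / 2) :* (con (+ 2 / 1) :* P :- con 1ℚ) :* q :+ con (+ 1 / 3) :* r :- con (+ 1 / 6) :* (con (+ 2 / 1) :* P :- con 1ℚ) :* P :* P :* (P :- con 1ℚ :- con (+ 2 / 1) :* n₀))) refl

    -- p³/6 is the quadratic Faulhaber term: κ - 1 = p, and p B (p-1) ≡ -1 modulo p.
    𝓑-p+1 : P * 𝓑 N ≈[ 4 ] n 2 + (+ 1 / 2) * P * n₂ 2 + (+ 1 / 6) * P * P * P
    𝓑-p+1 = mk≈ (V-cancel {n = N} p∤N (V-resp (trans (cong (_- ι N * X) (unscale N)) (solve 3 (λ k a x → k :* a :- k :* x := k :* (a :- x)) refl (ι N) (P * 𝓑 N) X))
        (core-p+1 (≈⇒V (s-periodic 2) V-s2) (V-n 2) (V-n₂ 2) (V-n₃ N) (V-n₄ N) (V-term 4 N 0 (ℕP.m≤m+n 4 1)) (V-n 0)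
          (diff A≈) (diff S≈) (diff (n-periodic 2)) (diff (n₂-periodic 2)) (diff PB-M) ιN
          (offset (n N) (n 2)) (offset (n₂ N) (n₂ 2)) (offset (P * B M) (P - 1ℚ - n 0)) (offset (powerSum p N) (momentSum (ι N) N)) (offset (P * B N) Y))))
      where
      X = n 2 + (+ 1 / 2) * P * n₂ 2 + (+ 1 / 6) * P * P * P
      p∤N : ¬ p ∣ N
      p∤N = subst (λ t → ¬ p ∣ t) index-p+1 (∤-p+ 1 (s≤s z≤n) (≤p 2))
      Y = powerSum p N - (+ 1 / 6) * (ι N * (ι N - 1ℚ)) * P * P * (P * B M) - term N 4
      A≈ : P * B N ≈[ 5 ] Y
      A≈ = move (powerSum-≈5 N N-even (ℕP.≤-trans 6≤M (ℕP.m≤n+m M 2)))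
      S≈ = powerSum-moments N (s≤s z≤n)

    index-2p : p ℕ.+ p ≡ 2 ℕ.+ M ℕ.+ M
    index-2p = trans (cong₂ ℕ._+_ p≡1+M p≡1+M) (cong suc (ℕP.+-suc M M))

    K : ℕ
    K = 2 ℕ.+ M ℕ.+ M

    ιK : ι K ≡ (+ 2 / 1) * P
    ιK = trans (cong ι (sym index-2p)) (trans (ι-+ p p) (solve 1 (λ x → x :+ x := con (+ 2 / 1) :* x) refl P))

    K-even : Even K
    K-even = suc-odd (suc-even (even-+ M-even M-even))

    6≤K : 6 ≤ K
    6≤K = ℕP.≤-trans 6≤M (ℕP.m≤n+m M (2 ℕ.+ M))

    -- The weight gives p⁴ and the binomial coefficient C(2p, 4) the fifth factor.
    V-term-2p : V 5 (term K 4)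
    V-term-2p = V-*ʳ (V-* (V-resp (sym (trans (C-4 K (ℕP.≤-trans (ℕP.m≤m+n 4 2) 6≤K)) (cong (_* ((+ 1 / 24) * ι ((K ∸ 1) ℕ.* ((K ∸ 2) ℕ.* (K ∸ 3))))) ιK)))
        (V-*ʳ (V-*ˡ (V-ι 2) V-p) (V-*ˡ V-1/24 (V-ι ((K ∸ 1) ℕ.* ((K ∸ 2) ℕ.* (K ∸ 3))))))) (V-weight 4 0 (ℕP.m≤m+n 4 1))) (V-pB (K ∸ 4))
      where
      V-1/24 : V 0 (+ 1 / 24)
      V-1/24 = value-loc [] 0 (con (+ 1 / 24)) refl

    -- All terms carry κ = 2p, so the congruence modulo p⁵ is divided by 2p. The third moment
    -- survives with (κ-1)(κ-2)/6 ≡ 1/3.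
    𝓑-2p : P * 𝓑 K ≈[ 4 ] n 2 + (+ 1 / 2) * ((+ 2 / 1) * P - 1ℚ) * n₂ 2 + (+ 1 / 3) * n₃ 2 - (+ 1 / 6) * ((+ 2 / 1) * P - 1ℚ) * P * P * (P - 1ℚ - (+ 2 / 1) * n 0)
    𝓑-2p = mk≈ (V-cancel {n = 2} (>⇒∤ 2<p) (V-cancel-p (V-resp
        (trans (cong (_- ι K * X) (unscale K)) (trans (cong (λ t → t * (P * 𝓑 K) - t * X) ιK) (solve 3 (λ k a x → con (+ 2 / 1) :* k :* a :- con (+ 2 / 1) :* k :* x := k :* (con (ι 2) :* (a :- x))) refl P (P * 𝓑 K) X)))
        (core-2p (≈⇒V (≈-trans (s-periodic N) (s-periodic 2)) V-s2) (V-n 2) (V-n₂ 2) (V-n₃ 2) (V-n₄ K) V-term-2p (V-n 0)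
          (diff A≈) (diff S≈) (diff n≈) (diff n₂≈) (diff n₃≈) (diff PB-2M) ιK
          (offset (n K) (n 2)) (offset (n₂ K) (n₂ 2)) (offset (n₃ K) (n₃ 2)) (offset (P * B (M ℕ.+ M)) (P - 1ℚ - (+ 2 / 1) * n 0)) (offset (powerSum p K) (momentSum (ι K) K)) (offset (P * B K) Y)))))
      where
      X = n 2 + (+ 1 / 2) * ((+ 2 / 1) * P - 1ℚ) * n₂ 2 + (+ 1 / 3) * n₃ 2 - (+ 1 / 6) * ((+ 2 / 1) * P - 1ℚ) * P * P * (P - 1ℚ - (+ 2 / 1) * n 0)
      Y = powerSum p K - (+ 1 / 6) * (ι K * (ι K - 1ℚ)) * P * P * (P * B (M ℕ.+ M)) - term K 4
      A≈ : P * B K ≈[ 5 ] Y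
      A≈ = move (powerSum-≈5 K K-even 6≤K)
      S≈ = powerSum-moments K (s≤s z≤n)
      n≈ = ≈-trans (n-periodic N) (n-periodic 2)
      n₂≈ = ≈-trans (n₂-periodic N) (n₂-periodic 2)
      n₃≈ = ≈-trans (n₃-periodic N) (n₃-periodic 2)

    index-p+3 : p ℕ.+ 3 ≡ 4 ℕ.+ M
    index-p+3 = trans (ℕP.+-comm p 3) (cong (3 ℕ.+_) p≡1+M)

    V-s4 : V 5 (s 4)
    V-s4 = s-vanish 4 (s≤s z≤n) (≤M 5)

    𝓑-p+3 : P * 𝓑 (4 ℕ.+ M) ≈[ 3 ] n 4 + (+ 1 / 2) * (P + (+ 2 / 1)) * n₂ 4
    𝓑-p+3 = ≈-trans (𝓑-≈ (4 ℕ.+ M) (even-+ (2 , refl) M-even) (ℕP.m≤m+n 4 M) (subst (λ t → ¬ p ∣ t) index-p+3 (∤-p+ 3 (s≤s z≤n) (≤p 4)))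
        (V-≤ (ℕP.m≤m+n 3 2) (≈⇒V (s-periodic 4) V-s4)) (V-≤ (s≤s z≤n) (≈⇒V (s-periodic 2) V-s2)))
      (≈-≤ (ℕP.m≤m+n 3 2) (≈-+ (n-periodic 4) (≈-trans (≈-*ˡ (V-*ˡ V-½ (V-- (V-ι (4 ℕ.+ M)) (V-ι 1))) (n₂-periodic 4))
        (≈-reflexive (cong (λ t → (+ 1 / 2) * t * n₂ 4) (trans (cong (_- 1ℚ) (trans (ι-+ 4 M) (cong (_+_ (ι 4)) ιM))) (solve 1 (λ x → con (ι 4) :+ (x :- con 1ℚ) :- con 1ℚ := x :+ con (+ 2 / 1)) refl P)))))))

    ιtop : ι top ≡ P - (+ 3 / 1)
    ιtop = ι-∸ {p} {3} (≤p 3)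

    V-s-top : V 5 (s top)
    V-s-top = s-vanish top (ℕP.≤-trans (s≤s z≤n) 8≤top) top<M

    V-s-top-2 : V 5 (s (top ∸ 2))
    V-s-top-2 = s-vanish (top ∸ 2) (ℕP.≤-trans (s≤s z≤n) (ℕP.∸-monoˡ-≤ 2 8≤top)) (ℕP.≤-<-trans (ℕP.m∸n≤m top 2) top<M)

    𝓑-p-3 : P * 𝓑 top ≈[ 3 ] n top + (+ 1 / 2) * (P - (+ 4 / 1)) * n₂ top
    𝓑-p-3 = ≈-trans (𝓑-≈-mid top top-even 4≤top ℕP.≤-refl) (≈-reflexive (cong (λ t → n top + (+ 1 / 2) * t * n₂ top)
      (trans (cong (_- 1ℚ) ιtop) (solve 1 (λ x → x :- con (+ 3 / 1) :- con 1ℚ := x :- con (+ 4 / 1)) refl P))))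

    index-2p-4 : p ℕ.+ p ∸ 4 ≡ top ℕ.+ M
    index-2p-4 = cong (_∸ 4) (trans index-2p (cong (λ t → suc (suc (t ℕ.+ M))) (sym 2+top)))

    p∤top+M : ¬ p ∣ top ℕ.+ M
    p∤top+M = subst (λ t → ¬ p ∣ t) (trans (sym (ℕP.+-∸-assoc p 4≤p)) index-2p-4)
      (∤-p+ (p ∸ 4) (ℕP.m<n⇒0<n∸m (≤p 5)) (ℕP.∸-monoʳ-< {p} {4} {0} (s≤s z≤n) 4≤p))
      where
      4≤p : 4 ≤ p
      4≤p = ≤p 4

    -- The index 2p - 4 is p - 3 shifted by a period, with another coefficient of `n₂ top`; in 2 𝓑
    -- (p-3) - 𝓑 (2p-4) the multiples of p in these coefficients cancel.
    𝓑-2p-4 : P * 𝓑 (top ℕ.+ M) ≈[ 3 ] n top + (+ 1 / 2) * ((+ 2 / 1) * P - (+ 5 / 1)) * n₂ top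
    𝓑-2p-4 = ≈-trans (𝓑-≈ (top ℕ.+ M) (even-+ top-even M-even) (ℕP.≤-trans 4≤top (ℕP.m≤m+n top M)) p∤top+M
        (V-≤ (ℕP.m≤m+n 3 2) (≈⇒V (s-periodic top) V-s-top))
        (V-≤ (s≤s z≤n) (≈⇒V (≈-trans (≈-reflexive (cong s (ℕP.+-∸-comm M 2≤top))) (s-periodic (top ∸ 2))) V-s-top-2)))
      (≈-≤ (ℕP.m≤m+n 3 2) (≈-+ (n-periodic top) (≈-trans (≈-*ˡ (V-*ˡ V-½ (V-- (V-ι (top ℕ.+ M)) (V-ι 1))) (n₂-periodic top))
        (≈-reflexive (cong (λ t → (+ 1 / 2) * t * n₂ top) (trans (cong (_- 1ℚ) (trans (ι-+ top M) (cong₂ _+_ ιtop ιM))) (solve 1 (λ x → x :- con (+ 3 / 1) :+ (x :- con 1ℚ) :- con 1ℚ := con (+ 2 / 1) :* x :- con (+ 5 / 1)) refl P)))))))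

    n-4 : n 4 ≈[ 3 ] - ((+ 1 / 120) * P) - (+ 3 / 2) * n₂ 4
    n-4 = mk≈ (V-resp (solve 3 (λ x a q → :- (x :* con (𝓑 4) :- (a :+ con (+ 1 / 2) :* (con (ι 4) :- con 1ℚ) :* q)) := a :- (:- (con (+ 1 / 120) :* x) :- con (+ 3 / 2) :* q)) refl P (n 4) (n₂ 4))
      (V-neg (diff (𝓑-≈-mid 4 (2 , refl) ℕP.≤-refl 4≤top))))

    n₂-top : n₂ top ≈[ 3 ] - ((+ 2 / 1) * n 0 * n top) - P * P * 𝓒 top
    n₂-top = mk≈ (V-resp (trans (cong (λ t → P * n₂ top - (t * n₂ top - (x + c top + 0ℚ)) - (c top - k)) ιM)
          (solve 6 (λ p q x c k y → p :* q :- ((p :- con 1ℚ) :* q :- (x :+ c :+ con 0ℚ)) :- (c :- k) := q :- (:- x :- k)) refl P (n₂ top) x (c top) k (n top)))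
        (V-- (V-- (V-* V-p (V-n₂ top)) (V-≤ (ℕP.m≤m+n 3 2) (diff relation))) (diff (≈-trans (≈-sym (bb-≈ top)) (≈-reflexive (sym (𝓒-conv top 4≤top (ℕP.<⇒≤ top<M))))))))
      where
      x = (+ 2 / 1) * n 0 * n top
      k = P * P * 𝓒 top
      relation : ι M * n₂ top ≈[ 5 ] x + c top + 0ℚ
      relation = ≈-trans (n₂-even top top-even 4≤top ℕP.≤-refl) (≈-reflexive (cong₂ (λ s t → (+ 2 / 1) * n 0 * s + c top + t) (nᵣ-in 2≤top ℕP.≤-refl)
        -- No wrapped pair exists: two indices of at most p - 3 cannot sum to 2p - 4.
        (c-high (top ℕ.+ M) (ℕP.+-monoʳ-< top top<M))))

  recip-↑ : ∀ a i .{{_ : ℕ.NonZero a}} → recipℕ (a ℕ.^ i) ≡ recipℕ a ↑ i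
  recip-↑ a zero = refl
  recip-↑ a (suc i) {{a≢0}} = trans (recip-* a (a ℕ.^ i) {{a≢0}} {{ℕP.m^n≢0 a i}}) (cong (recipℕ a *_) (recip-↑ a i))

  -- The double sum over Fermat quotients

  module DoubleSum (p : ℕ) (pp : Prime p) (11≤p : 11 ≤ p) where
    open Values p pp 11≤p public

    coef : ℕ → ℚ
    coef i = B i - (+ 2 / 1) * 𝓑 i

    -- B i - 2 𝓑 i = (i - 2) 𝓑 i: the difference of the statement is an index weight, which is how
    -- `U` arises.
    P-coef : ∀ i → 0 < i → P * coef i ≡ (ι i - (+ 2 / 1)) * P𝓑 i
    P-coef i@(suc _) _ = trans (solve 3 (λ p b c → p :* (b :- con (+ 2 / 1) :* c) := p :* b :- con (+ 2 / 1) :* (p :* c)) refl P (B i) (𝓑 i))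
      (trans (cong (_- (+ 2 / 1) * P𝓑 i) (unscale i)) (solve 2 (λ k x → k :* x :- con (+ 2 / 1) :* x := (k :- con (+ 2 / 1)) :* x) refl (ι i) (P𝓑 i)))

    -- Both factors p q of order 1 are known modulo p², so their square is known modulo p³, and the
    -- cofactor a^(2-i) is needed modulo p only.
    quotients : ∀ a i → 0 < a → a < p → i ≤ M → (recipℕ (a ℕ.^ i) * (ι a * ι a)) * ((P * fq p a) * (P * fq p a)) ≈[ 3 ] w a ↑ (2 ℕ.+ (M ∸ i)) * y² a
    quotients a@(suc _) i 0<a a<p i≤M = ≈-trans (≈-*ʳ (V-* V-f V-f) r≈) (≈-trans (≈-*ˡ V-lhs (≈-*-weighted V-f (V-neg (V-y a 0<a a<p)) (fermat-quotient a 0<a a<p) (fermat-quotient a 0<a a<p)))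
        (≈-trans (≈-*ʳ (V-* (V-neg (V-y a 0<a a<p)) (V-neg (V-y a 0<a a<p))) (≈-≤ (s≤s z≤n) (≈-*ʳ (V-*ˡ (V-w a) (V-w a)) (winv-w a i 0<a a<p i≤M))))
          (≈-reflexive (solve 3 (λ w v y → v :* (w :* w) :* (:- y :* :- y) := (w :* (w :* v)) :* (y :* y)) refl (w a) (w a ↑ (M ∸ i)) (y a)))))
      where
      V-f : V 1 (P * fq p a)
      V-f = ≈⇒V (≈-≤ (s≤s z≤n) (fermat-quotient a 0<a a<p)) (V-neg (V-y a 0<a a<p))
      V-lhs : V 0 (winv a ↑ i * (w a * w a))
      V-lhs = V-*ˡ (V0-↑ i (V-winv a a<p)) (V-*ˡ (V-w a) (V-w a))
      recip≈ : recipℕ a ≈[ 1 ] winv a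
      recip≈ = mk≈ (V-cancel {n = a} (>⇒∤ a<p) (V-resp
          (trans (cong₂ (λ s t → (w a - ι a) * winv a + (s - t)) (ι-recip a) (w-inverse a 0<a))
            (trans (solve 3 (λ w a v → (w :- a) :* v :+ (con 1ℚ :- con 1ℚ) := w :* v :- a :* v) refl (w a) (ι a) (winv a))
              (trans (cong (_- ι a * winv a) (trans (w-inverse a 0<a) (sym (ι-recip a)))) (solve 3 (λ a r v → a :* r :- a :* v := a :* (r :- v)) refl (ι a) (recipℕ a) (winv a)))))
          (V-+ (V-*ʳ (diff (w-≈ a)) (V-winv a a<p)) (V-resp (sym (cong₂ _-_ (ι-recip a) (w-inverse a 0<a))) V-0))))
      r≈ : recipℕ (a ℕ.^ i) * (ι a * ι a) ≈[ 1 ] winv a ↑ i * (w a * w a)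
      r≈ = ≈-trans (≈-*ʳ (V-*ˡ (V-ι a) (V-ι a)) (≈-trans (≈-reflexive (recip-↑ a i)) (≈-↑ i (V-recip< a a<p) (V-winv a a<p) recip≈)))
        (≈-*ˡ (V0-↑ i (V-winv a a<p)) (≈-* (V-ι a) (V-w a) (≈-sym (w-≈ a)) (≈-sym (w-≈ a))))

    -- The number p - 10 of indices in [6, p-5]; the index following them is 6 + L = p - 4, and 7 +
    -- L = p - 3.
    L : ℕ
    L = suc (p ∸ 5) ∸ 6

    p≡10+L : p ≡ 10 ℕ.+ L
    p≡10+L = trans (sym (ℕP.m+[n∸m]≡n {10} {p} (≤p 10))) (cong (10 ℕ.+_) (sym (ℕP.∸-+-assoc p 5 5)))

    top≡7+L : top ≡ 7 ℕ.+ L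
    top≡7+L = cong (_∸ 3) p≡10+L

    g : ℕ → ℚ
    g i = (ι i - (+ 2 / 1)) * (nᵣ i * qᵣ (N ∸ i))

    doubleSum : ℚ
    doubleSum = sumFT 1 (p ∸ 1) (λ a → sumFT 6 (p ∸ 5) (λ i → coef i * recipℕ (a ℕ.^ i)) * ((ι a * fq p a) * (ι a * fq p a)))

    regroup : P * P * P * doubleSum ≡
      ∑ L (λ j → ∑* (λ a → (P * coef (6 ℕ.+ j)) * ((recipℕ (a ℕ.^ (6 ℕ.+ j)) * (ι a * ι a)) * ((P * fq p a) * (P * fq p a)))))
    regroup = trans (cong (P * P * P *_) (sumFT≡∑ 1 (p ∸ 1) _)) (trans (sym (∑-*ˡ M (P * P * P) _))
      (trans (∑-cong M (λ i _ → inner (suc i))) (∑-swap M L _)))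
      where
      inner : ∀ a → P * P * P * (sumFT 6 (p ∸ 5) (λ i → coef i * recipℕ (a ℕ.^ i)) * ((ι a * fq p a) * (ι a * fq p a)))
        ≡ ∑ L (λ j → (P * coef (6 ℕ.+ j)) * ((recipℕ (a ℕ.^ (6 ℕ.+ j)) * (ι a * ι a)) * ((P * fq p a) * (P * fq p a))))
      inner a = trans (solve 4 (λ p s a f → p :* p :* p :* (s :* ((a :* f) :* (a :* f))) := s :* (p :* (a :* a) :* ((p :* f) :* (p :* f)))) refl P (sumFT 6 (p ∸ 5) (λ i → coef i * recipℕ (a ℕ.^ i))) (ι a) (fq p a))
        (trans (cong (_* (P * (ι a * ι a) * ((P * fq p a) * (P * fq p a)))) (sumFT≡∑ 6 (p ∸ 5) _))
          (trans (sym (∑-*ʳ L (λ j → coef (6 ℕ.+ j) * recipℕ (a ℕ.^ (6 ℕ.+ j))) (P * (ι a * ι a) * ((P * fq p a) * (P * fq p a)))))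
            (∑-cong L (λ j _ → solve 5 (λ p c r a f → c :* r :* (p :* a :* f) := p :* c :* (r :* a :* f)) refl P (coef (6 ℕ.+ j)) (recipℕ (a ℕ.^ (6 ℕ.+ j))) (ι a * ι a) ((P * fq p a) * (P * fq p a))))))

    doubleSum-g : P * P * P * doubleSum ≈[ 4 ] ∑ L (λ j → g (6 ℕ.+ j))
    doubleSum-g = ≈-trans (≈-reflexive regroup) (≈-∑ L step)
      where
      step : ∀ j → j < L → ∑* (λ a → (P * coef (6 ℕ.+ j)) * ((recipℕ (a ℕ.^ (6 ℕ.+ j)) * (ι a * ι a)) * ((P * fq p a) * (P * fq p a)))) ≈[ 4 ] g (6 ℕ.+ j)
      step j j<L = ≈-trans (≈-∑* {f = λ a → (P * coef i) * ((recipℕ (a ℕ.^ i) * (ι a * ι a)) * ((P * fq p a) * (P * fq p a)))} {g = λ a → (P * coef i) * (w a ↑ (2 ℕ.+ (M ∸ i)) * y² a)}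
            (λ a u v → ≈-*ˡ V-Pc (quotients a i u v (ℕP.≤-trans i≤top (ℕP.<⇒≤ top<M)))))
        (≈-trans (≈-reflexive (trans (∑-*ˡ M (P * coef i) _) (cong (_* n₂ (2 ℕ.+ (M ∸ i))) Pc≡)))
          (≈-trans (≈-*ʳ (V-n₂ (2 ℕ.+ (M ∸ i))) (≈-*ˡ V-i (bᵣ-≈2 i)))
            (≈-trans (≈-reflexive (ℚP.*-assoc (ι i - (+ 2 / 1)) (nᵣ i) (n₂ (2 ℕ.+ (M ∸ i)))))
              (≈-*ˡ V-i (≈-≤ (ℕP.m≤m+n 4 1) (nᵣ-termwise i (V0-n₂ (2 ℕ.+ (M ∸ i))) (V0-qᵣ (N ∸ i))
                (λ e _ _ → ≈-reflexive (sym (trans (qᵣ-in (even-∸ N-even e) (partner-≥4 i≤top) (partner-≤top {i} (s≤s (s≤s (s≤s (s≤s z≤n)))))) (cong n₂ (N∸ i≤top)))))))))))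
        where
        i = 6 ℕ.+ j
        i≤top : i ≤ top
        i≤top = subst (i ≤_) (sym top≡7+L) (ℕP.+-mono-≤ (ℕP.m≤m+n 6 1) (ℕP.<⇒≤ j<L))
        Pc≡ : P * coef i ≡ (ι i - (+ 2 / 1)) * bᵣ i
        Pc≡ = trans (P-coef i (s≤s z≤n)) (cong ((ι i - (+ 2 / 1)) *_) (sym (restrict-in P𝓑 (s≤s (s≤s z≤n)) i≤top)))
        V-i : V 0 (ι i - (+ 2 / 1))
        V-i = V-- (V-ι i) (V-ι 2)
        V-Pc : V 1 (P * coef i)
        V-Pc = V-resp (sym Pc≡) (V-*ˡ V-i (V-bᵣ i))

    g-sum : ∑ (suc N) g ≡ U - (+ 2 / 1) * W
    g-sum = trans (∑-cong (suc N) (λ i _ → solve 3 (λ k n q → (k :- con (+ 2 / 1)) :* (n :* q) := k :* n :* q :- con (+ 2 / 1) :* (n :* q)) refl (ι i) (nᵣ i) (qᵣ (N ∸ i))))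
      (trans (∑-- (suc N) (λ i → θ nᵣ i * qᵣ (N ∸ i)) (λ i → (+ 2 / 1) * (nᵣ i * qᵣ (N ∸ i))))
        (cong₂ _-_ (sym (⋆-∑ N (θ nᵣ) qᵣ)) (trans (∑-*ˡ (suc N) (+ 2 / 1) (λ i → nᵣ i * qᵣ (N ∸ i))) (cong ((+ 2 / 1) *_) (sym (⋆-∑ N nᵣ qᵣ))))))

    g-n : ∀ {i} → nᵣ i ≡ 0ℚ → g i ≡ 0ℚ
    g-n {i} e = trans (cong (λ t → (ι i - (+ 2 / 1)) * (t * qᵣ (N ∸ i))) e) (solve 2 (λ a b → a :* (con 0ℚ :* b) := con 0ℚ) refl (ι i - (+ 2 / 1)) (qᵣ (N ∸ i)))

    g-q : ∀ {i} → qᵣ (N ∸ i) ≡ 0ℚ → g i ≡ 0ℚ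
    g-q {i} e = trans (cong (λ t → (ι i - (+ 2 / 1)) * (nᵣ i * t)) e) (solve 2 (λ a b → a :* (b :* con 0ℚ) := con 0ℚ) refl (ι i - (+ 2 / 1)) (nᵣ i))

    g-odd : ∀ {i} → Odd i → g i ≈[ 4 ] 0ℚ
    g-odd {i} o = V⇒≈0 (V-*ˡ (V-- (V-ι i) (V-ι 2)) (V-≤ (ℕP.m≤m+n 4 1) (V-*ʳ (nᵣ-odd o) (V0-qᵣ (N ∸ i)))))

    g-4 : g 4 ≡ (+ 2 / 1) * (n 4 * n₂ top)
    g-4 = cong₂ (λ s t → (+ 2 / 1) * (s * t)) (nᵣ-in (s≤s (s≤s z≤n)) 4≤top) (trans (cong qᵣ N-4) (qᵣ-in top-even 4≤top ℕP.≤-refl))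

    N≡4+top : N ≡ 4 ℕ.+ top
    N≡4+top = cong (2 ℕ.+_) (sym 2+top)

    g-top : g top ≡ (P - (+ 5 / 1)) * (n top * n₂ 4)
    g-top = cong₂ _*_ (trans (cong (_- (+ 2 / 1)) ιtop) (solve 1 (λ x → x :- con (+ 3 / 1) :- con (+ 2 / 1) := x :- con (+ 5 / 1)) refl P))
      (cong₂ _*_ (nᵣ-in 2≤top ℕP.≤-refl) (trans (cong qᵣ (trans (cong (_∸ top) N≡4+top) (ℕP.m+n∸n≡m 4 top))) (qᵣ-in (2 , refl) ℕP.≤-refl 4≤top)))

    lengths : suc N ≡ 6 ℕ.+ (L ℕ.+ 6)
    lengths = trans (cong suc (trans N≡4+top (cong (4 ℕ.+_) top≡7+L))) (cong (6 ℕ.+_) (ℕP.+-comm 6 L))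

    -- The range [6, p-5] omits from the full convolution only i = 4 and i = p-3. The odd neighbours
    -- 5 and p-4 are negligible, and 2 and 3 have partners beyond p - 3.
    g-split : ∑ (suc N) g ≈[ 4 ] (+ 2 / 1) * (n 4 * n₂ top) + (∑ L (λ j → g (6 ℕ.+ j)) + (P - (+ 5 / 1)) * (n top * n₂ 4))
    g-split = ≈-trans (≈-reflexive (trans (cong (λ t → ∑ t g) lengths) (cong (λ t → g 0 + (g 1 + (g 2 + (g 3 + (g 4 + (g 5 + t)))))) (∑-split L 6 (λ j → g (6 ℕ.+ j))))))
      (≈-trans (≈-+ (≈-reflexive (g-n {0} (restrict-low n (s≤s z≤n)))) (≈-+ (≈-reflexive (g-n {1} (restrict-low n (s≤s (s≤s z≤n)))))
          (≈-+ (≈-reflexive (g-q {2} (qᵣ-high top<M))) (≈-+ (≈-reflexive (g-q {3} (qᵣ-high (subst (top <_) (cong (_∸ 1) 2+top) ℕP.≤-refl))))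
            (≈-+ (≈-reflexive g-4) (≈-+ (g-odd {5} (2 , refl)) (≈-+ (≈-refl {x = S}) upper)))))))
        (≈-reflexive (solve 3 (λ a s b → con 0ℚ :+ (con 0ℚ :+ (con 0ℚ :+ (con 0ℚ :+ (a :+ (con 0ℚ :+ (s :+ b)))))) := a :+ (s :+ b)) refl
          ((+ 2 / 1) * (n 4 * n₂ top)) S ((P - (+ 5 / 1)) * (n top * n₂ 4)))))
      where
      S = ∑ L (λ j → g (6 ℕ.+ j))
      k = 6 ℕ.+ L
      k-odd : Odd k
      k-odd = subst Odd (cong (_∸ 1) top≡7+L) (odd-pred top-even (ℕP.≤-trans (s≤s z≤n) 8≤top))
      beyond : ∀ j → 2 ≤ j → top < j ℕ.+ k
      beyond j 2≤j = subst (_< j ℕ.+ k) (sym top≡7+L) (ℕP.+-monoˡ-≤ k 2≤j)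
      high : ∀ j → 2 ≤ j → g (j ℕ.+ k) ≈[ 4 ] 0ℚ
      high j h = ≈-reflexive (g-n (restrict-high n (beyond j h)))
      upper : ∑ 6 (λ j → g (6 ℕ.+ (L ℕ.+ j))) ≈[ 4 ] (P - (+ 5 / 1)) * (n top * n₂ 4)
      upper = ≈-trans (≈-reflexive (∑-cong 6 (λ j _ → cong g (trans (cong (6 ℕ.+_) (ℕP.+-comm L j)) (trans (sym (ℕP.+-assoc 6 j L)) (trans (cong (ℕ._+ L) (ℕP.+-comm 6 j)) (ℕP.+-assoc j 6 L)))))))
        (≈-trans (≈-+ (g-odd k-odd) (≈-+ (≈-reflexive (trans (cong g (sym top≡7+L)) g-top)) (≈-+ (high 2 ℕP.≤-refl) (≈-+ (high 3 (ℕP.m≤m+n 2 1)) (≈-+ (high 4 (ℕP.m≤m+n 2 2)) (≈-+ (high 5 (ℕP.m≤m+n 2 3)) ≈-refl))))))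
          (≈-reflexive (solve 1 (λ a → con 0ℚ :+ (a :+ (con 0ℚ :+ (con 0ℚ :+ (con 0ℚ :+ (con 0ℚ :+ con 0ℚ))))) := a) refl ((P - (+ 5 / 1)) * (n top * n₂ 4)))))

    σ-≈ : P * P * P * doubleSum ≈[ 4 ] U - (+ 2 / 1) * W - (+ 2 / 1) * n 4 * n₂ top + (+ 5 / 1) * n top * n₂ 4
    σ-≈ = ≈-trans doubleSum-g (mk≈ (V-resp
        (trans (cong (λ t → - (t - ((+ 2 / 1) * (n 4 * n₂ top) + (S + (P - (+ 5 / 1)) * (n top * n₂ 4)))) - P * (n top * n₂ 4)) g-sum)
          (solve 8 (λ p u w a b s x y → :- (u :- con (+ 2 / 1) :* w :- (con (+ 2 / 1) :* (a :* b) :+ (s :+ (p :- con (+ 5 / 1)) :* (x :* y)))) :- p :* (x :* y)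
            := s :- (u :- con (+ 2 / 1) :* w :- con (+ 2 / 1) :* a :* b :+ con (+ 5 / 1) :* x :* y)) refl P U W (n 4) (n₂ top) S (n top) (n₂ 4)))
        (V-- (V-neg (diff g-split)) (V-* V-p (V-* (V-n top) (V-n₂ 4))))))
      where S = ∑ L (λ j → g (6 ℕ.+ j))

  -- The multiple harmonic sum

  -- e₀, e₁, e₂ denote elementary symmetric functions of lo, lo + 1, …, lo + d - 1; product is e_d.
  product : ℕ → ℕ → ℚ
  product zero lo = 1ℚ
  product (suc d) lo = ι lo * product d (suc lo)

  e₁ : ℕ → ℕ → ℚ
  e₁ zero lo = 0ℚ
  e₁ (suc d) lo = ι lo + e₁ d (suc lo)

  e₂ : ℕ → ℕ → ℚ
  e₂ zero lo = 0ℚ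
  e₂ (suc d) lo = ι lo * e₁ d (suc lo) + e₂ d (suc lo)

  product-! : ∀ d lo → ι (lo !) * product d (suc lo) ≡ ι ((lo ℕ.+ d) !)
  product-! zero lo = trans (ℚP.*-identityʳ _) (cong (λ t → ι (t !)) (sym (ℕP.+-identityʳ lo)))
  product-! (suc d) lo = trans (solve 3 (λ a b c → a :* (b :* c) := (b :* a) :* c) refl (ι (lo !)) (ι (suc lo)) (product d (suc (suc lo))))
    (trans (cong (_* product d (suc (suc lo))) (sym (ι-* (suc lo) (lo !)))) (trans (product-! d (suc lo)) (cong (λ t → ι (t !)) (sym (ℕP.+-suc lo d)))))

  e₁-closed : ∀ d lo → e₁ d lo ≡ ι d * ι lo + (+ 1 / 2) * (ι d * (ι d - 1ℚ))
  e₁-closed zero lo = solve 1 (λ l → con 0ℚ := con 0ℚ :* l :+ con (+ 1 / 2) :* (con 0ℚ :* (con 0ℚ :- con 1ℚ))) refl (ι lo)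
  e₁-closed (suc d) lo = trans (cong (_+_ (ι lo)) (e₁-closed d (suc lo))) (trans (cong (λ t → ι lo + (ι d * t + (+ 1 / 2) * (ι d * (ι d - 1ℚ)))) (ι-suc lo))
    (trans (solve 2 (λ l d → l :+ (d :* (con 1ℚ :+ l) :+ con (+ 1 / 2) :* (d :* (d :- con 1ℚ))) := (con 1ℚ :+ d) :* l :+ con (+ 1 / 2) :* ((con 1ℚ :+ d) :* ((con 1ℚ :+ d) :- con 1ℚ))) refl (ι lo) (ι d))
      (cong (λ t → t * ι lo + (+ 1 / 2) * (t * (t - 1ℚ))) (sym (ι-suc d)))))

  -- (e₁² - p₂)/2, where p₂ = d l² + l d(d-1) + d(d-1)(2d-1)/6 is the sum of the squares of l, ...,
  -- l+d-1.
  e₂-poly : ℚ → ℚ → ℚ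
  e₂-poly d l = (+ 1 / 2) * ((d * l + (+ 1 / 2) * (d * (d - 1ℚ))) * (d * l + (+ 1 / 2) * (d * (d - 1ℚ)))
    - (d * l * l + l * d * (d - 1ℚ) + (+ 1 / 6) * d * (d - 1ℚ) * ((+ 2 / 1) * d - 1ℚ)))

  e₂-closed : ∀ d lo → e₂ d lo ≡ e₂-poly (ι d) (ι lo)
  e₂-closed zero lo = solve 1 (λ l → con 0ℚ := con (+ 1 / 2) :* ((con 0ℚ :* l :+ con 0ℚ) :* (con 0ℚ :* l :+ con 0ℚ) :- (con 0ℚ :* l :* l :+ l :* con 0ℚ :* con (0ℚ - 1ℚ) :+ con 0ℚ))) refl (ι lo)
  e₂-closed (suc d) lo = trans (cong₂ (λ s t → ι lo * s + t) (e₁-closed d (suc lo)) (e₂-closed d (suc lo)))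
    (trans (cong (λ t → ι lo * (ι d * t + (+ 1 / 2) * (ι d * (ι d - 1ℚ))) + e₂-poly (ι d) t) (ι-suc lo))
    (trans (solve 2 (λ l d → l :* (d :* (con 1ℚ :+ l) :+ con (+ 1 / 2) :* (d :* (d :- con 1ℚ))) :+ poly d (con 1ℚ :+ l) := poly (con 1ℚ :+ d) l) refl (ι lo) (ι d))
      (cong (λ t → e₂-poly t (ι lo)) (sym (ι-suc d)))))
    where
    open +-*-Solver using (Polynomial)
    poly : ∀ {n} → Polynomial n → Polynomial n → Polynomial n
    poly d l = con (+ 1 / 2) :* ((d :* l :+ con (+ 1 / 2) :* (d :* (d :- con 1ℚ))) :* (d :* l :+ con (+ 1 / 2) :* (d :* (d :- con 1ℚ)))
      :- (d :* l :* l :+ l :* d :* (d :- con 1ℚ) :+ con (+ 1 / 6) :* d :* (d :- con 1ℚ) :* (con (+ 2 / 1) :* d :- con 1ℚ)))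

  module _ (p : ℕ) where

    incSum-step : ∀ k lo d → lo ℕ.+ suc d ≡ suc (p ∸ 1) →
      incSum p (suc k) lo ≡ recipℕ lo * incSum p k (suc lo) + incSum p (suc k) (suc lo)
    incSum-step k lo d eq = trans (sumFT≡∑ lo (p ∸ 1) f) (trans (cong (λ t → ∑ t (λ i → f (lo ℕ.+ i))) len)
      (cong₂ _+_ (cong f (ℕP.+-identityʳ lo)) (trans (∑-cong (p ∸ 1 ∸ lo) (λ i _ → cong f (ℕP.+-suc lo i))) (sym (sumFT≡∑ (suc lo) (p ∸ 1) f)))))
      where
      f : ℕ → ℚ
      f i = recipℕ i * incSum p k (suc i)
      len : suc (p ∸ 1) ∸ lo ≡ suc (p ∸ 1 ∸ lo)
      len = ℕP.+-∸-assoc 1 (subst (lo ≤_) (ℕP.suc-injective (trans (sym (ℕP.+-suc lo d)) eq)) (ℕP.m≤m+n lo d))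

    -- There is no strictly increasing choice of more than `d` indices among `d`.
    incSum-zero : ∀ d k lo → lo ℕ.+ d ≡ suc (p ∸ 1) → incSum p (suc (d ℕ.+ k)) lo ≡ 0ℚ
    incSum-zero zero k lo eq = trans (sumFT≡∑ lo (p ∸ 1) (λ i → recipℕ i * incSum p k (suc i)))
      (cong (λ t → ∑ t (λ i → recipℕ (lo ℕ.+ i) * incSum p k (suc (lo ℕ.+ i)))) (trans (cong (_∸ lo) (trans (sym eq) (ℕP.+-identityʳ lo))) (ℕP.n∸n≡0 lo)))
    incSum-zero (suc d) k lo eq = trans (incSum-step (suc (d ℕ.+ k)) lo d eq)
      (trans (cong₂ (λ s t → recipℕ lo * s + t) (incSum-zero d k (suc lo) eq′) (trans (cong (λ t → incSum p (suc t) (suc lo)) (sym (ℕP.+-suc d k))) (incSum-zero d (suc k) (suc lo) eq′)))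
        (solve 1 (λ a → a :* con 0ℚ :+ con 0ℚ := con 0ℚ) refl (recipℕ lo)))
      where eq′ = trans (sym (ℕP.+-suc lo d)) eq

    private
      distribute : ∀ lo .{{_ : NonZero lo}} a b c → (recipℕ lo * a + b) * (ι lo * c) ≡ a * c + ι lo * (b * c)
      distribute lo a b c = trans (solve 5 (λ r l a b c → (r :* a :+ b) :* (l :* c) := (l :* r) :* (a :* c) :+ l :* (b :* c)) refl (recipℕ lo) (ι lo) a b c)
        (cong (_+ ι lo * (b * c)) (trans (cong (_* (a * c)) (ι-recip lo)) (ℚP.*-identityˡ (a * c))))

    -- Clearing denominators turns a sum of reciprocals over subsets into a sum over complements.
    -- Codegrees 0, 1, 2 are handled in turn, each step splitting on whether the least index `lo` is
    -- chosen.
    incSum-e₀ : ∀ d lo → lo ℕ.+ d ≡ suc (p ∸ 1) → .{{_ : NonZero lo}} → incSum p d lo * product d lo ≡ 1ℚ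
    incSum-e₀ zero lo eq = refl
    incSum-e₀ (suc d) lo eq = trans (cong (_* (ι lo * product d (suc lo))) (incSum-step d lo d eq))
      (trans (distribute lo _ _ _) (trans (cong₂ (λ s t → s + ι lo * (t * product d (suc lo))) (incSum-e₀ d (suc lo) eq′)
          (trans (cong (λ t → incSum p (suc t) (suc lo)) (sym (ℕP.+-identityʳ d))) (incSum-zero d 0 (suc lo) eq′)))
        (solve 2 (λ a b → con 1ℚ :+ a :* (con 0ℚ :* b) := con 1ℚ) refl (ι lo) (product d (suc lo)))))
      where eq′ = trans (sym (ℕP.+-suc lo d)) eq

    incSum-e₁ : ∀ d lo → lo ℕ.+ suc d ≡ suc (p ∸ 1) → .{{_ : NonZero lo}} → incSum p d lo * product (suc d) lo ≡ e₁ (suc d) lo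
    incSum-e₁ zero lo eq = solve 1 (λ l → con 1ℚ :* (l :* con 1ℚ) := l :+ con 0ℚ) refl (ι lo)
    incSum-e₁ (suc d) lo eq = trans (cong (_* (ι lo * product (suc d) (suc lo))) (incSum-step d lo (suc d) eq))
      (trans (distribute lo _ _ _) (trans (cong₂ (λ s t → s + ι lo * t) (incSum-e₁ d (suc lo) eq′) (incSum-e₀ (suc d) (suc lo) eq′))
        (solve 2 (λ a b → a :+ b :* con 1ℚ := b :+ a) refl (e₁ (suc d) (suc lo)) (ι lo))))
      where eq′ = trans (sym (ℕP.+-suc lo (suc d))) eq

    incSum-e₂ : ∀ d lo → lo ℕ.+ suc (suc d) ≡ suc (p ∸ 1) → .{{_ : NonZero lo}} → incSum p d lo * product (suc (suc d)) lo ≡ e₂ (suc (suc d)) lo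
    incSum-e₂ zero lo eq = solve 2 (λ l m → con 1ℚ :* (l :* (m :* con 1ℚ)) := l :* (m :+ con 0ℚ) :+ (m :* con 0ℚ :+ con 0ℚ)) refl (ι lo) (ι (suc lo))
    incSum-e₂ (suc d) lo eq = trans (cong (_* (ι lo * product (suc (suc d)) (suc lo))) (incSum-step d lo (suc (suc d)) eq))
      (trans (distribute lo _ _ _) (trans (cong₂ (λ s t → s + ι lo * t) (incSum-e₂ d (suc lo) eq′) (incSum-e₁ (suc d) (suc lo) eq′))
        (ℚP.+-comm (e₂ (suc (suc d)) (suc lo)) _)))
      where eq′ = trans (sym (ℕP.+-suc lo (suc (suc d)))) eq

    Astar-closed : 3 ≤ p → Astar p (p ∸ 3) * ι ((p ∸ 1) !) ≡ (+ 1 / 24) * ι p * (ι p - 1ℚ) * (ι p - (+ 2 / 1)) * ((+ 3 / 1) * ι p - 1ℚ)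
    Astar-closed 3≤p = trans (cong (Astar p (p ∸ 3) *_) (trans (cong (λ t → ι (t !)) (sym M≡)) (sym (trans (sym (ℚP.*-identityˡ _)) (product-! (suc (suc (p ∸ 3))) 0)))))
      (trans (incSum-e₂ (p ∸ 3) 1 (cong suc M≡)) (trans (e₂-closed (suc (suc (p ∸ 3))) 1)
        (trans (cong (λ t → e₂-poly t 1ℚ) (trans (cong ι M≡) (ι-∸ (ℕP.≤-trans (s≤s z≤n) 3≤p))))
          (solve 1 (λ x → let d = x :- con 1ℚ; l = con 1ℚ in con (+ 1 / 2) :* ((d :* l :+ con (+ 1 / 2) :* (d :* (d :- con 1ℚ))) :* (d :* l :+ con (+ 1 / 2) :* (d :* (d :- con 1ℚ)))
      :- (d :* l :* l :+ l :* d :* (d :- con 1ℚ) :+ con (+ 1 / 6) :* d :* (d :- con 1ℚ) :* (con (+ 2 / 1) :* d :- con 1ℚ)))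
            := con (+ 1 / 24) :* x :* (x :- con 1ℚ) :* (x :- con (+ 2 / 1)) :* (con (+ 3 / 1) :* x :- con 1ℚ)) refl (ι p)))))
      where
      M≡ : suc (suc (p ∸ 3)) ≡ p ∸ 1
      M≡ = sym (ℕP.+-∸-assoc 2 3≤p)

  -- The final congruence

  -- bracket′ is the parenthesised factor of the theorem with the powers of p absorbed into the Bernoulli numbers.
  bracket′ : (P β b₁ b₂ b₃ z₁ z₂ T γ K ω τ σ : ℚ) → ℚ
  bracket′ P β b₁ b₂ b₃ z₁ z₂ T γ K ω τ σ =
      (+ 37 / 12) * P * P * P - (+ 3 / 1) * P * P + (+ 3 / 4) * P - P * P * β
    + (+ 3 / 1) * (P - (+ 3 / 1)) * b₁
    - (P - (+ 3 / 1) + (+ 11 / 2) * P * P * P) * b₂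
    + (P - (+ 5 / 1)) * (b₃ + (+ 1 / 60) * P) * ((+ 2 / 1) * z₁ - z₂)
    + (+ 2 / 1) * (z₂ - (+ 2 / 1) * z₁) * (- ((+ 1 / 60) * P) - b₃ + (+ 1 / 2) * ((+ 7 / 720) * P * P + (+ 2 / 1) * b₃ - (+ 1 / 60) * P * β))
    - (+ 1 / 2) * ((+ 4 / 3) * T - γ * ((+ 1 / 4) * P) + K * ((+ 1 / 24) * P) - (+ 1 / 144) * P * P * ((P - (+ 2 / 1)) * z₁))
    + (1ℚ + ω) * ((+ 1 / 2) * (P - (+ 3 / 1))) * (- ((+ 1 / 60) * P) * z₁ - τ)
    - (+ 1 / 2) * σ

  bracketᵖ : ∀ {m} → (P β b₁ b₂ b₃ z₁ z₂ T γ K ω τ σ : Polynomial m) → Polynomial m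
  bracketᵖ P β b₁ b₂ b₃ z₁ z₂ T γ K ω τ σ =
       c (+ 37 / 12) :* P :* P :* P :- c (+ 3 / 1) :* P :* P :+ c (+ 3 / 4) :* P :- P :* P :* β
    :+ c (+ 3 / 1) :* (P :- c (+ 3 / 1)) :* b₁
    :- (P :- c (+ 3 / 1) :+ c (+ 11 / 2) :* P :* P :* P) :* b₂
    :+ (P :- c (+ 5 / 1)) :* (b₃ :+ c (+ 1 / 60) :* P) :* (c (+ 2 / 1) :* z₁ :- z₂)
    :+ c (+ 2 / 1) :* (z₂ :- c (+ 2 / 1) :* z₁) :* (:- (c (+ 1 / 60) :* P) :- b₃ :+ c (+ 1 / 2) :* (c (+ 7 / 720) :* P :* P :+ c (+ 2 / 1) :* b₃ :- c (+ 1 / 60) :* P :* β))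
    :- c (+ 1 / 2) :* (c (+ 4 / 3) :* T :- γ :* (c (+ 1 / 4) :* P) :+ K :* (c (+ 1 / 24) :* P) :- c (+ 1 / 144) :* P :* P :* ((P :- c (+ 2 / 1)) :* z₁))
    :+ (c 1ℚ :+ ω) :* (c (+ 1 / 2) :* (P :- c (+ 3 / 1))) :* (:- (c (+ 1 / 60) :* P) :* z₁ :- τ)
    :- c (+ 1 / 2) :* σ
    where
    c : ∀ {m} → ℚ → Polynomial m
    c = con

  module Assembly (p : ℕ) (pp : Prime p) (11≤p : 11 ≤ p) where
    open Order p pp 11≤p

    -- n₀, n₂, n₄, z are the moments n k for k = 0, 2, 4, p-3; H, M₁, Q, Q₄, Qz the second moments for k = 0, 1, 2, 4, p-3; N₃ is the third
    -- moment for k = 2.  b₁, b₂, b₃ and z₁, z₂ stand for p 𝓑 j with j = p+1, 2p, p+3, p-3, 2p-4, and every δ for an error term.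
    assembly : ∀ {P n₀ n₂ n₄ z Q N₃ H K Q₄ Qz T D W G U M₁ β ω b₁ b₂ b₃ z₁ z₂ τ σ γ fact}
      {δn₂ δD δW δM δG δU δn₄ δQz δβ δω δ₁ δ₂ δ₃ δz₁ δz₂ δτ δσ δγ δf} →
      V 1 P → V 1 n₀ → V 1 z → V 2 Q → V 3 N₃ → V 2 H → V 2 K → V 2 Q₄ → V 3 T →
      V 4 δn₂ → V 4 δD → V 4 δW → V 3 δM → V 3 δG → V 4 δU → V 3 δn₄ → V 3 δQz → V 2 δβ → V 2 δω →
      V 4 δ₁ → V 4 δ₂ → V 3 δ₃ → V 3 δz₁ → V 3 δz₂ → V 4 δτ → V 4 δσ → V 3 δγ → V 3 δf →
      n₂ ≡ (+ 1 / 2) * ((+ 1 / 6) * P * (P - 1ℚ) * ((+ 2 / 1) * P - 1ℚ) - Q) + δn₂ →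
      D ≡ (P - 1ℚ) * Q - (+ 2 / 1) * n₀ * n₂ - (+ 1 / 4) * P * P * (P - 1ℚ) * (P - 1ℚ) + δD →
      M₁ ≡ P * n₀ + δM →
      W ≡ (P - 1ℚ) * N₃ - n₀ * Q - (+ 1 / 2) * P * (P - 1ℚ) * M₁ - n₂ * H + δW →
      G ≡ (P - 1ℚ) * H - n₀ * n₀ + δG →
      U ≡ - (n₀ * D) - (+ 1 / 3) * T + (+ 2 / 1) * n₂ * G + δU →
      n₄ ≡ - ((+ 1 / 120) * P) - (+ 3 / 2) * Q₄ + δn₄ →
      Qz ≡ - ((+ 2 / 1) * n₀ * z) - K + δQz →
      β ≡ P - 1ℚ - n₀ + δβ →
      ω ≡ - n₀ + δω →
      b₁ ≡ n₂ + (+ 1 / 2) * P * Q + (+ 1 / 6) * P * P * P + δ₁ →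
      b₂ ≡ n₂ + (+ 1 / 2) * ((+ 2 / 1) * P - 1ℚ) * Q + (+ 1 / 3) * N₃ - (+ 1 / 6) * ((+ 2 / 1) * P - 1ℚ) * P * P * (P - 1ℚ - (+ 2 / 1) * n₀) + δ₂ →
      b₃ ≡ n₄ + (+ 1 / 2) * (P + (+ 2 / 1)) * Q₄ + δ₃ →
      z₁ ≡ z + (+ 1 / 2) * (P - (+ 4 / 1)) * Qz + δz₁ →
      z₂ ≡ z + (+ 1 / 2) * ((+ 2 / 1) * P - (+ 5 / 1)) * Qz + δz₂ →
      τ ≡ D - U + δτ →
      σ ≡ U - (+ 2 / 1) * W - (+ 2 / 1) * n₄ * Qz + (+ 5 / 1) * z * Q₄ + δσ →
      γ ≡ G + δγ →
      fact ≡ - (1ℚ + n₀ + (+ 1 / 2) * (n₀ * n₀ - H)) + δf →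
      V 4 ((+ 1 / 24) * (P - (+ 3 / 1)) * P * (P - 1ℚ) * (P - (+ 2 / 1)) * ((+ 3 / 1) * P - 1ℚ)
        + fact * bracket′ P β b₁ b₂ b₃ z₁ z₂ T γ K ω τ σ)
    assembly vP v₀ vz vQ v₃ vH vK v₄ vT w₁ w₂ w₃ w₄ w₅ w₆ w₇ w₈ w₉ w₁₀ w₁₁ w₁₂ w₁₃ w₁₄ w₁₅ w₁₆ w₁₇ w₁₈ w₁₉
      refl refl refl refl refl refl refl refl refl refl refl refl refl refl refl refl refl refl refl =
      -- With the equations matched by `refl`, everything is a polynomial in 28 variables, 19 of
      -- them error terms; one expansion below weight 4 performs all the cancellations.
      V-poly (vP ∷ v₀ ∷ vz ∷ vQ ∷ v₃ ∷ vH ∷ vK ∷ v₄ ∷ vT ∷ w₁ ∷ w₂ ∷ w₃ ∷ w₄ ∷ w₅ ∷ w₆ ∷ w₇ ∷ w₈ ∷ w₉ ∷ w₁₀ ∷ w₁₁ ∷ w₁₂ ∷ w₁₃ ∷ w₁₄ ∷ w₁₅ ∷ w₁₆ ∷ w₁₇ ∷ w₁₈ ∷ w₁₉ ∷ []) 4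
        (λ P n₀ z Q N₃ H K Q₄ T δn₂ δD δW δM δG δU δn₄ δQz δβ δω δ₁ δ₂ δ₃ δz₁ δz₂ δτ δσ δγ δf →
          let n₂ = c (+ 1 / 2) :* (c (+ 1 / 6) :* P :* (P :- c 1ℚ) :* (c (+ 2 / 1) :* P :- c 1ℚ) :- Q) :+ δn₂
              D = (P :- c 1ℚ) :* Q :- c (+ 2 / 1) :* n₀ :* n₂ :- c (+ 1 / 4) :* P :* P :* (P :- c 1ℚ) :* (P :- c 1ℚ) :+ δD
              M₁ = P :* n₀ :+ δM
              W = (P :- c 1ℚ) :* N₃ :- n₀ :* Q :- c (+ 1 / 2) :* P :* (P :- c 1ℚ) :* M₁ :- n₂ :* H :+ δW
              G = (P :- c 1ℚ) :* H :- n₀ :* n₀ :+ δG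
              U = :- (n₀ :* D) :- c (+ 1 / 3) :* T :+ c (+ 2 / 1) :* n₂ :* G :+ δU
              n₄ = :- (c (+ 1 / 120) :* P) :- c (+ 3 / 2) :* Q₄ :+ δn₄
              Qz = :- (c (+ 2 / 1) :* n₀ :* z) :- K :+ δQz
              β = P :- c 1ℚ :- n₀ :+ δβ
              ω = :- n₀ :+ δω
              b₁ = n₂ :+ c (+ 1 / 2) :* P :* Q :+ c (+ 1 / 6) :* P :* P :* P :+ δ₁
              b₂ = n₂ :+ c (+ 1 / 2) :* (c (+ 2 / 1) :* P :- c 1ℚ) :* Q :+ c (+ 1 / 3) :* N₃ :- c (+ 1 / 6) :* (c (+ 2 / 1) :* P :- c 1ℚ) :* P :* P :* (P :- c 1ℚ :- c (+ 2 / 1) :* n₀) :+ δ₂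
              b₃ = n₄ :+ c (+ 1 / 2) :* (P :+ c (+ 2 / 1)) :* Q₄ :+ δ₃
              z₁ = z :+ c (+ 1 / 2) :* (P :- c (+ 4 / 1)) :* Qz :+ δz₁
              z₂ = z :+ c (+ 1 / 2) :* (c (+ 2 / 1) :* P :- c (+ 5 / 1)) :* Qz :+ δz₂
              τ = D :- U :+ δτ
              σ = U :- c (+ 2 / 1) :* W :- c (+ 2 / 1) :* n₄ :* Qz :+ c (+ 5 / 1) :* z :* Q₄ :+ δσ
              γ = G :+ δγ
              fact = :- (c 1ℚ :+ n₀ :+ c (+ 1 / 2) :* (n₀ :* n₀ :- H)) :+ δf
          in c (+ 1 / 24) :* (P :- c (+ 3 / 1)) :* P :* (P :- c 1ℚ) :* (P :- c (+ 2 / 1)) :* (c (+ 3 / 1) :* P :- c 1ℚ)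
            :+ fact :* bracketᵖ P β b₁ b₂ b₃ z₁ z₂ T γ K ω τ σ) refl
      where
      c : ∀ {n} → ℚ → Polynomial n
      c = con

  -- Written in the exact shape of the statement, so that `result` has the required type by
  -- unfolding.
  bracket : (P t t₅ B₁ b₁ B₂ b₃ z Bz z₂ 𝓉 c₁ c₃ ω τ σ : ℚ) → ℚ
  bracket P t t₅ B₁ b₁ B₂ b₃ z Bz z₂ 𝓉 c₁ c₃ ω τ σ =
      (+ 37 / 12) * P * P * P - (+ 3 / 1) * P * P + (+ 3 / 4) * P - P * P * (P * B₁)
    + (+ 3 / 1) * P * t * b₁ - (+ 1 / 2) * (t + (+ 11 / 2) * P * P * P) * B₂
    + P * P * t₅ * (b₃ - (+ 2 / 1) * 𝓑 4) * ((+ 2 / 1) * z - z₂)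
    + (+ 2 / 1) * P * (z₂ - (+ 2 / 1) * z)
        * ( P * ((+ 2 / 1) * 𝓑 4 - b₃) + (+ 1 / 2) * ( (+ 7 / 720) * P * P + (+ 2 / 1) * P * b₃ + (+ 2 / 1) * P * 𝓑 4 * (P * B₁) ) )
    - (+ 1 / 2) * P * P * P
        * ( (+ 4 / 3) * 𝓉 - c₁ * (𝓑 2 + B 2) - c₃ * (𝓑 4 + B 4) - 𝓑 2 * 𝓑 2 * (z + Bz) )
    + P * P * (1ℚ + P * ω) * ((+ 1 / 2) * t) * ((+ 2 / 1) * 𝓑 4 * z - τ)
    - (+ 1 / 2) * P * P * P * σ

  -- An exact identity. The constants of `bracket′` are 1/4 = 𝓑 2 + B 2, 1/24 = -(𝓑 4 + B 4), 1/60 =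
  -- -2 𝓑 4 and 1/144 = (𝓑 2)².
  bracket-≡ : ∀ P {t t₅ B₁ b₁ B₂ b₂ b₃ z Bz z₂ 𝓉 c₁ c₃ ω τ σ} → t ≡ P - (+ 3 / 1) → t₅ ≡ P - (+ 5 / 1) → B₂ ≡ (+ 2 / 1) * (P * b₂) → Bz ≡ (P - (+ 3 / 1)) * z →
    bracket P t t₅ B₁ b₁ B₂ b₃ z Bz z₂ 𝓉 c₁ c₃ ω τ σ ≡
    bracket′ P (P * B₁) (P * b₁) (P * b₂) (P * b₃) (P * z) (P * z₂) (P * P * P * 𝓉) (P * P * c₁) (P * P * c₃) (P * ω) (P * P * τ) (P * P * P * σ)
  bracket-≡ P {B₁ = B₁} {b₁} {_} {b₂} {b₃} {z} {_} {z₂} {𝓉} {c₁} {c₃} {ω} {τ} {σ} refl refl refl refl =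
    solve 13 (λ P B₁ b₁ b₂ b₃ z z₂ 𝓉 c₁ c₃ ω τ σ →
        c (+ 37 / 12) :* P :* P :* P :- c (+ 3 / 1) :* P :* P :+ c (+ 3 / 4) :* P :- P :* P :* (P :* B₁)
      :+ c (+ 3 / 1) :* P :* (P :- c (+ 3 / 1)) :* b₁ :- c (+ 1 / 2) :* (P :- c (+ 3 / 1) :+ c (+ 11 / 2) :* P :* P :* P) :* (c (+ 2 / 1) :* (P :* b₂))
      :+ P :* P :* (P :- c (+ 5 / 1)) :* (b₃ :- c (+ 2 / 1) :* c (𝓑 4)) :* (c (+ 2 / 1) :* z :- z₂)
      :+ c (+ 2 / 1) :* P :* (z₂ :- c (+ 2 / 1) :* z)
          :* ( P :* (c (+ 2 / 1) :* c (𝓑 4) :- b₃) :+ c (+ 1 / 2) :* ( c (+ 7 / 720) :* P :* P :+ c (+ 2 / 1) :* P :* b₃ :+ c (+ 2 / 1) :* P :* c (𝓑 4) :* (P :* B₁) ) )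
      :- c (+ 1 / 2) :* P :* P :* P
          :* ( c (+ 4 / 3) :* 𝓉 :- c₁ :* (c (𝓑 2) :+ c (B 2)) :- c₃ :* (c (𝓑 4) :+ c (B 4)) :- c (𝓑 2) :* c (𝓑 2) :* (z :+ (P :- c (+ 3 / 1)) :* z) )
      :+ P :* P :* (c 1ℚ :+ P :* ω) :* (c (+ 1 / 2) :* (P :- c (+ 3 / 1))) :* (c (+ 2 / 1) :* c (𝓑 4) :* z :- τ)
      :- c (+ 1 / 2) :* P :* P :* P :* σ
      := bracketᵖ P (P :* B₁) (P :* b₁) (P :* b₂) (P :* b₃) (P :* z) (P :* z₂) (P :* P :* P :* 𝓉) (P :* P :* c₁) (P :* P :* c₃) (P :* ω) (P :* P :* τ) (P :* P :* P :* σ)) refl P B₁ b₁ b₂ b₃ z z₂ 𝓉 c₁ c₃ ω τ σ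
    where
    c : ∀ {n} → ℚ → Polynomial n
    c = con

  module Final (p : ℕ) (pp : Prime p) (11≤p : 11 ≤ p) where
    open DoubleSum p pp 11≤p
    open Assembly p pp 11≤p using (assembly)

    D-≈ : c N ≈[ 4 ] (P - 1ℚ) * n₂ 2 - (+ 2 / 1) * n 0 * n 2 - (+ 1 / 4) * P * P * (P - 1ℚ) * (P - 1ℚ)
    D-≈ = mk≈ (V-resp (trans (cong (λ t → - (t * n₂ 2 - ((+ 2 / 1) * n 0 * n 2 + n 1 * n 1 + c N)) - (n 1 * n 1 - h₁ * h₁)) ιM)
        (solve 6 (λ p q a b x d → :- ((p :- con 1ℚ) :* q :- (con (+ 2 / 1) :* a :* b :+ x :* x :+ d)) :- (x :* x :- con (+ 1 / 2) :* p :* (p :- con 1ℚ) :* (con (+ 1 / 2) :* p :* (p :- con 1ℚ)))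
          := d :- ((p :- con 1ℚ) :* q :- con (+ 2 / 1) :* a :* b :- con (+ 1 / 4) :* p :* p :* (p :- con 1ℚ) :* (p :- con 1ℚ))) refl P (n₂ 2) (n 0) (n 2) (n 1) (c N)))
      (V-≤ (ℕP.m≤m+n 4 1) (V-- (V-neg (diff n₂-2)) (diff (≈-* (V0-n 1) V-h₁ n-1 n-1)))))
      where
      h₁ = (+ 1 / 2) * P * (P - 1ℚ)
      V-h₁ : V 0 h₁
      V-h₁ = V-*ˡ (V-*ˡ V-½ V0-P) V0-P-1

    W-≈ : W ≈[ 4 ] (P - 1ℚ) * n₃ 2 - n 0 * n₂ 2 - (+ 1 / 2) * P * (P - 1ℚ) * n₂ 1 - n 2 * n₂ 0
    W-≈ = mk≈ (V-resp (trans (cong (λ t → - (t * n₃ 2 - (n 0 * n₂ 2 + n 1 * n₂ 1 + (n 2 * n₂ 0 + W))) - (n 1 * n₂ 1 - (+ 1 / 2) * P * (P - 1ℚ) * n₂ 1)) ιM)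
        (solve 7 (λ p r aq x m y w → :- ((p :- con 1ℚ) :* r :- (aq :+ x :* m :+ (y :+ w))) :- (x :* m :- con (+ 1 / 2) :* p :* (p :- con 1ℚ) :* m)
          := w :- ((p :- con 1ℚ) :* r :- aq :- con (+ 1 / 2) :* p :* (p :- con 1ℚ) :* m :- y)) refl P (n₃ 2) (n 0 * n₂ 2) (n 1) (n₂ 1) (n 2 * n₂ 0) W))
      (V-≤ (ℕP.m≤m+n 4 1) (V-- (V-neg (diff n₃-2)) (diff (≈-*ʳ (V0-n₂ 1) n-1)))))

    G-≈ : c M ≈[ 3 ] (P - 1ℚ) * n₂ 0 - n 0 * n 0
    G-≈ = mk≈ (V-resp (trans (cong (λ t → - (t * n₂ 0 - (n 0 * n 0 + c M))) ιM) (solve 4 (λ p q a g → :- ((p :- con 1ℚ) :* q :- (a :+ g)) := g :- ((p :- con 1ℚ) :* q :- a)) refl P (n₂ 0) (n 0 * n 0) (c M)))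
      (V-neg (V-≤ (ℕP.m≤m+n 3 2) (diff n₂-0))))

    T′ γ K′ : ℚ
    T′ = P * P * P * 𝓣 (p ℕ.+ 1)
    γ = P * P * 𝓒 M
    K′ = P * P * 𝓒 top

    T-≈ : T ≈[ 4 ] T′
    T-≈ = ≈-trans (≈-sym bbb-≈) (≈-reflexive (trans (sym 𝓣-conv) (cong (λ t → P * P * P * 𝓣 t) (sym index-p+1))))

    U-≈′ : U ≈[ 4 ] - (n 0 * c N) - (+ 1 / 3) * T′ + (+ 2 / 1) * n 2 * c M
    U-≈′ = ≈-trans U-≈ (≈-+ (≈-- (≈-refl {x = - (n 0 * c N)}) (≈-*ˡ (V-recip< 3 (≤p 4)) T-≈)) (≈-refl {x = (+ 2 / 1) * n 2 * c M}))

    γ-≈ : γ ≈[ 3 ] c M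
    γ-≈ = ≈-trans (≈-reflexive (𝓒-conv M (≤M 4) ℕP.≤-refl)) (bb-≈ M)

    τ-≈′ : P * P * 𝓣𝓒4 p ≈[ 4 ] c N - U
    τ-≈′ = ≈-trans (≈-reflexive 𝓣𝓒-conv) τ-≈

    lift : ∀ {k i j x} → i ≡ j → P * 𝓑 j ≈[ k ] x → P * 𝓑 i ≈[ k ] x
    lift refl e = e

    -- Presents a congruence as an equation with an explicit error, the form that `assembly`
    -- expects.
    δ≡ : ∀ {k x y} → x ≈[ k ] y → x ≡ y + (x - y)
    δ≡ {k} {x} {y} _ = offset x y

    assembled : V 4 ((+ 1 / 24) * (P - (+ 3 / 1)) * P * (P - 1ℚ) * (P - (+ 2 / 1)) * ((+ 3 / 1) * P - 1ℚ) + ι (M !) *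
      bracket′ P (P * B M) (P * 𝓑 (p ℕ.+ 1)) (P * 𝓑 (p ℕ.+ p)) (P * 𝓑 (p ℕ.+ 3)) (P * 𝓑 top) (P * 𝓑 (p ℕ.+ p ∸ 4)) T′ γ K′ (P * wq p) (P * P * 𝓣𝓒4 p) (P * P * P * doubleSum))
    assembled = assembly V-p (V-n 0) (V-n top) (V-n₂ 2) (V-n₃ 2) (V-n₂ 0) V-K (V-n₂ 4) (≈⇒V (≈-≤ (ℕP.m≤m+n 3 1) (≈-sym T-≈)) V-T)
        (V-≤ (ℕP.m≤m+n 4 1) (diff n-2)) (diff D-≈) (diff W-≈) (V-≤ (ℕP.m≤m+n 3 2) (diff n₂-1)) (diff G-≈) (diff U-≈′) (diff n-4) (diff n₂-top) (diff PB-M) (diff wilson-quotient)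
        (diff v₁) (diff v₂) (diff v₃) (diff 𝓑-p-3) (diff v₄) (diff τ-≈′) (diff σ-≈) (diff γ-≈) (diff factorial-≈)
        (δ≡ n-2) (δ≡ D-≈) (δ≡ n₂-1) (δ≡ W-≈) (δ≡ G-≈) (δ≡ U-≈′) (δ≡ n-4) (δ≡ n₂-top) (δ≡ PB-M) (δ≡ wilson-quotient)
        (δ≡ v₁) (δ≡ v₂) (δ≡ v₃) (δ≡ 𝓑-p-3) (δ≡ v₄) (δ≡ τ-≈′) (δ≡ σ-≈) (δ≡ γ-≈) (δ≡ factorial-≈)
      where
      V-K : V 2 K′
      V-K = V-resp (sym (𝓒-conv top 4≤top (ℕP.<⇒≤ top<M))) (V-bb top)
      v₁ = lift index-p+1 𝓑-p+1
      v₂ = lift index-2p 𝓑-2p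
      v₃ = lift index-p+3 𝓑-p+3
      v₄ = lift index-2p-4 𝓑-2p-4

    R : ℚ
    R = bracket P (ι top) (ι (p ∸ 5)) (B M) (𝓑 (p ℕ.+ 1)) (B (p ℕ.+ p)) (𝓑 (p ℕ.+ 3)) (𝓑 top) (B top) (𝓑 (p ℕ.+ p ∸ 4)) (𝓣 (p ℕ.+ 1)) (𝓒 M) (𝓒 top) (wq p) (𝓣𝓒4 p) doubleSum

    B-𝓑 : ∀ k .{{_ : ℕ.NonZero k}} → B k ≡ ι k * 𝓑 k
    B-𝓑 k = trans (sym (ℚP.*-identityʳ (B k))) (trans (cong (B k *_) (sym (ι-recip k))) (solve 3 (λ b k r → b :* (k :* r) := k :* (b :* r)) refl (B k) (ι k) (recipℕ k)))

    top≢0 : ℕ.NonZero top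
    top≢0 = ℕ.>-nonZero (ℕP.≤-trans (s≤s z≤n) 8≤top)

    -- (p-1)! and p - 3 are units modulo p, so the congruence may be multiplied by both; the left
    -- side then is p - 3 times the closed form of e₂(1, ..., p-1).
    conclusion : V 4 (Astar p top - (- recipℕ top) * R)
    conclusion = V-cancel {n = M !} (p∤! M M<p) (V-cancel {n = top} (p∤ (ℕP.≤-trans (s≤s z≤n) 8≤top) ℕP.≤-refl) (V-resp (sym scaled) assembled))
      where
      R≡ = bracket-≡ P {B₁ = B M} {b₁ = 𝓑 (p ℕ.+ 1)} {b₃ = 𝓑 (p ℕ.+ 3)} {z₂ = 𝓑 (p ℕ.+ p ∸ 4)} {𝓉 = 𝓣 (p ℕ.+ 1)} {c₁ = 𝓒 M} {c₃ = 𝓒 top} {ω = wq p} {τ = 𝓣𝓒4 p} {σ = doubleSum} ιtop (ι-∸ {p} {5} (≤p 5))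
        (trans (B-𝓑 (p ℕ.+ p) {{ℕ.>-nonZero (ℕP.≤-trans (ℕP.≤-trans (s≤s z≤n) 11≤p) (ℕP.m≤m+n p p))}}) (trans (cong (_* 𝓑 (p ℕ.+ p)) (trans (cong ι index-2p) ιK)) (ℚP.*-assoc (+ 2 / 1) P (𝓑 (p ℕ.+ p)))))
        (trans (B-𝓑 top {{top≢0}}) (cong (_* 𝓑 top) ιtop))
      scaled : ι top * (ι (M !) * (Astar p top - (- recipℕ top) * R)) ≡ _
      scaled = trans (solve 5 (λ t f a r x → t :* (f :* (a :- (:- r) :* x)) := t :* (a :* f) :+ (t :* r) :* (f :* x)) refl (ι top) (ι (M !)) (Astar p top) (recipℕ top) R)
        (trans (cong₂ (λ s t → s * (Astar p top * ι (M !)) + t * (ι (M !) * R)) ιtop (ι-recip top {{top≢0}}))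
          (cong₂ _+_ (trans (cong ((P - (+ 3 / 1)) *_) (Astar-closed p (≤p 3)))
              (solve 1 (λ x → (x :- con (+ 3 / 1)) :* (con (+ 1 / 24) :* x :* (x :- con 1ℚ) :* (x :- con (+ 2 / 1)) :* (con (+ 3 / 1) :* x :- con 1ℚ)) := con (+ 1 / 24) :* (x :- con (+ 3 / 1)) :* x :* (x :- con 1ℚ) :* (x :- con (+ 2 / 1)) :* (con (+ 3 / 1) :* x :- con 1ℚ)) refl P))
            (trans (ℚP.*-identityˡ (ι (M !) * R)) (cong (ι (M !) *_) R≡))))

    result : Astar p top ≡ (- recipℕ top) * R [mod p ^ 4 ]
    result = V⇒≡mod {Astar p top} {(- recipℕ top) * R} 4 conclusion

open import Data.Nat using (ℕ; _≤_; _∸_; _+_) renaming (_^_ to _^ᴺ_)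
open import Data.Nat.Primality using (Prime)
open import Data.Integer using (+_)
open import Data.Rational using (ℚ; _*_; _-_; -_; _/_; 1ℚ)
open import Data.Rational using () renaming (_+_ to _⊕_)

theorem4 : (p : ℕ) → Prime p → 11 ≤ p →
    Astar p (p ∸ 3) ≡
    (- recipℕ (p ∸ 3)) *
    ( (+ 37 / 12) * ι p * ι p * ι p
    - (+ 3 / 1) * ι p * ι p
    ⊕ (+ 3 / 4) * ι p
    - ι p * ι p * (ι p * B (p ∸ 1))
    ⊕ (+ 3 / 1) * ι p * ι (p ∸ 3) * 𝓑 (p + 1)
    - (+ 1 / 2) * (ι (p ∸ 3) ⊕ (+ 11 / 2) * ι p * ι p * ι p) * B (p + p)
    ⊕ ι p * ι p * ι (p ∸ 5) * (𝓑 (p + 3) - (+ 2 / 1) * 𝓑 4) * ((+ 2 / 1) * 𝓑 (p ∸ 3) - 𝓑 (p + p ∸ 4))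
    ⊕ (+ 2 / 1) * ι p * (𝓑 (p + p ∸ 4) - (+ 2 / 1) * 𝓑 (p ∸ 3))
    * ( ι p * ((+ 2 / 1) * 𝓑 4 - 𝓑 (p + 3))
    ⊕ (+ 1 / 2) * ( (+ 7 / 720) * ι p * ι p
    ⊕ (+ 2 / 1) * ι p * 𝓑 (p + 3)
    ⊕ (+ 2 / 1) * ι p * 𝓑 4 * (ι p * B (p ∸ 1)) ) )
    - (+ 1 / 2) * ι p * ι p * ι p
    * ( (+ 4 / 3) * 𝓣 (p + 1)
    - 𝓒 (p ∸ 1) * (𝓑 2 ⊕ B 2)
    - 𝓒 (p ∸ 3) * (𝓑 4 ⊕ B 4)
    - 𝓑 2 * 𝓑 2 * (𝓑 (p ∸ 3) ⊕ B (p ∸ 3)) )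
    ⊕ ι p * ι p * (1ℚ ⊕ ι p * wq p) * ((+ 1 / 2) * ι (p ∸ 3))
    * ((+ 2 / 1) * 𝓑 4 * 𝓑 (p ∸ 3) - 𝓣𝓒4 p)
    - (+ 1 / 2) * ι p * ι p * ι p
    * sumFT 1 (p ∸ 1) (λ a →
    sumFT 6 (p ∸ 5) (λ i → (B i - (+ 2 / 1) * 𝓑 i) * recipℕ (a ^ᴺ i))
    * ((ι a * fq p a) * (ι a * fq p a))) )
    [mod p ^ 4 ]
theorem4 = Proof.Final.result
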